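{- Let $\bar a=(a_1,\dots,a_s)$ be a composition of $n$, let $l$ be a positive integer with $2l\le\min_{i\in[s]}a_i$, and let $t$ be a positive real number. Then complementary sections of the chainlink polytope have the same relative volume, $$|\mathrm{CL}^t(\bar a,l)|=|\mathrm{CL}^{n-t}(\bar a,l)|.$$ In fact, their Ehrhart counting functions are identical: $\#\big(k\,\mathrm{CL}^t(\bar a,l)\cap\mathbb{Z}^s\big)=\#\big(k\,\mathrm{CL}^{n-t}(\bar a,l)\cap\mathbb{Z}^s\big)$ for every positive integer $k$.
   Context: A composition of $n$ is a tuple $\bar a=(a_1,\dots,a_s)$ of positive integers with $a_1+\dots+a_s=n$. The chainlink polytope is $$\mathrm{CL}(\bar a,l)=\{x\in\mathbb{R}^s : 0\le x_i\le a_i,\ x_i-x_{i+1}\le a_i-l \text{ for all } i\in[s]\},$$ with indices cyclic modulo $s$ (so $x_{s+1}=x_1$). For real $t$, its section is $\mathrm{CL}^t(\bar a,l)=\mathrm{CL}(\bar a,l)\cap\{x_1+\dots+x_s=t\}$. The relative volume $|P|$ of a polytope $P$ in a hyperplane $\{x_1+\dots+x_s=t\}$ is its $(s-1)$-dimensional volume, normalized (translation-invariantly) so that the simplex $\operatorname{conv}\{0,e_1-e_2,e_1-e_3,\dots,e_1-e_s\}$ has volume $1$. -}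

module Defs where

open import Data.Fin.Base using (Fin; toℕ)
open import Data.Integer.Base as ℤ using (ℤ; +_)
import Data.Integer.Properties as ℤₚ
open import Data.List.Base using (List; length)
open import Data.List.Membership.Propositional using (_∈_)
open import Data.List.Relation.Unary.All using (All)
open import Data.List.Relation.Unary.Unique.Propositional using (Unique)
open import Data.Nat.Base as ℕ using (ℕ; zero; suc; _!)
open import Data.Nat.DivMod using (_mod_)
import Data.Nat.Properties as ℕₚ
open import Data.Product.Base using (Σ-syntax; ∃-syntax; _×_; proj₁)
open import Data.Rational.Base as ℚ using (ℚ; 0ℚ; 1ℚ; ½)
import Data.Rational.Properties as ℚₚ
import Data.Rational.Solver as ℚSolver
open import Data.Vec.Base as Vec using (Vec; _∷_; lookup)
open import Data.Vec.Relation.Unary.All using () renaming (All to Allᵛ)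
open import Function.Bundles using (Inverse)
open import Level using (0ℓ)
open import Relation.Binary.Bundles using (Setoid)
import Relation.Binary.Construct.On as On
open import Relation.Binary.PropositionalEquality
  using (_≡_; refl; sym; trans; cong; cong₂; subst; setoid)
open import Relation.Unary using (Pred; _≐_)

------------------------------------------------------------------------
-- Real numbers: Bishop's regular sequences, with rate 2⁻ⁿ in place of 1/n

2⁻ : ℕ → ℚ
2⁻ zero    = 1ℚ
2⁻ (suc n) = ½ ℚ.* 2⁻ n

record ℝ : Set where
  constructor mkℝ
  field
    approx  : ℕ → ℚ
    regular : ∀ m n → ℚ.∣ approx m ℚ.- approx n ∣ ℚ.≤ 2⁻ m ℚ.+ 2⁻ n

open ℝ public

infix 4 _≤ᴿ_ _<ᴿ_ _≃_

_≤ᴿ_ : ℝ → ℝ → Set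
x ≤ᴿ y = ∀ n → approx x n ℚ.≤ approx y n ℚ.+ (2⁻ n ℚ.+ 2⁻ n)

_<ᴿ_ : ℝ → ℝ → Set
x <ᴿ y = ∃[ n ] approx x n ℚ.+ (2⁻ n ℚ.+ 2⁻ n) ℚ.< approx y n

_≃_ : ℝ → ℝ → Set
x ≃ y = (x ≤ᴿ y) × (y ≤ᴿ x)

2⁻-nonNeg : ∀ n → ℚ.NonNegative (2⁻ n)
2⁻-nonNeg zero    = _
2⁻-nonNeg (suc n) = ℚₚ.nonNeg*nonNeg⇒nonNeg ½ (2⁻ n) {{2⁻-nonNeg n}}

fromℚ : ℚ → ℝ
fromℚ q .approx  _   = q
fromℚ q .regular m n = subst (ℚ._≤ 2⁻ m ℚ.+ 2⁻ n)
  (sym (cong ℚ.∣_∣ (ℚₚ.+-inverseʳ q)))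
  (ℚₚ.+-mono-≤ (ℚₚ.nonNegative⁻¹ (2⁻ m) {{2⁻-nonNeg m}})
               (ℚₚ.nonNegative⁻¹ (2⁻ n) {{2⁻-nonNeg n}}))

fromℤ : ℤ → ℝ
fromℤ z = fromℚ (z ℚ./ 1)

0ᴿ : ℝ
0ᴿ = fromℤ (+ 0)

infixl 6 _+ᴿ_ _-ᴿ_
infix  8 -ᴿ_

private
  open ℚSolver.+-*-Solver

  interchange : ∀ a b c d →
    (a ℚ.+ b) ℚ.- (c ℚ.+ d) ≡ (a ℚ.- c) ℚ.+ (b ℚ.- d)
  interchange = solve 4 (λ a b c d →
    (a :+ b) :- (c :+ d) := (a :- c) :+ (b :- d)) refl

  halves : ∀ p q →
    (½ ℚ.* p ℚ.+ ½ ℚ.* q) ℚ.+ (½ ℚ.* p ℚ.+ ½ ℚ.* q) ≡ p ℚ.+ q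
  halves = solve 2 (λ p q →
    (con ½ :* p :+ con ½ :* q) :+ (con ½ :* p :+ con ½ :* q) := p :+ q) refl

  neg-sub : ∀ p q → (ℚ.- p) ℚ.- (ℚ.- q) ≡ ℚ.- (p ℚ.- q)
  neg-sub = solve 2 (λ p q → (:- p) :- (:- q) := :- (p :- q)) refl

_+ᴿ_ : ℝ → ℝ → ℝ
(x +ᴿ y) .approx  n   = approx x (suc n) ℚ.+ approx y (suc n)
(x +ᴿ y) .regular m n = begin
  ℚ.∣ (x′ m ℚ.+ y′ m) ℚ.- (x′ n ℚ.+ y′ n) ∣
    ≡⟨ cong ℚ.∣_∣ (interchange (x′ m) (y′ m) (x′ n) (y′ n)) ⟩
  ℚ.∣ (x′ m ℚ.- x′ n) ℚ.+ (y′ m ℚ.- y′ n) ∣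
    ≤⟨ ℚₚ.∣p+q∣≤∣p∣+∣q∣ (x′ m ℚ.- x′ n) (y′ m ℚ.- y′ n) ⟩
  ℚ.∣ x′ m ℚ.- x′ n ∣ ℚ.+ ℚ.∣ y′ m ℚ.- y′ n ∣
    ≤⟨ ℚₚ.+-mono-≤ (regular x (suc m) (suc n)) (regular y (suc m) (suc n)) ⟩
  (2⁻ (suc m) ℚ.+ 2⁻ (suc n)) ℚ.+ (2⁻ (suc m) ℚ.+ 2⁻ (suc n))
    ≡⟨ halves (2⁻ m) (2⁻ n) ⟩
  2⁻ m ℚ.+ 2⁻ n ∎
  where
  open ℚₚ.≤-Reasoning
  x′ y′ : ℕ → ℚ
  x′ k = approx x (suc k)
  y′ k = approx y (suc k)

-ᴿ_ : ℝ → ℝ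
(-ᴿ x) .approx  n   = ℚ.- approx x n
(-ᴿ x) .regular m n = subst (ℚ._≤ 2⁻ m ℚ.+ 2⁻ n)
  (sym (trans (cong ℚ.∣_∣ (neg-sub (approx x m) (approx x n)))
              (ℚₚ.∣-p∣≡∣p∣ (approx x m ℚ.- approx x n))))
  (regular x m n)

_-ᴿ_ : ℝ → ℝ → ℝ
x -ᴿ y = x +ᴿ (-ᴿ y)

infixr 7 _·_

_·_ : ℕ → ℝ → ℝ
zero  · x = 0ᴿ
suc k · x = x +ᴿ k · x

sumᴿ : ∀ {m} → Vec ℝ m → ℝ
sumᴿ = Vec.foldr′ _+ᴿ_ 0ᴿ

------------------------------------------------------------------------
-- Chainlink polytopes.  The number of parts s is written suc d, so that it
-- is positive and d is the dimension of the sections.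

record Composition (n s : ℕ) : Set where
  field
    parts    : Vec ℕ s
    positive : Allᵛ (1 ℕ.≤_) parts
    total    : Vec.sum parts ≡ n

open Composition public

next : ∀ {d} → Fin (suc d) → Fin (suc d)
next {d} i = suc (toℕ i) mod suc d

CL : ∀ {d} → Vec ℕ (suc d) → ℕ → Pred (Vec ℝ (suc d)) 0ℓ
CL a l x = ∀ i →
    (0ᴿ ≤ᴿ lookup x i)
  × (lookup x i ≤ᴿ fromℤ (+ lookup a i))
  × (lookup x i -ᴿ lookup x (next i) ≤ᴿ fromℤ (+ lookup a i ℤ.- + l))

CLSection : ∀ {d} → Vec ℕ (suc d) → ℕ → ℝ → Pred (Vec ℝ (suc d)) 0ℓ
CLSection a l t x = CL a l x × (sumᴿ x ≃ t)

------------------------------------------------------------------------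
-- Relative volume

-- Volumes are given by their lower and upper Dedekind cuts.  This makes the
-- volume of an arbitrary set meaningful (lower is the cut of the inner Jordan
-- content, upper that of the outer one) without deciding real inequalities;
-- for a polytope the two are the two halves of one real number.

record Cut : Set₁ where
  field
    lower upper : Pred ℚ 0ℓ

open Cut public

infix 4 _≈ᶜ_

_≈ᶜ_ : Cut → Cut → Set
v ≈ᶜ w = (lower v ≐ lower w) × (upper v ≐ upper w)

-- The closed cube ∏ⱼ [ zⱼ / N , (zⱼ + 1) / N ].

Cube : ∀ {d} (N : ℕ) .{{_ : ℕ.NonZero N}} → Vec ℤ d → Pred (Vec ℝ d) 0ℓ
Cube N z u = ∀ j →
    (fromℚ (lookup z j ℚ./ N) ≤ᴿ lookup u j)
  × (lookup u j ≤ᴿ fromℚ (ℤ.suc (lookup z j) ℚ./ N))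

-- The point t e₁ + ∑ⱼ uⱼ (eⱼ₊₁ - e₁) of the hyperplane x₁ + ⋯ + xₛ = t.

chart : ∀ {d} → ℝ → Vec ℝ d → Vec ℝ (suc d)
chart t u = (t -ᴿ sumᴿ u) ∷ u

-- In this chart conv {0, e₁ - e₂, …, e₁ - eₛ}, translated into the hyperplane,
-- is the standard simplex up to sign, of Lebesgue measure 1 / d!.  Normalising
-- it to volume 1 therefore gives a cube of side 1 / N the volume d! / N ^ d.

cubesVolume : ∀ (d N : ℕ) .{{_ : ℕ.NonZero N}} → ℕ → ℚ
cubesVolume d N c = ℚ._/_ (+ (d ! ℕ.* c)) (N ℕ.^ d) {{ℕₚ.m^n≢0 N d}}

-- Relative volume of the intersection of P with the hyperplane of level t.

relVolume : ∀ {d} → ℝ → Pred (Vec ℝ (suc d)) 0ℓ → Cut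
relVolume {d} t P .lower q =
  Σ[ N ∈ ℕ ] Σ[ N≢0 ∈ ℕ.NonZero N ] Σ[ I ∈ List (Vec ℤ d) ]
      Unique I
    × All (λ z → ∀ u → Cube N {{N≢0}} z u → P (chart t u)) I
    × q ℚ.< cubesVolume d N {{N≢0}} (length I)
relVolume {d} t P .upper q =
  Σ[ N ∈ ℕ ] Σ[ N≢0 ∈ ℕ.NonZero N ] Σ[ O ∈ List (Vec ℤ d) ]
      (∀ z u → Cube N {{N≢0}} z u → P (chart t u) → z ∈ O)
    × cubesVolume d N {{N≢0}} (length O) ℚ.< q

------------------------------------------------------------------------
-- Lattice points of dilations

dilate : ∀ {s} → ℕ → Pred (Vec ℝ s) 0ℓ → Pred (Vec ℝ s) 0ℓ
dilate k P y = ∃[ x ] P x × (∀ i → lookup y i ≃ k · lookup x i)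

-- P ∩ ℤˢ, with equality that of the underlying integer vectors.

LatticePoints : ∀ {s} → Pred (Vec ℝ s) 0ℓ → Setoid 0ℓ 0ℓ
LatticePoints {s} P =
  On.setoid {B = Σ[ y ∈ Vec ℤ s ] P (Vec.map fromℤ y)} (setoid (Vec ℤ s)) proj₁

-- Equality of cardinalities, as a bijection: for real t, whether k t is an
-- integer is undecidable, so the number of lattice points of the k-th dilate
-- of a section is not available as a natural number.

infix 4 _≅_

_≅_ : Setoid 0ℓ 0ℓ → Setoid 0ℓ 0ℓ → Set
A ≅ B = Inverse A B

{-# OPTIONS --safe #-}
module Submission where

-- Raise one part a_j ≥ 2l by 1.  The old lattice points embed into the new ones by adding 1 to x_j,
-- which misses the points whose x_j equals the lower bound imposed by x_{j−1}; they also embed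
-- unchanged, which misses the points whose x_j is the largest one allowed by x_{j+1}.  Both kinds of
-- missed points are parametrised by the open chain left when the j-th entry is deleted, and an open
-- chain splits into two shorter ones when one of its own entries becomes extremal.  Sending the
-- first kind to the second at each step reduces everything to the case that all parts are 2l, where
-- reversing the order and replacing x by 2l − x does the job.  The result is a bijection of the
-- lattice points of the polytope onto themselves that takes the level T to n − T.
--
-- Shrinking or enlarging all facets by the same m does not change aᵢ − 2l, so the bijection exists for
-- these polytopes as well.  For the lower cut, the grid points deep inside the given cubes are lattice
-- points of a shrunken dilate, and all cubes at their images lie in the complementary section.  For
-- the upper cut, every cube that meets the complementary section has its corner in an enlarged
-- dilate, and the image of the corner is close to a point of the original section, hence close to
-- one of the given cubes.

open import Defs
import Algebra.Properties.Group as Group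
open import Algebra.Bundles using (AbelianGroup)
open import Data.Empty using (⊥)
open import Data.Fin.Base using (Fin; zero; suc; fromℕ; inject₁)
import Data.Fin.Properties as Fin
open import Data.Fin.Properties using (any?; _≟_)
open import Data.Fin.Relation.Unary.Top using (view; ‵fromℕ; ‵inject₁)
open import Data.Integer.Base as ℤ using (ℤ; +_; -[1+_]; ∣_∣)
import Data.Integer.DivMod as ℤ
import Data.Integer.Properties as ℤ
open import Data.Integer.Tactic.RingSolver using () renaming (solve-∀ to solve-ℤ)
open import Data.List.Base as List using (List; []; _∷_; _++_; length; replicate; upTo; cartesianProductWith; concatMap)
open import Data.List.Membership.DecPropositional using () renaming (_∈?_ to ∈?)
open import Data.List.Membership.Propositional using (_∈_; find; lose)
open import Data.List.Membership.Propositional.Properties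
import Data.List.Properties as List
open import Data.List.Relation.Binary.Disjoint.Propositional using (Disjoint)
open import Data.List.Relation.Unary.All as All using (All; []; _∷_)
import Data.List.Relation.Unary.All.Properties as All
open import Data.List.Relation.Unary.AllPairs as AllPairs using ([]; _∷_)
import Data.List.Relation.Unary.AllPairs.Properties as AllPairs
open import Data.List.Relation.Unary.Any using (here)
open import Data.List.Relation.Unary.Unique.Propositional using (Unique)
import Data.List.Relation.Unary.Unique.Propositional.Properties as Unique
open import Data.Nat.Base hiding (_/_)
open import Data.Nat.DivMod using (m<n⇒m%n≡m; n%n≡0)
open import Data.Nat.ListAction using (sum)
open import Data.Nat.ListAction.Properties using (sum-++)
open import Data.Nat.Properties hiding (_≟_)
open import Data.Nat.Tactic.RingSolver using (solve-∀)
open import Data.Product.Base using (_×_; _,_; proj₁; proj₂; ∃-syntax; Σ-syntax)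
open import Data.Rational.Base as ℚ using (ℚ; mkℚ; 0ℚ; 1ℚ; ½; toℚᵘ; _/_)
import Data.Rational.Properties as ℚ
open import Data.Rational.Solver using (module +-*-Solver)
open import Data.Rational.Unnormalised.Base as ℚᵘ using (mkℚᵘ; *≤*; *<*; *≡*)
import Data.Rational.Unnormalised.Properties as ℚᵘ
open import Data.Sum.Base as Sum using (_⊎_; inj₁; inj₂; [_,_]′)
open import Data.Unit.Base using (⊤; tt)
open import Data.Vec.Base as Vec using (Vec; []; _∷_; lookup; toList)
import Data.Vec.Properties as Vec
open import Function.Base using (_∘_)
open import Relation.Binary.PropositionalEquality
open import Relation.Nullary using (¬_; yes; no; contradiction)
open import Relation.Nullary.Decidable using (decidable-stable)

open +-*-Solver using (solve; _:+_; _:*_; _:-_; :-_; _:=_; con)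

-- Chains and cycles of bounded entries

-- Reversing the order and replacing each xᵢ by aᵢ - xᵢ lands in the polytope of the reversed
-- composition. It is a self-map when all parts are equal, so the induction descends to such a case.
-- Since aᵢ ≥ 2l, the bound that an entry imposes on the next never exceeds l, and an entry sitting
-- at its own lower bound imposes none; hence deleting an extremal entry cuts a list into
-- independent chains. An entry deleted at its minimum contributed `U` of the chain before it to the
-- level; deleted at its maximum, it contributed a constant plus `V` of the chain behind it. Open
-- chains therefore need a duality between sum + `U` and sum + `V`, and reverse complementation
-- exchanges the two. The bijection acts on lattice points only, so volumes are compared by counting
-- on refined grids. A strict inequality between a rational and a volume of cubes is an inequality
-- of integers with one unit to spare, and the grid is refined until the margins at the boundary of
-- the cubes cost less than that unit. Rounding a real level costs a bounded number of grid steps,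
-- which is what the margins are for.

private variable
  A₀ A₁ A₂ A₃ : Set

-- The maps are total on the carriers while the laws are asked only on the predicates. The equations
-- then compare bare data, never membership proofs, and values off the predicates are arbitrary.
record Iso (P : A₀ → Set) (w : A₀ → ℕ) (Q : A₁ → Set) (w′ : A₁ → ℕ) : Set where
  field
    to      : A₀ → A₁
    from    : A₁ → A₀
    to-∈    : ∀ x → P x → Q (to x)
    from-∈  : ∀ y → Q y → P (from y)
    from∘to : ∀ x → P x → from (to x) ≡ x
    to∘from : ∀ y → Q y → to (from y) ≡ y
    weight  : ∀ x → P x → w′ (to x) ≡ w x

-- Source and target carry separate weights: for open chains these are sum + `U` on one side and sum
-- + `V` on the other.
record Dual (P : A₀ → Set) (w : A₀ → ℕ) (Q : A₁ → Set) (w′ : A₁ → ℕ) (K : ℕ) : Set where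
  field
    to      : A₀ → A₁
    from    : A₁ → A₀
    to-∈    : ∀ x → P x → Q (to x)
    from-∈  : ∀ y → Q y → P (from y)
    from∘to : ∀ x → P x → from (to x) ≡ x
    to∘from : ∀ y → Q y → to (from y) ≡ y
    weight  : ∀ x → P x → w x + w′ (to x) ≡ K

module _ {P : A₀ → Set} {w : A₀ → ℕ} {P′ : A₁ → Set} {w′ : A₁ → ℕ}
         {Q′ : A₂ → Set} {v′ : A₂ → ℕ} {Q : A₃ → Set} {v : A₃ → ℕ} {K : ℕ} where

  transport : Iso P w P′ w′ → Iso Q v Q′ v′ → Dual P′ w′ Q′ v′ K → Dual P w Q v K
  transport I J Θ = record
    { to      = J.from ∘ Θ.to ∘ I.to
    ; from    = I.from ∘ Θ.from ∘ J.to
    ; to-∈    = λ x p → J.from-∈ _ (Θ.to-∈ _ (I.to-∈ x p))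
    ; from-∈  = λ y q → I.from-∈ _ (Θ.from-∈ _ (J.to-∈ y q))
    ; from∘to = λ x p → trans
        (cong (I.from ∘ Θ.from) (J.to∘from _ (Θ.to-∈ _ (I.to-∈ x p))))
        (trans (cong I.from (Θ.from∘to _ (I.to-∈ x p))) (I.from∘to x p))
    ; to∘from = λ y q → trans
        (cong (J.from ∘ Θ.to) (I.to∘from _ (Θ.from-∈ _ (J.to-∈ y q))))
        (trans (cong J.from (Θ.to∘from _ (J.to-∈ y q))) (J.from∘to y q))
    ; weight  = λ x p → trans
        (cong₂ _+_ (sym (I.weight x p))
          (trans (sym (J.weight _ (J.from-∈ _ (Θ.to-∈ _ (I.to-∈ x p)))))
                 (cong v′ (J.to∘from _ (Θ.to-∈ _ (I.to-∈ x p))))))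
        (Θ.weight _ (I.to-∈ x p))
    }
    where
    module I = Iso I
    module J = Iso J
    module Θ = Dual Θ

module _ {P : A₀ → Set} {w : A₀ → ℕ} {P′ : A₁ → Set} {w′ : A₁ → ℕ}
         {Q : A₂ → Set} {v : A₂ → ℕ} {Q′ : A₃ → Set} {v′ : A₃ → ℕ} where

  infixr 1 _⊎ᵈ_
  infixr 2 _×ᵈ_

  _⊎ᵈ_ : ∀ {K} → Dual P w P′ w′ K → Dual Q v Q′ v′ K →
         Dual [ P , Q ]′ [ w , v ]′ [ P′ , Q′ ]′ [ w′ , v′ ]′ K
  S ⊎ᵈ T = record
    { to      = Sum.map S.to T.to
    ; from    = Sum.map S.from T.from
    ; to-∈    = λ { (inj₁ x) → S.to-∈ x ; (inj₂ x) → T.to-∈ x }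
    ; from-∈  = λ { (inj₁ x) → S.from-∈ x ; (inj₂ x) → T.from-∈ x }
    ; from∘to = λ { (inj₁ x) p → cong inj₁ (S.from∘to x p) ; (inj₂ x) p → cong inj₂ (T.from∘to x p) }
    ; to∘from = λ { (inj₁ x) p → cong inj₁ (S.to∘from x p) ; (inj₂ x) p → cong inj₂ (T.to∘from x p) }
    ; weight  = λ { (inj₁ x) → S.weight x ; (inj₂ x) → T.weight x }
    }
    where
    module S = Dual S
    module T = Dual T

  _×ᵈ_ : ∀ {K L} → Dual P w P′ w′ K → Dual Q v Q′ v′ L →
         Dual {A₀ × A₂} {A₁ × A₃} (λ (x , y) → P x × Q y) (λ (x , y) → w x + v y)
              (λ (x , y) → P′ x × Q′ y) (λ (x , y) → w′ x + v′ y) (K + L)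
  S ×ᵈ T = record
    { to      = λ (x , y) → S.to x , T.to y
    ; from    = λ (x , y) → S.from x , T.from y
    ; to-∈    = λ (x , y) (p , q) → S.to-∈ x p , T.to-∈ y q
    ; from-∈  = λ (x , y) (p , q) → S.from-∈ x p , T.from-∈ y q
    ; from∘to = λ (x , y) (p , q) → cong₂ _,_ (S.from∘to x p) (T.from∘to y q)
    ; to∘from = λ (x , y) (p , q) → cong₂ _,_ (S.to∘from x p) (T.to∘from y q)
    ; weight  = λ (x , y) (p , q) → trans
        (+-interchange (w x) (v y) (w′ (S.to x)) (v′ (T.to y)))
        (cong₂ _+_ (S.weight x p) (T.weight y q))
    }
    where
    module S = Dual S
    module T = Dual T
    +-interchange : ∀ a b c d → (a + b) + (c + d) ≡ (a + c) + (b + d)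
    +-interchange = solve-∀

shift : ∀ {P : A₀ → Set} {w Q} {w′ : A₁ → ℕ} {K} a b →
        Dual P w Q w′ K → Dual P ((λ z → a + z) ∘ w) Q ((λ z → b + z) ∘ w′) (a + b + K)
shift {w = w} {w′ = w′} a b Θ = record
  { Dual Θ hiding (weight)
  ; weight = λ x p → trans (lemma a b (w x) _) (cong (λ z → a + b + z) (Dual.weight Θ x p)) }
  where
  lemma : ∀ a b c d → (a + c) + (b + d) ≡ a + b + (c + d)
  lemma = solve-∀

m∸n≤o⇒m≤n+o : ∀ m n {o} → m ∸ n ≤ o → m ≤ n + o
m∸n≤o⇒m≤n+o m n p = ≤-trans (m≤n+m∸n m n) (+-monoʳ-≤ n p)

module Chains (l : ℕ) where

  -- With aᵢ = eᵢ + 2l: the excess xᵢ ∸ (aᵢ − l) is a lower bound for the next entry, which is the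
  -- inequality xᵢ − xᵢ₊₁ ≤ aᵢ − l.  The excess left over at the end of a chain is U, and V is the
  -- largest bound in [0, l] that the first entry satisfies.
  Ch : ℕ → List ℕ → List ℕ → Set
  Ch c []       []       = ⊤
  Ch c (e ∷ es) (x ∷ xs) = c ≤ x × x ≤ e + (l + l) × Ch (x ∸ (e + l)) es xs
  Ch c _        _        = ⊥

  U : ℕ → List ℕ → List ℕ → ℕ
  U c (e ∷ es) (x ∷ xs) = U (x ∸ (e + l)) es xs
  U c _        _        = c

  V : List ℕ → ℕ
  V []      = l
  V (x ∷ _) = x ⊓ l

  size : List ℕ → ℕ
  size []       = 0
  size (e ∷ es) = e + (l + l) + size es

  excess-≤ : ∀ {e x} → x ≤ e + (l + l) → x ∸ (e + l) ≤ l
  excess-≤ {e} {x} x≤ = m≤n+o⇒m∸n≤o x (e + l) (≤-trans x≤ (≤-reflexive (sym (+-assoc e l l))))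

  U-≤ : ∀ {c} es {xs} → c ≤ l → Ch c es xs → U c es xs ≤ l
  U-≤ []       {[]}     c≤l _              = c≤l
  U-≤ (e ∷ es) {x ∷ xs} c≤l (_ , x≤ , ch) = U-≤ es (excess-≤ {e} x≤) ch

  U-mono : ∀ {c c′} es xs → c ≤ c′ → U c es xs ≤ U c′ es xs
  U-mono []       xs       c≤ = c≤
  U-mono (e ∷ es) []       c≤ = c≤
  U-mono (e ∷ es) (x ∷ xs) c≤ = ≤-refl

  V-≤ : ∀ xs → V xs ≤ l
  V-≤ []       = ≤-refl
  V-≤ (x ∷ xs) = m⊓n≤n x l

  Ch⇒≤V : ∀ {c} es {xs} → c ≤ l → Ch c es xs → c ≤ V xs
  Ch⇒≤V []       {[]}     c≤l _         = c≤l
  Ch⇒≤V (e ∷ es) {x ∷ xs} c≤l (c≤x , _) = ⊓-glb c≤x c≤l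

  Ch-bound : ∀ {c c′} es {xs} → c′ ≤ V xs → Ch c es xs → Ch c′ es xs
  Ch-bound []       {[]}     _  _        = tt
  Ch-bound (e ∷ es) {x ∷ xs} c′≤ (_ , p) = ≤-trans c′≤ (m⊓n≤m x l) , p

  -- A list with a distinguished entry x, followed by a chain; the entries before x (or, in the
  -- cyclic case, all the others) enter only through the lower bound that they impose on x.
  module Node {R : A₀ → Set} {es : List ℕ} {lb : A₀ → List ℕ → ℕ}
              (lb≤l : ∀ {a xs} → R a → Ch 0 es xs → lb a xs ≤ l) where

    Pointed : Set
    Pointed = A₀ × ℕ × List ℕ

    N : ℕ → Pointed → Set
    N e (a , x , xs) = R a × lb a xs ≤ x × x ≤ e + (l + l) × Ch (x ∸ (e + l)) es xs

    Rest : A₀ × List ℕ → Set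
    Rest (a , xs) = R a × Ch 0 es xs

    -- `W` depends on e because `U` does when the distinguished entry is the last one. `W′` does
    -- not, since `V` looks only at the first entry.
    module _ (W : ℕ → Pointed → ℕ) (W′ : Pointed → ℕ) (w w′ : A₀ × List ℕ → ℕ)
      (W-suc   : ∀ e a x xs → R a → W (suc e) (a , suc x , xs) ≡ suc (W e (a , x , xs)))
      (W-lb    : ∀ e a xs → R a → Ch 0 es xs → W (suc e) (a , lb a xs , xs) ≡ w (a , xs))
      (W′-high : ∀ e a xs → R a → Ch 0 es xs →
                 W′ (a , suc (e + l + V xs) , xs) ≡ suc (e + l) + w′ (a , xs)) where

      -- Lower x by 1 unless x is minimal; in split-high, keep x unless it is maximal.
      split-low : ∀ e → Iso (N (suc e)) (W (suc e)) [ N e , Rest ]′ [ suc ∘ W e , w ]′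
      split-low e = record
        { to      = to
        ; from    = from
        ; to-∈    = to-∈
        ; from-∈  = λ
            { (inj₁ (a , x , xs)) (r , lo , hi , ch) → r , m≤n⇒m≤1+n lo , s≤s hi , ch
            ; (inj₂ (a , xs)) (r , ch) → r , ≤-refl
                , ≤-trans (lb≤l r ch) (≤-trans (m≤m+n l l) (m≤n+m (l + l) (suc e)))
                -- The bound `lb` is at most l and an excess is counted only beyond a threshold that
                -- is at least l, so an entry at its minimum imposes nothing on the chain behind it.
                -- This is where parts of at least 2l matter.
                , subst (λ c → Ch c es xs)
                    (sym (m≤n⇒m∸n≡0 (≤-trans (lb≤l r ch) (m≤n+m l (suc e))))) ch }
        ; from∘to = from∘to
        ; to∘from = λ
            { (inj₁ y) → to∘from₁ y
            ; (inj₂ y) → to∘from₂ y }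
        ; weight  = weight
        }
        where
        to : Pointed → Pointed ⊎ (A₀ × List ℕ)
        to (a , x , xs) with x ≤? lb a xs
        ... | yes _ = inj₂ (a , xs)
        ... | no  _ = inj₁ (a , pred x , xs)
        from : Pointed ⊎ (A₀ × List ℕ) → Pointed
        from (inj₁ (a , x , xs)) = a , suc x , xs
        from (inj₂ (a , xs))     = a , lb a xs , xs
        to-∈ : ∀ y → N (suc e) y → [ N e , Rest ]′ (to y)
        to-∈ (a , x , xs) (r , lo , hi , ch) with x ≤? lb a xs
        ... | yes _ = r , Ch-bound es z≤n ch
        to-∈ (a , zero  , xs) (r , lo , hi , ch) | no x≰ = contradiction z≤n x≰
        to-∈ (a , suc x , xs) (r , lo , hi , ch) | no x≰ = r , s≤s⁻¹ (≰⇒> x≰) , s≤s⁻¹ hi , ch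
        from∘to : ∀ y → N (suc e) y → from (to y) ≡ y
        from∘to (a , x , xs) (r , lo , _) with x ≤? lb a xs
        ... | yes x≤ = cong (λ z → a , z , xs) (≤-antisym lo x≤)
        from∘to (a , zero  , xs) _ | no x≰ = contradiction z≤n x≰
        from∘to (a , suc x , xs) _ | no x≰ = refl
        to∘from₁ : ∀ y → N e y → to (from (inj₁ y)) ≡ inj₁ y
        to∘from₁ (a , x , xs) (_ , lo , _) with suc x ≤? lb a xs
        ... | yes x< = contradiction (<-≤-trans x< lo) (<-irrefl refl)
        ... | no  _  = refl
        to∘from₂ : ∀ y → Rest y → to (from (inj₂ y)) ≡ inj₂ y
        to∘from₂ (a , xs) _ with lb a xs ≤? lb a xs
        ... | yes _ = refl
        ... | no ¬p = contradiction ≤-refl ¬p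
        weight : ∀ y → N (suc e) y → [ suc ∘ W e , w ]′ (to y) ≡ W (suc e) y
        weight (a , x , xs) (r , lo , hi , ch) with x ≤? lb a xs
        ... | yes x≤ = trans (sym (W-lb e a xs r (Ch-bound es z≤n ch)))
                             (cong (λ z → W (suc e) (a , z , xs)) (≤-antisym lo x≤))
        weight (a , zero  , xs) _ | no x≰ = contradiction z≤n x≰
        weight (a , suc x , xs) (r , _) | no x≰ = sym (W-suc e a x xs r)

      split-high : ∀ e → Iso (N (suc e)) W′ [ N e , Rest ]′ [ W′ , (λ z → suc (e + l) + z) ∘ w′ ]′
      split-high e = record
        { to      = to
        ; from    = from
        ; to-∈    = to-∈
        ; from-∈  = λ
            { (inj₁ (a , x , xs)) (r , lo , hi , ch) → r , lo , m≤n⇒m≤1+n hi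
                , Ch-bound es (≤-trans (∸-monoʳ-≤ x (n≤1+n (e + l)))
                                       (Ch⇒≤V es (excess-≤ {e} hi) ch)) ch
            ; (inj₂ (a , xs)) (r , ch) → r
                , ≤-trans (lb≤l r ch) (≤-trans (m≤n+m l (suc e)) (m≤m+n (suc e + l) (V xs)))
                , ≤-trans (+-monoʳ-≤ (suc e + l) (V-≤ xs)) (≤-reflexive (+-assoc (suc e) l l))
                , Ch-bound es (≤-reflexive (m+n∸m≡n (e + l) (V xs))) ch }
        ; from∘to = from∘to
        ; to∘from = λ
            { (inj₁ y) → to∘from₁ y
            ; (inj₂ y) → to∘from₂ y }
        ; weight  = weight
        }
        where
        to : Pointed → Pointed ⊎ (A₀ × List ℕ)
        to (a , x , xs) with x ≤? e + l + V xs
        ... | yes _ = inj₁ (a , x , xs)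
        ... | no  _ = inj₂ (a , xs)
        from : Pointed ⊎ (A₀ × List ℕ) → Pointed
        from (inj₁ y)        = y
        from (inj₂ (a , xs)) = a , suc (e + l + V xs) , xs
        to-∈ : ∀ y → N (suc e) y → [ N e , Rest ]′ (to y)
        to-∈ (a , x , xs) (r , lo , hi , ch) with x ≤? e + l + V xs
        ... | yes x≤ = r , lo
            , ≤-trans x≤ (≤-trans (+-monoʳ-≤ (e + l) (V-≤ xs)) (≤-reflexive (+-assoc e l l)))
            , Ch-bound es (m≤n+o⇒m∸n≤o x (e + l) x≤) ch
        ... | no _ = r , Ch-bound es z≤n ch
        -- The chain behind x caps the excess of x at `V xs`, so a single value is left above e + l
        -- + `V xs`.
        top : ∀ {x xs} → x ≤ suc e + (l + l) → Ch (x ∸ (suc e + l)) es xs → ¬ x ≤ e + l + V xs →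
              suc (e + l + V xs) ≡ x
        top {x} {xs} hi ch x≰ = ≤-antisym (≰⇒> x≰)
          (m∸n≤o⇒m≤n+o x (suc e + l) (Ch⇒≤V es (excess-≤ {suc e} hi) ch))
        from∘to : ∀ y → N (suc e) y → from (to y) ≡ y
        from∘to (a , x , xs) (r , lo , hi , ch) with x ≤? e + l + V xs
        ... | yes _  = refl
        ... | no  x≰ = cong (λ z → a , z , xs) (top hi ch x≰)
        to∘from₁ : ∀ y → N e y → to y ≡ inj₁ y
        to∘from₁ (a , x , xs) (r , lo , hi , ch) with x ≤? e + l + V xs
        ... | yes _  = refl
        ... | no  x≰ = contradiction
            (m∸n≤o⇒m≤n+o x (e + l) (Ch⇒≤V es (excess-≤ {e} hi) ch)) x≰
        to∘from₂ : ∀ y → Rest y → to (from (inj₂ y)) ≡ inj₂ y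
        to∘from₂ (a , xs) _ with suc (e + l + V xs) ≤? e + l + V xs
        ... | yes p = contradiction p (<-irrefl refl)
        ... | no  _ = refl
        weight : ∀ y → N (suc e) y → [ W′ , (λ z → suc (e + l) + z) ∘ w′ ]′ (to y) ≡ W′ y
        weight (a , x , xs) (r , lo , hi , ch) with x ≤? e + l + V xs
        ... | yes _  = refl
        ... | no  x≰ = trans (sym (W′-high e a xs r (Ch-bound es z≤n ch)))
                             (cong (λ z → W′ (a , z , xs)) (top hi ch x≰))

      -- A minimal entry on the source side is paired with a maximal one on the target side. Old
      -- points contribute 1 + K, from the raised entry; new ones contribute suc (e + l) + K′, from
      -- the constant part of the maximal entry. The equation makes the two constants agree.
      step : ∀ {e K K′} → Dual (N e) (W e) (N e) W′ K → Dual Rest w Rest w′ K′ →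
             e + l + K′ ≡ K → Dual (N (suc e)) (W (suc e)) (N (suc e)) W′ (suc K)
      step {e} {K′ = K′} Θ H refl =
        transport (split-low e) (split-high e) (shift 1 0 Θ ⊎ᵈ shift 0 (suc (e + l)) H)

  -- Open chains cut in two at one entry

  size-++ : ∀ es es′ → size (es ++ es′) ≡ size es + size es′
  size-++ []       es′ = refl
  size-++ (e ∷ es) es′ = trans (cong (λ z → e + (l + l) + z) (size-++ es es′))
                               (sym (+-assoc (e + (l + l)) (size es) (size es′)))

  join : List ℕ × ℕ × List ℕ → List ℕ
  join (xs , x , ys) = xs ++ x ∷ ys

  split : List ℕ → List ℕ → List ℕ × ℕ × List ℕ
  split []       (x ∷ xs) = [] , x , xs
  split (e ∷ es) (x ∷ xs) = let ys , y , zs = split es xs in x ∷ ys , y , zs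
  split es       []       = [] , 0 , []

  module _ {e : ℕ} {es : List ℕ} where

    Joint : ℕ → List ℕ → List ℕ × ℕ × List ℕ → Set
    Joint c el (ys , x , xs) = Ch c el ys × U c el ys ≤ x × x ≤ e + (l + l) × Ch (x ∸ (e + l)) es xs

    join-∈ : ∀ {c} el z → Joint c el z → Ch c (el ++ e ∷ es) (join z)
    join-∈ []       ([]     , x , xs) (_ , p)                     = p
    join-∈ (_ ∷ el) (y ∷ ys , x , xs) ((c≤y , y≤ , ch) , p) = c≤y , y≤ , join-∈ el _ (ch , p)

    split-∈ : ∀ {c} el xs → Ch c (el ++ e ∷ es) xs → Joint c el (split el xs)
    split-∈ []       (x ∷ xs) p               = tt , p
    split-∈ (_ ∷ el) (x ∷ xs) (c≤x , x≤ , ch) =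
      let ch′ , p = split-∈ el xs ch in (c≤x , x≤ , ch′) , p

    join∘split : ∀ {c} el xs → Ch c (el ++ e ∷ es) xs → join (split el xs) ≡ xs
    join∘split []       (x ∷ xs) _            = refl
    join∘split (_ ∷ el) (x ∷ xs) (_ , _ , ch) = cong (x ∷_) (join∘split el xs ch)

    split∘join : ∀ {c} el ys {x xs} → Ch c el ys → split el (ys ++ x ∷ xs) ≡ (ys , x , xs)
    split∘join []       []       _            = refl
    split∘join (_ ∷ el) (y ∷ ys) (_ , _ , ch) =
      cong (λ (ys , z) → y ∷ ys , z) (split∘join el ys ch)

    U-join : ∀ {c} el ys {x xs} → Ch c el ys →
             U c (el ++ e ∷ es) (ys ++ x ∷ xs) ≡ U (x ∸ (e + l)) es xs
    U-join []       []       _            = refl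
    U-join (_ ∷ el) (y ∷ ys) (_ , _ , ch) = U-join el ys ch

  splitting : ∀ el {e es} (w : List ℕ → ℕ) →
              Iso (Ch 0 (el ++ e ∷ es)) w (Joint {e} {es} 0 el) (w ∘ join)
  splitting el {e} {es} w = record
    { to      = split el
    ; from    = join
    ; to-∈    = split-∈ el
    ; from-∈  = join-∈ el
    ; from∘to = join∘split el
    ; to∘from = λ (ys , _) (ch , _) → split∘join {e} {es} el ys ch
    ; weight  = λ xs ch → cong w (join∘split el xs ch)
    }

  -- The weights are what remains of the level of a longer list after an extremal entry is deleted:
  -- `U` is the value of a minimal entry placed behind the chain, `V` the variable part of a maximal
  -- entry placed before it. The extra l is the value of `U` + `V` across the duality when all parts
  -- are 2l.
  ChainDual : List ℕ → Set
  ChainDual es = Dual (Ch 0 es) (λ xs → sum xs + U 0 es xs) (Ch 0 es) (λ xs → sum xs + V xs) (size es + l)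

  joining : ∀ el {e es} (w : List ℕ → ℕ) →
            Iso (Joint {e} {es} 0 el) (w ∘ join) (Ch 0 (el ++ e ∷ es)) w
  joining el {e} {es} w = record
    { to      = join
    ; from    = split el
    ; to-∈    = join-∈ el
    ; from-∈  = split-∈ el
    ; from∘to = λ (ys , _) (ch , _) → split∘join {e} {es} el ys ch
    ; to∘from = join∘split el
    ; weight  = λ _ _ → refl
    }

  -- With the entry e + 1 deleted at an extreme, the weight of the whole is the sum of the weights
  -- of the two pieces, plus a constant in the maximal case. So the product of the dualities of the
  -- pieces is exactly what `step` asks for the new points.
  chain-step : ∀ el e es → ChainDual el → ChainDual es →
               ChainDual (el ++ e ∷ es) → ChainDual (el ++ suc e ∷ es)
  chain-step el e es L Rt Θ = subst (Dual _ _ _ _) (cong (_+ l) size-suc)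
    (transport (splitting el _) (splitting el _)
      (step W W′
            (λ (ys , xs) → sum ys + U 0 el ys + (sum xs + U 0 es xs))
            (λ (ys , xs) → sum ys + V ys + (sum xs + V xs))
            W-suc W-lb W′-high
            (transport (joining el _) (joining el _) Θ) (L ×ᵈ Rt)
            (trans (regroup e l (size el) (size es)) (cong (_+ l) (sym (size-join e))))))
    where
    open Node {R = Ch 0 el} {es} {λ ys _ → U 0 el ys} (λ ch _ → U-≤ el z≤n ch)
    W : ℕ → List ℕ × ℕ × List ℕ → ℕ
    W e z = sum (join z) + U 0 (el ++ e ∷ es) (join z)
    W′ : List ℕ × ℕ × List ℕ → ℕ
    W′ z = sum (join z) + V (join z)
    size-join : ∀ e → size (el ++ e ∷ es) ≡ size el + (e + (l + l) + size es)
    size-join e = size-++ el (e ∷ es)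
    size-suc : suc (size (el ++ e ∷ es)) ≡ size (el ++ suc e ∷ es)
    size-suc = trans (cong suc (size-join e)) (trans (sym (+-suc (size el) _)) (sym (size-join (suc e))))
    regroup : ∀ e l a b → e + l + (a + l + (b + l)) ≡ a + (e + (l + l) + b) + l
    regroup = solve-∀
    W-suc : ∀ e ys x xs → Ch 0 el ys → W (suc e) (ys , suc x , xs) ≡ suc (W e (ys , x , xs))
    W-suc e ys x xs ch = cong₂ _+_
      (trans (sum-++ ys (suc x ∷ xs))
        (trans (+-suc (sum ys) (x + sum xs)) (cong suc (sym (sum-++ ys (x ∷ xs))))))
      (trans (U-join el ys ch) (sym (U-join el ys ch)))
    W-lb : ∀ e ys xs → Ch 0 el ys → Ch 0 es xs →
           W (suc e) (ys , U 0 el ys , xs) ≡ sum ys + U 0 el ys + (sum xs + U 0 es xs)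
    W-lb e ys xs ch _ = trans
      (cong₂ _+_ (sum-++ ys (U 0 el ys ∷ xs))
        (trans (U-join el ys ch)
          (cong (λ c → U c es xs) (m≤n⇒m∸n≡0 (≤-trans (U-≤ el z≤n ch) (m≤n+m l (suc e)))))))
      (assoc (sum ys) (U 0 el ys) (sum xs) (U 0 es xs))
      where
      assoc : ∀ a b c d → a + (b + c) + d ≡ a + b + (c + d)
      assoc = solve-∀
    W′-high : ∀ e ys xs → Ch 0 el ys → Ch 0 es xs →
              W′ (ys , suc (e + l + V xs) , xs) ≡ suc (e + l) + (sum ys + V ys + (sum xs + V xs))
    W′-high e ys xs _ _ = trans
      (cong₂ _+_ (sum-++ ys _) (V-++ ys))
      (assoc (suc (e + l)) (V xs) (sum ys) (V ys) (sum xs))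
      where
      V-++ : ∀ ys → V (ys ++ suc (e + l + V xs) ∷ xs) ≡ V ys
      -- With nothing before it, the maximal entry exceeds l, and the cap at l returns the value
      -- chosen for `V []`.
      V-++ []       = m≥n⇒m⊓n≡n (≤-trans (m≤n+m l (suc e)) (m≤m+n (suc e + l) (V xs)))
      V-++ (_ ∷ _)  = refl
      assoc : ∀ a v b c d → b + (a + v + d) + c ≡ a + (b + c + (d + v))
      assoc = solve-∀

  -- Chains all of whose parts are 2l

  zeros : ℕ → List ℕ
  zeros p = replicate p 0

  zeros-∷ʳ : ∀ p → zeros p ++ 0 ∷ [] ≡ zeros (suc p)
  zeros-∷ʳ zero    = refl
  zeros-∷ʳ (suc p) = cong (0 ∷_) (zeros-∷ʳ p)

  zeros-shift : ∀ p es → zeros p ++ 0 ∷ es ≡ zeros (suc p) ++ es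
  zeros-shift p es = trans (sym (List.++-assoc (zeros p) (0 ∷ []) es)) (cong (_++ es) (zeros-∷ʳ p))

  -- Reverse complement. For parts 2l the constraint is xᵢ - xᵢ₊₁ ≤ l, which is invariant under
  -- reversal combined with x ↦ 2l - x.
  rc : List ℕ → List ℕ
  rc []       = []
  rc (x ∷ xs) = rc xs ++ (l + l ∸ x) ∷ []

  m∸n∸o≡m∸o∸n : ∀ m n o → m ∸ n ∸ o ≡ m ∸ o ∸ n
  m∸n∸o≡m∸o∸n m n o = trans (∸-+-assoc m n o) (trans (cong (m ∸_) (+-comm n o)) (sym (∸-+-assoc m o n)))

  compl-excess : ∀ x → l + l ∸ x ∸ l ≡ l ∸ x
  compl-excess x = trans (m∸n∸o≡m∸o∸n (l + l) x l) (cong (_∸ x) (m+n∸m≡n l l))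

  compl-excess′ : ∀ x → l ∸ (x ∸ l) ≡ (l + l ∸ x) ⊓ l
  compl-excess′ x with ≤-total x l
  ... | inj₁ x≤l rewrite m≤n⇒m∸n≡0 x≤l = sym (m≥n⇒m⊓n≡n (m+n≤o⇒m≤o∸n l (+-monoʳ-≤ l x≤l)))
  ... | inj₂ l≤x = trans lemma (sym (m≤n⇒m⊓n≡m (m≤n+o⇒m∸n≤o (l + l) x (+-monoˡ-≤ l l≤x))))
    where
    lemma : l ∸ (x ∸ l) ≡ l + l ∸ x
    lemma = trans (sym ([m+n]∸[m+o]≡n∸o l l (x ∸ l))) (cong (l + l ∸_) (m+[n∸m]≡n l≤x))

  -- Read backwards, a bound d on the final excess becomes the initial lower bound l - d, and the
  -- initial bound c becomes the final bound l - c. Both ends are tracked because each inductive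
  -- step turns an inner bound into an outer one.
  rc-Ch : ∀ {c d} p xs → c ≤ l → d ≤ l → Ch c (zeros p) xs → U c (zeros p) xs ≤ d →
          Ch (l ∸ d) (zeros p) (rc xs) × U (l ∸ d) (zeros p) (rc xs) ≤ l ∸ c
  rc-Ch zero    []       c≤l d≤l _ u≤ = tt , ∸-monoʳ-≤ l u≤
  rc-Ch {c} {d} (suc p) (x ∷ xs) c≤l d≤l (c≤x , x≤ , ch) u≤ =
    let ch′ , u≤′ = rc-Ch p xs (excess-≤ {0} x≤) d≤l ch u≤
        ch″ = join-∈ {0} {[]} (zeros p) (rc xs , _ , [])
                (ch′ , ≤-trans u≤′ (≤-trans (≤-reflexive (compl-excess′ x)) (m⊓n≤m _ l)) , m∸n≤m (l + l) x , tt)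
        U≡ = U-join {0} {[]} (zeros p) (rc xs) {l + l ∸ x} {[]} ch′
    in subst (λ z → Ch (l ∸ d) z (rc (x ∷ xs)) × U (l ∸ d) z (rc (x ∷ xs)) ≤ l ∸ c) (zeros-∷ʳ p)
         (ch″ , ≤-trans (≤-reflexive (trans U≡ (compl-excess x))) (∸-monoʳ-≤ l c≤x))

  rc-∷ʳ : ∀ xs x → rc (xs ++ x ∷ []) ≡ (l + l ∸ x) ∷ rc xs
  rc-∷ʳ []       x = refl
  rc-∷ʳ (y ∷ xs) x = cong (_++ (l + l ∸ y) ∷ []) (rc-∷ʳ xs x)

  rc-involutive : ∀ {c} p xs → Ch c (zeros p) xs → rc (rc xs) ≡ xs
  rc-involutive zero    []       _             = refl
  rc-involutive (suc p) (x ∷ xs) (_ , x≤ , ch) =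
    trans (rc-∷ʳ (rc xs) (l + l ∸ x)) (cong₂ _∷_ (m∸[m∸n]≡n x≤) (rc-involutive p xs ch))

  sum-rc : ∀ {c} p xs → Ch c (zeros p) xs → sum xs + sum (rc xs) ≡ size (zeros p)
  sum-rc zero    []       _             = refl
  sum-rc (suc p) (x ∷ xs) (_ , x≤ , ch) = trans
    (cong (λ z → x + sum xs + z) (sum-++ (rc xs) _))
    (trans (regroup x (sum xs) (sum (rc xs)) (l + l ∸ x))
           (cong₂ _+_ (m+[n∸m]≡n x≤) (sum-rc p xs ch)))
    where
    regroup : ∀ a b c d → a + b + (c + (d + 0)) ≡ a + d + (b + c)
    regroup = solve-∀

  -- The first entry of the reverse complement comes from the last entry of the list, and that entry
  -- alone determines `U`. Keeping x as a separate head lets the induction run down to it.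
  V-rc-∷ : ∀ {c} p xs x → Ch c (zeros p) xs → V (rc (x ∷ xs)) ≡ l ∸ U (x ∸ l) (zeros p) xs
  V-rc-∷ zero    []        x _            = sym (compl-excess′ x)
  V-rc-∷ (suc p) (x′ ∷ xs) x (_ , _ , ch) = trans (V-++ (rc xs)) (V-rc-∷ p xs x′ ch)
    where
    V-++ : ∀ ys {y zs} → V ((ys ++ y ∷ []) ++ zs) ≡ V (ys ++ y ∷ [])
    V-++ []      = refl
    V-++ (_ ∷ _) = refl

  -- The exchange of `U` and `V` that makes the asymmetric weights of `ChainDual` correct in the
  -- base case.
  V-rc : ∀ p xs → Ch 0 (zeros p) xs → V (rc xs) ≡ l ∸ U 0 (zeros p) xs
  V-rc zero    []       _            = refl
  V-rc (suc p) (x ∷ xs) (_ , _ , ch) = V-rc-∷ p xs x ch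

  chain-base : ∀ p → ChainDual (zeros p)
  chain-base p = record
    { to      = rc
    ; from    = rc
    ; to-∈    = rc-∈
    ; from-∈  = rc-∈
    ; from∘to = rc-involutive p
    ; to∘from = rc-involutive p
    ; weight  = λ xs ch → trans (regroup (sum xs) (U 0 (zeros p) xs) (sum (rc xs)) (V (rc xs)))
        (cong₂ _+_ (sum-rc p xs ch)
          (trans (cong (λ z → U 0 (zeros p) xs + z) (V-rc p xs ch)) (m+[n∸m]≡n (U-≤ (zeros p) z≤n ch))))
    }
    where
    rc-∈ : ∀ xs → Ch 0 (zeros p) xs → Ch 0 (zeros p) (rc xs)
    rc-∈ xs ch = Ch-bound (zeros p) z≤n
      (proj₁ (rc-Ch p xs z≤n (U-≤ (zeros p) z≤n ch) ch ≤-refl))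
    regroup : ∀ a b c d → a + b + (c + d) ≡ a + c + (b + d)
    regroup = solve-∀

  -- Entries are brought down to 2l from left to right. The piece to the left of the current entry
  -- is then always `zeros p`, settled by `chain-base`, and recursion is needed only for the piece
  -- to its right.
  chain-dual : ∀ p es → ChainDual (zeros p ++ es)
  chain-dual p []           = subst ChainDual (sym (List.++-identityʳ (zeros p))) (chain-base p)
  chain-dual p (zero  ∷ es) = subst ChainDual (sym (zeros-shift p es)) (chain-dual (suc p) es)
  chain-dual p (suc e ∷ es) = chain-step (zeros p) e es (chain-base p) (chain-dual 0 es) (chain-dual p (e ∷ es))

  -- Cycles

  module _ (es : List ℕ) where

    -- The trivial first component makes this an instance of `Node.N`, with the last entry of the
    -- cycle imposing the bound on x. Starting `U` from 0 instead of the excess of x makes a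
    -- difference only for empty `es`, where the bound of x on itself holds automatically.
    Cyc : ℕ → ⊤ × ℕ × List ℕ → Set
    Cyc e (_ , x , xs) = ⊤ × U 0 es xs ≤ x × x ≤ e + (l + l) × Ch (x ∸ (e + l)) es xs

  cycSum : ⊤ × ℕ × List ℕ → ℕ
  cycSum (_ , x , xs) = x + sum xs

  CycDual : ℕ → List ℕ → Set
  CycDual e es = Dual (Cyc es e) cycSum (Cyc es e) cycSum (size (e ∷ es))

  -- Deleting one entry of a cycle leaves a single open chain. A minimal entry equals `U` of that
  -- chain and a maximal one is a constant plus `V`, so the sums on both sides become the two
  -- weights of `chain-dual`.
  cyc-step : ∀ e es → CycDual e es → CycDual (suc e) es
  cyc-step e es Θ = step (λ _ → cycSum) cycSum
      (λ (_ , xs) → sum xs + U 0 es xs) (λ (_ , xs) → sum xs + V xs)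
      (λ _ _ _ _ _ → refl) (λ _ _ xs _ _ → +-comm (U 0 es xs) (sum xs))
      (λ e _ xs _ _ → trans (+-assoc (suc (e + l)) (V xs) (sum xs))
                            (cong (λ z → suc (e + l) + z) (+-comm (V xs) (sum xs))))
      Θ pad (regroup e l (size es))
    where
    open Node {R = λ (_ : ⊤) → ⊤} {es} {λ _ xs → U 0 es xs} (λ _ ch → U-≤ es z≤n ch)
    regroup : ∀ e l a → e + l + (a + l) ≡ e + (l + l) + a
    regroup = solve-∀
    module H = Dual (chain-dual 0 es)
    pad : Dual Rest (λ (_ , xs) → sum xs + U 0 es xs) Rest (λ (_ , xs) → sum xs + V xs) (size es + l)
    pad = record
      { to      = λ (_ , xs) → tt , H.to xs
      ; from    = λ (_ , xs) → tt , H.from xs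
      ; to-∈    = λ (_ , xs) (_ , ch) → tt , H.to-∈ xs ch
      ; from-∈  = λ (_ , xs) (_ , ch) → tt , H.from-∈ xs ch
      ; from∘to = λ (_ , xs) (_ , ch) → cong (tt ,_) (H.from∘to xs ch)
      ; to∘from = λ (_ , xs) (_ , ch) → cong (tt ,_) (H.to∘from xs ch)
      ; weight  = λ (_ , xs) (_ , ch) → H.weight xs ch
      }

  -- `cyc-step` changes only the head of the cycle; rotating brings the next entry into that
  -- position.
  rotation : ∀ e e′ es → Iso (Cyc (e′ ∷ es) e) cycSum (Cyc (es ++ e ∷ []) e′) cycSum
  rotation e e′ es = record
    { to      = to
    ; from    = from
    ; to-∈    = to-∈
    ; from-∈  = from-∈
    ; from∘to = from∘to
    ; to∘from = to∘from
    ; weight  = weight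
    }
    where
    to from : ⊤ × ℕ × List ℕ → ⊤ × ℕ × List ℕ
    to (_ , x , [])      = tt , x , []
    to (_ , x , x′ ∷ xs) = tt , x′ , xs ++ x ∷ []
    from (_ , x′ , ys) = let xs , x , _ = split es ys in tt , x , x′ ∷ xs
    to-∈ : ∀ z → Cyc (e′ ∷ es) e z → Cyc (es ++ e ∷ []) e′ (to z)
    to-∈ (_ , x , x′ ∷ xs) (_ , u≤ , x≤ , (lo , x′≤ , ch)) =
      tt , ≤-trans (≤-reflexive (U-join es xs (Ch-bound es z≤n ch))) lo , x′≤ ,
      join-∈ es (xs , x , []) (ch , u≤ , x≤ , tt)
    from-∈ : ∀ z → Cyc (es ++ e ∷ []) e′ z → Cyc (e′ ∷ es) e (from z)
    from-∈ (_ , x′ , ys) (_ , u≤ , x′≤ , ch)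
      with split es ys | split-∈ {e} {[]} es ys ch | join∘split {e} {[]} es ys ch
    ... | xs , x , [] | ch′ , u≤′ , x≤ , _ | refl =
      tt , u≤′ , x≤ ,
      ≤-trans (≤-reflexive (sym (U-join {e} {[]} es xs (Ch-bound es z≤n ch′)))) u≤ , x′≤ , ch′
    from∘to : ∀ z → Cyc (e′ ∷ es) e z → from (to z) ≡ z
    from∘to (_ , x , x′ ∷ xs) (_ , _ , _ , _ , _ , ch) =
      cong (λ (ys , y , _) → tt , y , x′ ∷ ys) (split∘join {e} {[]} es xs ch)
    to∘from : ∀ z → Cyc (es ++ e ∷ []) e′ z → to (from z) ≡ z
    to∘from (_ , x′ , ys) (_ , u≤ , x′≤ , ch)
      with split es ys | split-∈ {e} {[]} es ys ch | join∘split {e} {[]} es ys ch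
    ... | xs , x , [] | _ | refl = refl
    weight : ∀ z → Cyc (e′ ∷ es) e z → cycSum (to z) ≡ cycSum z
    weight (_ , x , x′ ∷ xs) _ = trans (cong (λ z → x′ + z) (sum-++ xs (x ∷ []))) (regroup x x′ (sum xs))
      where
      regroup : ∀ a b c → b + (c + (a + 0)) ≡ a + (b + c)
      regroup = solve-∀

  -- Complementing the head in place and reversing the rest is a reversal of the whole cyclic order.
  cyc-base : ∀ p → CycDual 0 (zeros p)
  cyc-base p = record
    { to      = λ (_ , x , xs) → tt , l + l ∸ x , rc xs
    ; from    = λ (_ , x , xs) → tt , l + l ∸ x , rc xs
    ; to-∈    = compl-∈
    ; from-∈  = compl-∈
    ; from∘to = compl-involutive
    ; to∘from = compl-involutive
    ; weight  = λ (_ , x , xs) (_ , _ , x≤ , ch) → trans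
        (regroup x (sum xs) (l + l ∸ x) (sum (rc xs))) (cong₂ _+_ (m+[n∸m]≡n x≤) (sum-rc p xs ch))
    }
    where
    regroup : ∀ a b c d → a + b + (c + d) ≡ a + c + (b + d)
    regroup = solve-∀
    compl-involutive : ∀ z → Cyc (zeros p) 0 z →
      (tt , l + l ∸ (l + l ∸ proj₁ (proj₂ z)) , rc (rc (proj₂ (proj₂ z)))) ≡ z
    compl-involutive (_ , x , xs) (_ , _ , x≤ , ch) =
      cong₂ (λ y ys → tt , y , ys) (m∸[m∸n]≡n x≤) (rc-involutive p xs ch)
    -- Supplies the final bound for `rc-Ch`, which must be at most l. The minimum loses nothing,
    -- because l ∸ (x ⊓ l) is precisely the excess of the complemented head 2l - x.
    U-⊓ : ∀ p {x} xs → x ≤ l + l → U 0 (zeros p) xs ≤ x → Ch (x ∸ l) (zeros p) xs →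
          U (x ∸ l) (zeros p) xs ≤ x ⊓ l
    U-⊓ zero    {x} []       x≤ _  _  = ⊓-glb (m∸n≤m x l) (excess-≤ {0} x≤)
    U-⊓ (suc p)     (y ∷ ys) x≤ u≤ ch = ⊓-glb u≤ (U-≤ (zeros (suc p)) (excess-≤ {0} x≤) ch)
    compl-∈ : ∀ z → Cyc (zeros p) 0 z → Cyc (zeros p) 0 (tt , l + l ∸ proj₁ (proj₂ z) , rc (proj₂ (proj₂ z)))
    compl-∈ (_ , x , xs) (_ , u≤ , x≤ , ch) =
      let ch′ , u≤′ = rc-Ch p xs (excess-≤ {0} x≤) (m⊓n≤n x l) ch (U-⊓ p xs x≤ u≤ ch)
      in tt
       , ≤-trans (U-mono (zeros p) (rc xs) z≤n)
           (≤-trans u≤′ (≤-trans (≤-reflexive (compl-excess′ x)) (m⊓n≤m _ l)))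
       , m∸n≤m (l + l) x
       , subst (λ c → Ch c (zeros p) (rc xs)) (trans (l∸[x⊓l] x) (sym (compl-excess x))) ch′
      where
      l∸[x⊓l] : ∀ x → l ∸ (x ⊓ l) ≡ l ∸ x
      l∸[x⊓l] x with ≤-total x l
      ... | inj₁ x≤l = cong (l ∸_) (m≤n⇒m⊓n≡m x≤l)
      ... | inj₂ l≤x = trans (cong (l ∸_) (m≥n⇒m⊓n≡n l≤x)) (trans (n∸n≡0 l) (sym (m≤n⇒m∸n≡0 l≤x)))

  -- A head that has reached 2l is rotated to the back, where it joins the trailing zeros. When no
  -- other entries are left, all parts are 2l.
  cyc-dual : ∀ p e es → CycDual e (es ++ zeros p)
  cyc-dual p (suc e) es       = cyc-step e (es ++ zeros p) (cyc-dual p e es)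
  cyc-dual p zero    []       = cyc-base p
  cyc-dual p zero    (e ∷ es) = subst (Dual _ _ _ _) size-rotate
    (transport R R (subst (CycDual e) (sym rotated) (cyc-dual (suc p) e es)))
    where
    R = rotation 0 e (es ++ zeros p)
    rotated : (es ++ zeros p) ++ 0 ∷ [] ≡ es ++ zeros (suc p)
    rotated = trans (List.++-assoc es (zeros p) (0 ∷ [])) (cong (es ++_) (zeros-∷ʳ p))
    size-rotate : size (e ∷ (es ++ zeros p) ++ 0 ∷ []) ≡ size (0 ∷ e ∷ es ++ zeros p)
    size-rotate = trans (size-++ (e ∷ es ++ zeros p) (0 ∷ [])) (regroup (size (e ∷ es ++ zeros p)) l)
      where
      regroup : ∀ a b → a + (b + b + 0) ≡ b + b + a
      regroup = solve-∀

-- Lattice points of chainlink polytopes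

next-last : ∀ d → next (fromℕ d) ≡ zero
next-last d = Fin.toℕ-injective (trans (Fin.toℕ-fromℕ< _)
  (trans (cong (λ k → suc k % suc d) (Fin.toℕ-fromℕ d)) (n%n≡0 (suc d))))

next-inject₁ : ∀ {d} (i : Fin d) → next (inject₁ i) ≡ suc i
next-inject₁ {d} i = Fin.toℕ-injective (trans (Fin.toℕ-fromℕ< _)
  (trans (cong (λ k → suc k % suc d) (Fin.toℕ-inject₁ i)) (m<n⇒m%n≡m (s≤s (Fin.toℕ<n i)))))

lookup-∷ʳ-last : ∀ {A : Set} {d} (x : A) (xs : Vec A d) → lookup (xs Vec.∷ʳ x) (fromℕ d) ≡ x
lookup-∷ʳ-last x []       = refl
lookup-∷ʳ-last x (_ ∷ xs) = lookup-∷ʳ-last x xs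

lookup-∷ʳ-inject₁ : ∀ {A : Set} {d} (x : A) (xs : Vec A d) i → lookup (xs Vec.∷ʳ x) (inject₁ i) ≡ lookup xs i
lookup-∷ʳ-inject₁ x (_ ∷ xs) zero    = refl
lookup-∷ʳ-inject₁ x (_ ∷ xs) (suc i) = lookup-∷ʳ-inject₁ x xs i

lookup-next : ∀ {A : Set} {d} (x : A) (xs : Vec A d) i → lookup (xs Vec.∷ʳ x) i ≡ lookup (x ∷ xs) (next i)
lookup-next {d = d} x xs i with view i
... | ‵fromℕ     = trans (lookup-∷ʳ-last x xs) (cong (lookup (x ∷ xs)) (sym (next-last d)))
... | ‵inject₁ j = trans (lookup-∷ʳ-inject₁ x xs j) (cong (lookup (x ∷ xs)) (sym (next-inject₁ j)))

module _ (l : ℕ) where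
  open Chains l

  CycV : ∀ {d} → Vec ℕ (suc d) → Vec ℕ (suc d) → Set
  CycV es xs = ∀ i → lookup xs i ≤ lookup es i + (l + l)
                   × lookup xs i ∸ (lookup es i + l) ≤ lookup xs (next i)

  private
    us : ∀ {d} → Vec ℕ d → Vec ℕ d → Vec ℕ d
    us es xs = Vec.zipWith (λ e x → x ∸ (e + l)) es xs

  -- Placing c before the excesses and z behind the entries shifts one against the other, so that
  -- each excess meets the entry following it. With the excess of the head for c and the head itself
  -- for z this is the cyclic condition.
  Ch⇒ : ∀ {d c z} (es xs : Vec ℕ d) → Ch c (toList es) (toList xs) → U c (toList es) (toList xs) ≤ z →
        (∀ i → lookup xs i ≤ lookup es i + (l + l)) ×
        (∀ i → lookup (c ∷ us es xs) i ≤ lookup (xs Vec.∷ʳ z) i)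
  Ch⇒ []       []       ch              u≤ = (λ ()) , λ { zero → u≤ }
  Ch⇒ (e ∷ es) (x ∷ xs) (c≤x , x≤ , ch) u≤ =
    let p , q = Ch⇒ es xs ch u≤
    in (λ { zero → x≤ ; (suc i) → p i }) , (λ { zero → c≤x ; (suc i) → q i })

  ⇒Ch : ∀ {d c z} (es xs : Vec ℕ d) → (∀ i → lookup xs i ≤ lookup es i + (l + l)) →
        (∀ i → lookup (c ∷ us es xs) i ≤ lookup (xs Vec.∷ʳ z) i) →
        Ch c (toList es) (toList xs) × U c (toList es) (toList xs) ≤ z
  ⇒Ch []       []       p q = tt , q zero
  ⇒Ch (e ∷ es) (x ∷ xs) p q =
    let ch , u≤ = ⇒Ch es xs (p ∘ suc) (q ∘ suc) in (q zero , p zero , ch) , u≤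

  lookup-us : ∀ {d} (es xs : Vec ℕ d) i → lookup (us es xs) i ≡ lookup xs i ∸ (lookup es i + l)
  lookup-us es xs i = Vec.lookup-zipWith _ i es xs

  Cyc⇒CycV : ∀ {d} e x (es xs : Vec ℕ d) →
             Cyc (toList es) e (tt , x , toList xs) → CycV (e ∷ es) (x ∷ xs)
  Cyc⇒CycV e x es xs (_ , u≤ , x≤ , ch) i =
    bound i , subst₂ _≤_ (lookup-us (e ∷ es) (x ∷ xs) i) (lookup-next x xs i) (proj₂ pq i)
    where
    U≤ : ∀ {d} (es xs : Vec ℕ d) → U 0 (toList es) (toList xs) ≤ x → U (x ∸ (e + l)) (toList es) (toList xs) ≤ x
    U≤ []       []       _  = m∸n≤m x (e + l)
    U≤ (_ ∷ es) (_ ∷ xs) u≤ = u≤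
    pq = Ch⇒ es xs ch (U≤ es xs u≤)
    bound : ∀ i → lookup (x ∷ xs) i ≤ lookup (e ∷ es) i + (l + l)
    bound zero    = x≤
    bound (suc i) = proj₁ pq i

  CycV⇒Cyc : ∀ {d} e x (es xs : Vec ℕ d) →
             CycV (e ∷ es) (x ∷ xs) → Cyc (toList es) e (tt , x , toList xs)
  CycV⇒Cyc e x es xs p =
    let ch , u≤ = ⇒Ch es xs (proj₁ ∘ p ∘ suc)
          (λ i → subst₂ _≤_ (sym (lookup-us (e ∷ es) (x ∷ xs) i)) (sym (lookup-next x xs i)) (proj₂ (p i)))
    in tt , ≤-trans (U-mono (toList es) (toList xs) z≤n) u≤ , proj₁ (p zero) , ch

≤-from : ∀ {a b c d} → a ℤ.≤ b → b ℤ.- a ≡ d ℤ.- c → c ℤ.≤ d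
≤-from a≤b eq = ℤ.0≤i-j⇒j≤i (subst (+ 0 ℤ.≤_) eq (ℤ.i≤j⇒0≤j-i a≤b))

sumℤ : ∀ {s} → Vec ℤ s → ℤ
sumℤ = Vec.foldr′ ℤ._+_ (+ 0)

LatCL : ∀ {d} → ℤ → Vec ℕ (suc d) → ℕ → Vec ℤ (suc d) → Set
LatCL m A L X = ∀ i →
    (m ℤ.≤ lookup X i)
  × (lookup X i ℤ.≤ + lookup A i ℤ.- m)
  × (lookup X i ℤ.- lookup X (next i) ℤ.≤ + lookup A i ℤ.- + L ℤ.- m)

record Reflection {s} (P : Vec ℤ s → Set) (K : ℤ) : Set where
  field
    to      : Vec ℤ s → Vec ℤ s
    from    : Vec ℤ s → Vec ℤ s
    to-∈    : ∀ {X} → P X → P (to X)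
    from-∈  : ∀ {X} → P X → P (from X)
    from∘to : ∀ {X} → P X → from (to X) ≡ X
    to∘from : ∀ {X} → P X → to (from X) ≡ X
    sum-to  : ∀ {X} → P X → sumℤ (to X) ≡ K ℤ.- sumℤ X

  sum-from : ∀ {X} → P X → sumℤ (from X) ≡ K ℤ.- sumℤ X
  sum-from {X} p = trans (lemma K (sumℤ (from X)))
    (cong (λ z → K ℤ.- z) (trans (sym (sum-to (from-∈ p))) (cong sumℤ (to∘from p))))
    where
    lemma : ∀ a b → b ≡ a ℤ.- (a ℤ.- b)
    lemma = solve-ℤ

module _ {d} (A : Vec ℕ (suc d)) (L : ℕ) (2L≤A : ∀ i → 2 * L ≤ lookup A i)
         (m : ℤ) (m≤L : m ℤ.≤ + L) where
  private
    -- In the coordinates X - m the part Aᵢ turns into Aᵢ - 2m and the constant L into L - m, with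
    -- the same eᵢ = Aᵢ - 2L. Negative m is allowed; m ≤ L keeps the constant a natural number.
    l : ℕ
    l = ∣ + L ℤ.- m ∣
    open Chains l

    +l : + l ≡ + L ℤ.- m
    +l = ℤ.0≤i⇒+∣i∣≡i (ℤ.i≤j⇒0≤j-i m≤L)

    excess : ∀ {k} → Vec ℕ k → Vec ℕ k
    excess = Vec.map (_∸ 2 * L)

    +excess : ∀ i → + lookup (excess A) i ≡ + lookup A i ℤ.- (+ L ℤ.+ + L)
    +excess i = trans (cong +_ (Vec.lookup-map i _ A))
      (trans (sym (ℤ.⊖-≥ (2L≤A i))) (trans (sym (ℤ.m-n≡m⊖n (lookup A i) (2 * L)))
        (cong (λ k → + lookup A i ℤ.- (+ L ℤ.+ + k)) (+-identityʳ L))))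

    shiftⁿ : ℤ → ℕ
    shiftⁿ x = ∣ x ℤ.- m ∣

    unshift : ℕ → ℤ
    unshift x = + x ℤ.+ m

    shift-unshift : ∀ x → shiftⁿ (unshift x) ≡ x
    shift-unshift x = cong ∣_∣ (lemma (+ x) m)
      where
      lemma : ∀ a b → a ℤ.+ b ℤ.- b ≡ a
      lemma = solve-ℤ

    unshift-shift : ∀ {x} → m ℤ.≤ x → unshift (shiftⁿ x) ≡ x
    unshift-shift {x} m≤x = trans (cong (ℤ._+ m) (ℤ.0≤i⇒+∣i∣≡i (ℤ.i≤j⇒0≤j-i m≤x))) (lemma x m)
      where
      lemma : ∀ a b → a ℤ.- b ℤ.+ b ≡ a
      lemma = solve-ℤ

    bound-gap : ∀ {e k x} a b m y → e ≡ a ℤ.- (b ℤ.+ b) → k ≡ b ℤ.- m → x ≡ y ℤ.- m →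
                a ℤ.- m ℤ.- y ≡ e ℤ.+ (k ℤ.+ k) ℤ.- x
    bound-gap a b m y refl refl refl = lemma a b m y
      where
      lemma : ∀ a b m y → a ℤ.- m ℤ.- y ≡ (a ℤ.- (b ℤ.+ b)) ℤ.+ (b ℤ.- m ℤ.+ (b ℤ.- m)) ℤ.- (y ℤ.- m)
      lemma = solve-ℤ

    step-gap : ∀ {e k x x′} a b m y y′ → e ≡ a ℤ.- (b ℤ.+ b) → k ≡ b ℤ.- m → x ≡ y ℤ.- m → x′ ≡ y′ ℤ.- m →
               a ℤ.- b ℤ.- m ℤ.- (y ℤ.- y′) ≡ e ℤ.+ k ℤ.+ x′ ℤ.- x
    step-gap a b m y y′ refl refl refl refl = lemma a b m y y′
      where
      lemma : ∀ a b m y y′ → a ℤ.- b ℤ.- m ℤ.- (y ℤ.- y′) ≡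
                             (a ℤ.- (b ℤ.+ b)) ℤ.+ (b ℤ.- m) ℤ.+ (y′ ℤ.- m) ℤ.- (y ℤ.- m)
      lemma = solve-ℤ

    Lat⇒CycV : ∀ X → LatCL m A L X → CycV l (excess A) (Vec.map shiftⁿ X)
    Lat⇒CycV X p i =
        ℤ.drop‿+≤+ (≤-from (proj₁ (proj₂ (p i))) (bound-gap (+ lookup A i) (+ L) m (lookup X i) (+excess i) +l (+x i)))
      , m≤n+o⇒m∸n≤o _ (lookup (excess A) i + l)
          (ℤ.drop‿+≤+ (≤-from (proj₂ (proj₂ (p i))) (step-gap (+ lookup A i) (+ L) m (lookup X i) (lookup X (next i)) (+excess i) +l (+x i) (+x (next i)))))
      where
      +x : ∀ i → + lookup (Vec.map shiftⁿ X) i ≡ lookup X i ℤ.- m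
      +x i = trans (cong +_ (Vec.lookup-map i shiftⁿ X)) (ℤ.0≤i⇒+∣i∣≡i (ℤ.i≤j⇒0≤j-i (proj₁ (p i))))

    CycV⇒Lat : ∀ x → CycV l (excess A) x → LatCL m A L (Vec.map unshift x)
    CycV⇒Lat x p i =
        subst (m ℤ.≤_) (sym (Vec.lookup-map i unshift x)) (ℤ.i≤j+i m (+ lookup x i))
      , ≤-from (ℤ.+≤+ (proj₁ (p i))) (sym (bound-gap (+ lookup A i) (+ L) m (lookup (Vec.map unshift x) i) (+excess i) +l (+x i)))
      , ≤-from (ℤ.+≤+ (m∸n≤o⇒m≤n+o _ (lookup (excess A) i + l) (proj₂ (p i))))
               (sym (step-gap (+ lookup A i) (+ L) m (lookup (Vec.map unshift x) i) (lookup (Vec.map unshift x) (next i)) (+excess i) +l (+x i) (+x (next i))))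
      where
      +x : ∀ i → + lookup x i ≡ lookup (Vec.map unshift x) i ℤ.- m
      +x i = trans (lemma (+ lookup x i) m) (cong (ℤ._- m) (sym (Vec.lookup-map i unshift x)))
        where
        lemma : ∀ a b → a ≡ a ℤ.+ b ℤ.- b
        lemma = solve-ℤ

    toVec : ∀ k → List ℕ → Vec ℤ k
    toVec zero    _        = []
    toVec (suc k) []       = + 0 ∷ toVec k []
    toVec (suc k) (x ∷ xs) = unshift x ∷ toVec k xs

    toVec-toList : ∀ {k} (xs : Vec ℕ k) → toVec k (toList xs) ≡ Vec.map unshift xs
    toVec-toList []       = refl
    toVec-toList (x ∷ xs) = cong (unshift x ∷_) (toVec-toList xs)

    -- A view turning lists back into vectors: `Ch` forces a list to have the length of its bounds.
    data Listed {k} : List ℕ → Set where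
      listed : ∀ (xs : Vec ℕ k) → Listed (toList xs)

    list : ∀ {k c} (es : Vec ℕ k) xs → Ch c (toList es) xs → Listed {k} xs
    list []       []       _            = listed []
    list (_ ∷ es) (x ∷ xs) (_ , _ , ch) with list es xs ch
    ... | listed xs′ = listed (x ∷ xs′)

    encode : Vec ℤ (suc d) → ⊤ × ℕ × List ℕ
    encode (x ∷ xs) = tt , shiftⁿ x , toList (Vec.map shiftⁿ xs)

    decode : ⊤ × ℕ × List ℕ → Vec ℤ (suc d)
    decode (_ , x , xs) = unshift x ∷ toVec d xs

    module _ {a : ℕ} {as : Vec ℕ d} (A≡ : A ≡ a ∷ as) where
      private
        e : ℕ
        e = a ∸ 2 * L
        es : List ℕ
        es = toList (excess as)

      coding : Iso (LatCL m A L) (cycSum ∘ encode) (Cyc es e) (cycSum)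
      coding = record
        { to      = encode
        ; from    = decode
        ; to-∈    = to-∈
        ; from-∈  = from-∈
        ; from∘to = from∘to
        ; to∘from = to∘from
        ; weight  = λ _ _ → refl
        }
        where
        to-∈ : ∀ X → LatCL m A L X → Cyc es e (encode X)
        to-∈ (x ∷ xs) p = CycV⇒Cyc l e (shiftⁿ x) (excess as) (Vec.map shiftⁿ xs)
          (subst (λ A → CycV l (excess A) (Vec.map shiftⁿ (x ∷ xs))) A≡ (Lat⇒CycV (x ∷ xs) p))
        from-∈ : ∀ z → Cyc es e z → LatCL m A L (decode z)
        from-∈ (_ , x , xs) p@(_ , _ , _ , ch) with list (excess as) xs ch
        ... | listed xs′ rewrite toVec-toList xs′ =
          CycV⇒Lat (x ∷ xs′) (subst (λ A → CycV l (excess A) (x ∷ xs′)) (sym A≡)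
            (Cyc⇒CycV l e x (excess as) xs′ p))
        from∘to : ∀ X → LatCL m A L X → decode (encode X) ≡ X
        from∘to (x ∷ xs) p = cong₂ _∷_ (unshift-shift (proj₁ (p zero)))
          (trans (toVec-toList (Vec.map shiftⁿ xs)) (inverse xs (proj₁ ∘ p ∘ suc)))
          where
          inverse : ∀ {k} (xs : Vec ℤ k) → (∀ i → m ℤ.≤ lookup xs i) →
                    Vec.map unshift (Vec.map shiftⁿ xs) ≡ xs
          inverse []       _ = refl
          inverse (x ∷ xs) p = cong₂ _∷_ (unshift-shift (p zero)) (inverse xs (p ∘ suc))
        to∘from : ∀ z → Cyc es e z → encode (decode z) ≡ z
        to∘from (_ , x , xs) (_ , _ , _ , ch) with list (excess as) xs ch
        ... | listed xs′ = cong₂ (λ y ys → tt , y , ys) (shift-unshift x)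
          (trans (cong (toList ∘ Vec.map shiftⁿ) (toVec-toList xs′)) (cong toList (inverse xs′)))
          where
          inverse : ∀ {k} (xs : Vec ℕ k) → Vec.map shiftⁿ (Vec.map unshift xs) ≡ xs
          inverse []       = refl
          inverse (x ∷ xs) = cong₂ _∷_ (shift-unshift x) (inverse xs)

      latDual : Dual (LatCL m A L) (cycSum ∘ encode) (LatCL m A L) (cycSum ∘ encode) (size (e ∷ es))
      latDual = transport coding coding (subst (CycDual e) (List.++-identityʳ es) (cyc-dual 0 e es))

    total-encode : ∀ X → (∀ i → m ℤ.≤ lookup X i) → + cycSum (encode X) ≡ sumℤ X ℤ.- + suc d ℤ.* m
    total-encode (x ∷ xs) p = sums (x ∷ xs) p
      where
      sums : ∀ {k} (xs : Vec ℤ k) → (∀ i → m ℤ.≤ lookup xs i) →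
             + sum (toList (Vec.map shiftⁿ xs)) ≡ sumℤ xs ℤ.- + k ℤ.* m
      sums {zero} []       _ = sym (cong (λ z → + 0 ℤ.- z) (ℤ.*-zeroˡ m))
      sums {suc k} (x ∷ xs) p = trans
        (cong₂ ℤ._+_ (ℤ.0≤i⇒+∣i∣≡i (ℤ.i≤j⇒0≤j-i (p zero))) (sums xs (p ∘ suc)))
        (lemma x (sumℤ xs) m (+ k))
        where
        lemma : ∀ a b m k → a ℤ.- m ℤ.+ (b ℤ.- k ℤ.* m) ≡ a ℤ.+ b ℤ.- (+ 1 ℤ.+ k) ℤ.* m
        lemma = solve-ℤ

    size-excess : ∀ {k} (A : Vec ℕ k) → (∀ i → 2 * L ≤ lookup A i) →
                  + size (toList (excess A)) ≡ + Vec.sum A ℤ.- (+ k ℤ.* m ℤ.+ + k ℤ.* m)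
    size-excess []       _ = sym (cong (λ z → + 0 ℤ.- (z ℤ.+ z)) (ℤ.*-zeroˡ m))
    size-excess {suc k} (a ∷ A) p = trans
      (cong₂ (λ u v → + (a ∸ 2 * L) ℤ.+ (u ℤ.+ u) ℤ.+ v) +l (size-excess A (p ∘ suc)))
      (trans (cong (λ u → u ℤ.+ (+ L ℤ.- m ℤ.+ (+ L ℤ.- m)) ℤ.+ (+ Vec.sum A ℤ.- (+ k ℤ.* m ℤ.+ + k ℤ.* m))) +e)
             (lemma (+ a) (+ L) m (+ k) (+ Vec.sum A)))
      where
      +e : + (a ∸ 2 * L) ≡ + a ℤ.- (+ L ℤ.+ + L)
      +e = trans (sym (ℤ.⊖-≥ (p zero))) (trans (sym (ℤ.m-n≡m⊖n a (2 * L)))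
        (cong (λ k → + a ℤ.- (+ L ℤ.+ + k)) (+-identityʳ L)))
      lemma : ∀ a b m k s → (a ℤ.- (b ℤ.+ b)) ℤ.+ (b ℤ.- m ℤ.+ (b ℤ.- m)) ℤ.+ (s ℤ.- (k ℤ.* m ℤ.+ k ℤ.* m)) ≡
                            a ℤ.+ s ℤ.- ((+ 1 ℤ.+ k) ℤ.* m ℤ.+ (+ 1 ℤ.+ k) ℤ.* m)
      lemma = solve-ℤ

  -- Passing to X - m lowers both levels by s · m and the total by 2 s · m, where s is the number of
  -- parts. The shifts cancel, so the constant is the sum of `A` for every m.
  reflection : Reflection (LatCL m A L) (+ Vec.sum A)
  reflection = go A refl
    where
    go : ∀ A′ → A ≡ A′ → Reflection (LatCL m A L) (+ Vec.sum A)
    go (a ∷ as) A≡ = record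
      { to      = D.to
      ; from    = D.from
      ; to-∈    = D.to-∈ _
      ; from-∈  = D.from-∈ _
      ; from∘to = D.from∘to _
      ; to∘from = D.to∘from _
      ; sum-to  = λ {X} p → isolate (sumℤ X) (+ suc d ℤ.* m) {sumℤ (D.to X)} {+ Vec.sum A}
          (trans (sym (cong₂ ℤ._+_ (total-encode X (proj₁ ∘ p)) (total-encode (D.to X) (proj₁ ∘ D.to-∈ _ p))))
            (trans (cong +_ (D.weight X p)) (trans (cong (+_ ∘ size ∘ toList ∘ excess) (sym A≡)) (size-excess A 2L≤A))))
      }
      where
      module D = Dual (latDual A≡)
      isolate : ∀ a b {c k} → a ℤ.- b ℤ.+ (c ℤ.- b) ≡ k ℤ.- (b ℤ.+ b) → c ≡ k ℤ.- a
      isolate a b {c} {k} eq = trans (lemma a b c) (trans (cong (λ z → z ℤ.+ (b ℤ.+ b) ℤ.- a) eq) (lemma′ a b k))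
        where
        lemma : ∀ a b c → c ≡ a ℤ.- b ℤ.+ (c ℤ.- b) ℤ.+ (b ℤ.+ b) ℤ.- a
        lemma = solve-ℤ
        lemma′ : ∀ a b k → k ℤ.- (b ℤ.+ b) ℤ.+ (b ℤ.+ b) ℤ.- a ≡ k ℤ.- a
        lemma′ = solve-ℤ

-- Rational bounds for real numbers

module _ (N : ℕ) .{{_ : NonZero N}} where

  toℚᵘ-/ : ∀ X → toℚᵘ (X / N) ℚᵘ.≃ (X ℚᵘ./ N)
  toℚᵘ-/ X = helper N
    where
    helper : ∀ N .{{_ : NonZero N}} → toℚᵘ (X / N) ℚᵘ.≃ (X ℚᵘ./ N)
    helper (suc n) = ℚ.toℚᵘ-fromℚᵘ (mkℚᵘ X n)

module _ (N M : ℕ) .{{_ : NonZero N}} .{{_ : NonZero M}} (X Y : ℤ) where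

  /-mono-≤ : X ℤ.* + M ℤ.≤ Y ℤ.* + N → X / N ℚ.≤ Y / M
  /-mono-≤ p = ℚ.toℚᵘ-cancel-≤ (ℚᵘ.≤-respˡ-≃ (ℚᵘ.≃-sym (toℚᵘ-/ N X))
    (ℚᵘ.≤-respʳ-≃ (ℚᵘ.≃-sym (toℚᵘ-/ M Y)) (helper N M p)))
    where
    helper : ∀ N M .{{_ : NonZero N}} .{{_ : NonZero M}} → X ℤ.* + M ℤ.≤ Y ℤ.* + N → X ℚᵘ./ N ℚᵘ.≤ Y ℚᵘ./ M
    helper (suc _) (suc _) p = *≤* p

  /-cancel-≤ : X / N ℚ.≤ Y / M → X ℤ.* + M ℤ.≤ Y ℤ.* + N
  /-cancel-≤ p = helper N M (ℚᵘ.≤-respˡ-≃ (toℚᵘ-/ N X) (ℚᵘ.≤-respʳ-≃ (toℚᵘ-/ M Y) (ℚ.toℚᵘ-mono-≤ p)))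
    where
    helper : ∀ N M .{{_ : NonZero N}} .{{_ : NonZero M}} → X ℚᵘ./ N ℚᵘ.≤ Y ℚᵘ./ M → X ℤ.* + M ℤ.≤ Y ℤ.* + N
    helper (suc _) (suc _) (*≤* p) = p

  /-mono-< : X ℤ.* + M ℤ.< Y ℤ.* + N → X / N ℚ.< Y / M
  /-mono-< p = ℚ.toℚᵘ-cancel-< (ℚᵘ.<-respˡ-≃ (ℚᵘ.≃-sym (toℚᵘ-/ N X))
    (ℚᵘ.<-respʳ-≃ (ℚᵘ.≃-sym (toℚᵘ-/ M Y)) (helper N M p)))
    where
    helper : ∀ N M .{{_ : NonZero N}} .{{_ : NonZero M}} → X ℤ.* + M ℤ.< Y ℤ.* + N → X ℚᵘ./ N ℚᵘ.< Y ℚᵘ./ M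
    helper (suc _) (suc _) p = *<* p

  /-cancel-< : X / N ℚ.< Y / M → X ℤ.* + M ℤ.< Y ℤ.* + N
  /-cancel-< p = helper N M (ℚᵘ.<-respˡ-≃ (toℚᵘ-/ N X) (ℚᵘ.<-respʳ-≃ (toℚᵘ-/ M Y) (ℚ.toℚᵘ-mono-< p)))
    where
    helper : ∀ N M .{{_ : NonZero N}} .{{_ : NonZero M}} → X ℚᵘ./ N ℚᵘ.< Y ℚᵘ./ M → X ℤ.* + M ℤ.< Y ℤ.* + N
    helper (suc _) (suc _) (*<* p) = p

/-cross : ∀ N M .{{_ : NonZero N}} .{{_ : NonZero M}} X Y → X ℤ.* + M ≡ Y ℤ.* + N → X / N ≡ Y / M
/-cross N M X Y eq = ℚ.≤-antisym (/-mono-≤ N M X Y (ℤ.≤-reflexive eq)) (/-mono-≤ M N Y X (ℤ.≤-reflexive (sym eq)))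

module _ (N : ℕ) .{{_ : NonZero N}} where

  /-monoˡ : ∀ {X Y} → X ℤ.≤ Y → X / N ℚ.≤ Y / N
  /-monoˡ {X} {Y} p = /-mono-≤ N N X Y (ℤ.*-monoʳ-≤-nonNeg (+ N) p)

  /-cancelˡ : ∀ X Y → X / N ℚ.≤ Y / N → X ℤ.≤ Y
  /-cancelˡ X Y p = ℤ.*-cancelʳ-≤-pos X Y (+ N) {{ℤ.positive (ℤ.+<+ (>-nonZero⁻¹ N))}} (/-cancel-≤ N N X Y p)

  /-+ : ∀ X Y → X / N ℚ.+ Y / N ≡ (X ℤ.+ Y) / N
  /-+ X Y = ℚ.toℚᵘ-injective (ℚᵘ.≃-trans (ℚ.toℚᵘ-homo-+ (X / N) (Y / N))
    (ℚᵘ.≃-trans (ℚᵘ.+-cong (toℚᵘ-/ N X) (toℚᵘ-/ N Y))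
      (ℚᵘ.≃-trans (helper N) (ℚᵘ.≃-sym (toℚᵘ-/ N (X ℤ.+ Y))))))
    where
    helper : ∀ N .{{_ : NonZero N}} → (X ℚᵘ./ N) ℚᵘ.+ (Y ℚᵘ./ N) ℚᵘ.≃ (X ℤ.+ Y) ℚᵘ./ N
    helper (suc n) = *≡* (lemma X Y (+ suc n))
      where
      lemma : ∀ x y n → (x ℤ.* n ℤ.+ y ℤ.* n) ℤ.* n ≡ (x ℤ.+ y) ℤ.* (n ℤ.* n)
      lemma = solve-ℤ

  /-neg : ∀ X → ℚ.- (X / N) ≡ (ℤ.- X) / N
  /-neg X = ℚ.toℚᵘ-injective (ℚᵘ.≃-trans (ℚ.toℚᵘ-homo‿- (X / N))
    (ℚᵘ.≃-trans (ℚᵘ.-‿cong (toℚᵘ-/ N X)) (ℚᵘ.≃-trans (helper N) (ℚᵘ.≃-sym (toℚᵘ-/ N (ℤ.- X))))))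
    where
    helper : ∀ N .{{_ : NonZero N}} → ℚᵘ.- (X ℚᵘ./ N) ℚᵘ.≃ (ℤ.- X) ℚᵘ./ N
    helper (suc n) = ℚᵘ.≃-refl

  /-- : ∀ X Y → X / N ℚ.- Y / N ≡ (X ℤ.- Y) / N
  /-- X Y = trans (cong (X / N ℚ.+_) (/-neg Y)) (/-+ X (ℤ.- Y))

/-* : ∀ N M .{{_ : NonZero N}} .{{_ : NonZero M}} X Y →
      (X / N) ℚ.* (Y / M) ≡ ((X ℤ.* Y) / (N * M)) {{m*n≢0 N M}}
/-* N M X Y = ℚ.toℚᵘ-injective (ℚᵘ.≃-trans (ℚ.toℚᵘ-homo-* (X / N) (Y / M))
    (ℚᵘ.≃-trans (ℚᵘ.*-cong (toℚᵘ-/ N X) (toℚᵘ-/ M Y))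
      (ℚᵘ.≃-trans (helper N M) (ℚᵘ.≃-sym (toℚᵘ-/ (N * M) {{m*n≢0 N M}} (X ℤ.* Y))))))
    where
    helper : ∀ N M .{{_ : NonZero N}} .{{_ : NonZero M}} →
             (X ℚᵘ./ N) ℚᵘ.* (Y ℚᵘ./ M) ℚᵘ.≃ ((X ℤ.* Y) ℚᵘ./ (N * M)) {{m*n≢0 N M}}
    helper (suc n) (suc m) = ℚᵘ.≃-refl

≤-fromℚ : ∀ {a b c d} → a ℚ.≤ b → b ℚ.- a ≡ d ℚ.- c → c ℚ.≤ d
≤-fromℚ {a} {b} {c} {d} a≤b eq = subst₂ ℚ._≤_ (cancel a c) (trans (cong (ℚ._+ c) eq) (cancel′ d c))
  (ℚ.+-monoˡ-≤ c (ℚ.+-monoˡ-≤ (ℚ.- a) a≤b))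
  where
  cancel : ∀ a c → a ℚ.- a ℚ.+ c ≡ c
  cancel = solve 2 (λ a c → a :- a :+ c := c) refl
  cancel′ : ∀ a c → a ℚ.- c ℚ.+ c ≡ a
  cancel′ = solve 2 (λ a c → a :- c :+ c := a) refl

2⁻-halves : ∀ n → 2⁻ (suc n) ℚ.+ 2⁻ (suc n) ≡ 2⁻ n
2⁻-halves n = lemma (2⁻ n)
  where
  lemma : ∀ p → ½ ℚ.* p ℚ.+ ½ ℚ.* p ≡ p
  lemma = solve 1 (λ p → con ½ :* p :+ con ½ :* p := p) refl

0≤2⁻ : ∀ n → 0ℚ ℚ.≤ 2⁻ n
0≤2⁻ n = ℚ.nonNegative⁻¹ (2⁻ n) {{2⁻-nonNeg n}}

2⁻-/ : ∀ n → 2⁻ n ≡ (+ 1 / 2 ^ n) {{m^n≢0 2 n}}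
2⁻-/ zero    = refl
2⁻-/ (suc n) = trans (cong (½ ℚ.*_) (2⁻-/ n)) (/-* 2 (2 ^ n) {{_}} {{m^n≢0 2 n}} (+ 1) (+ 1))

n≤2^n : ∀ n → n ≤ 2 ^ n
n≤2^n zero    = z≤n
n≤2^n (suc n) = +-mono-≤ (m^n>0 2 n) (≤-trans (n≤2^n n) (≤-reflexive (sym (+-identityʳ _))))

0<numerator : ∀ {ε} → 0ℚ ℚ.< ε → + 1 ℤ.≤ ℚ.↥ ε
0<numerator {mkℚ (+ suc n)  _ _} _         = ℤ.+≤+ (s≤s z≤n)
0<numerator {mkℚ (+ zero)   _ _} (ℚ.*<* (ℤ.+<+ ()))
0<numerator {mkℚ -[1+ n ]   _ _} (ℚ.*<* ())

small : ∀ C {ε} → 0ℚ ℚ.< ε → ∃[ k ] + C / 1 ℚ.* 2⁻ k ℚ.≤ ε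
small C {ε} 0<ε = k , (begin
  + C / 1 ℚ.* 2⁻ k                          ≡⟨ cong (+ C / 1 ℚ.*_) (2⁻-/ k) ⟩
  + C / 1 ℚ.* (+ 1 / 2 ^ k)               ≡⟨ /-* 1 (2 ^ k) (+ C) (+ 1) ⟩
  ((+ C ℤ.* + 1) / (1 * 2 ^ k)) {{m*n≢0 1 (2 ^ k)}}
    ≤⟨ /-mono-≤ (1 * 2 ^ k) D {{m*n≢0 1 (2 ^ k)}} (+ C ℤ.* + 1) (ℚ.↥ ε) bound ⟩
  ℚ.↥ ε / D                                 ≡⟨ ℚ.↥p/↧p≡p ε ⟩
  ε                                         ∎)
  where
  open ℚ.≤-Reasoning
  D = ℚ.↧ₙ ε
  -- 2 ^ k is at least C · D, and the numerator of ε is at least 1.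
  k = C * D
  instance _ = m^n≢0 2 k
  bound : + C ℤ.* + 1 ℤ.* + D ℤ.≤ ℚ.↥ ε ℤ.* + (1 * 2 ^ k)
  bound = ℤ.≤-trans (ℤ.≤-reflexive (trans (cong (ℤ._* + D) (ℤ.*-identityʳ (+ C))) (sym (ℤ.pos-* C D))))
    (ℤ.≤-trans (ℤ.+≤+ (≤-trans (n≤2^n k) (≤-reflexive (sym (*-identityˡ _)))))
    (ℤ.≤-trans (ℤ.≤-reflexive (sym (ℤ.*-identityˡ _)))
      (ℤ.*-monoʳ-≤-nonNeg (+ (1 * 2 ^ k)) (0<numerator 0<ε))))

archimedean : ∀ C {a b} → (∀ k → a ℚ.≤ b ℚ.+ + C / 1 ℚ.* 2⁻ k) → a ℚ.≤ b
archimedean C {a} {b} p = ℚ.≮⇒≥ λ b<a →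
  let 0<ε = subst (ℚ._< ½ ℚ.* (a ℚ.- b)) (ℚ.*-zeroʳ ½)
              (ℚ.*-monoʳ-<-pos ½ (subst (ℚ._< a ℚ.- b) (ℚ.+-inverseʳ b) (ℚ.+-monoˡ-< (ℚ.- b) b<a)))
      k , small≤ = small C 0<ε
      a≤ = ℚ.≤-trans (p k) (ℚ.+-monoʳ-≤ b small≤)
  in ℚ.<-irrefl refl (ℚ.<-≤-trans b<a (≤-fromℚ (ℚ.+-mono-≤ a≤ a≤) (lemma a b)))
  where
  lemma : ∀ a b → (b ℚ.+ ½ ℚ.* (a ℚ.- b)) ℚ.+ (b ℚ.+ ½ ℚ.* (a ℚ.- b)) ℚ.- (a ℚ.+ a) ≡ b ℚ.- a
  lemma = solve 2 (λ a b → (b :+ con ½ :* (a :- b)) :+ (b :+ con ½ :* (a :- b)) :- (a :+ a) := b :- a) refl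

infix 4 _≼_ _≾_

-- These take the sequence instead of the real number, so that conversion checking never has to
-- compare regularity proofs.
record Below (p : ℚ) (f : ℕ → ℚ) : Set where
  constructor below
  field
    lower-bound : ∀ n → p ℚ.≤ f n ℚ.+ 2⁻ n

record Above (p : ℚ) (f : ℕ → ℚ) : Set where
  constructor above
  field
    upper-bound : ∀ n → f n ℚ.≤ p ℚ.+ 2⁻ n

open Below
open Above

-- The n-th approximation is within 2⁻ⁿ of its limit, so this is the exact comparison p ≤ x. Real
-- inequalities are handled through such rational bounds over a common denominator, which turns them
-- into inequalities of integers.
_≼_ : ℚ → ℝ → Set
p ≼ x = Below p (approx x)

_≾_ : ℝ → ℚ → Set
x ≾ p = Above p (approx x)

≼-trans : ∀ {p q x} → p ℚ.≤ q → q ≼ x → p ≼ x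
≼-trans p≤q q≼x = below λ n → ℚ.≤-trans p≤q (lower-bound q≼x n)

≾-trans : ∀ {p q x} → x ≾ p → p ℚ.≤ q → x ≾ q
≾-trans x≾p p≤q = above λ n → ℚ.≤-trans (upper-bound x≾p n) (ℚ.+-monoˡ-≤ (2⁻ n) p≤q)

≼-fromℚ : ∀ {q} → q ≼ fromℚ q
≼-fromℚ {q} = below λ n → subst (ℚ._≤ q ℚ.+ 2⁻ n) (ℚ.+-identityʳ q) (ℚ.+-monoʳ-≤ q (0≤2⁻ n))

fromℚ-≾ : ∀ {q} → fromℚ q ≾ q
fromℚ-≾ = above (lower-bound ≼-fromℚ)

interchange : ∀ a b c d → (a ℚ.+ b) ℚ.+ (c ℚ.+ d) ≡ (a ℚ.+ c) ℚ.+ (b ℚ.+ d)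
interchange = solve 4 (λ a b c d → (a :+ b) :+ (c :+ d) := (a :+ c) :+ (b :+ d)) refl

≼-+ : ∀ {p q x y} → p ≼ x → q ≼ y → p ℚ.+ q ≼ x +ᴿ y
≼-+ {p} {q} {x} {y} p≼x q≼y = below λ n → subst (p ℚ.+ q ℚ.≤_)
  (trans (interchange (approx x (suc n)) (2⁻ (suc n)) (approx y (suc n)) (2⁻ (suc n)))
         (cong (approx (x +ᴿ y) n ℚ.+_) (2⁻-halves n)))
  (ℚ.+-mono-≤ (lower-bound p≼x (suc n)) (lower-bound q≼y (suc n)))

≾-+ : ∀ {p q x y} → x ≾ p → y ≾ q → x +ᴿ y ≾ p ℚ.+ q
≾-+ {p} {q} {x} {y} x≾p y≾q = above λ n → subst (approx (x +ᴿ y) n ℚ.≤_)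
  (trans (interchange p (2⁻ (suc n)) q (2⁻ (suc n))) (cong (p ℚ.+ q ℚ.+_) (2⁻-halves n)))
  (ℚ.+-mono-≤ (upper-bound x≾p (suc n)) (upper-bound y≾q (suc n)))

≼-neg : ∀ {p x} → x ≾ p → ℚ.- p ≼ -ᴿ x
≼-neg {p} {x} x≾p = below λ n → ≤-fromℚ (upper-bound x≾p n) (lemma p (2⁻ n) (approx x n))
  where
  lemma : ∀ p e x → p ℚ.+ e ℚ.- x ≡ ℚ.- x ℚ.+ e ℚ.- (ℚ.- p)
  lemma = solve 3 (λ p e x → p :+ e :- x := :- x :+ e :- (:- p)) refl

≾-neg : ∀ {p x} → p ≼ x → -ᴿ x ≾ ℚ.- p
≾-neg {p} {x} p≼x = above λ n → ≤-fromℚ (lower-bound p≼x n) (lemma p (2⁻ n) (approx x n))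
  where
  lemma : ∀ p e x → x ℚ.+ e ℚ.- p ≡ ℚ.- p ℚ.+ e ℚ.- (ℚ.- x)
  lemma = solve 3 (λ p e x → x :+ e :- p := :- p :+ e :- (:- x)) refl

≼-- : ∀ {p q x y} → p ≼ x → y ≾ q → p ℚ.- q ≼ x -ᴿ y
≼-- {p} {q} {x} {y} p≼x y≾q = ≼-+ {p} {ℚ.- q} {x} { -ᴿ y} p≼x (≼-neg {q} {y} y≾q)

≾-- : ∀ {p q x y} → x ≾ p → q ≼ y → x -ᴿ y ≾ p ℚ.- q
≾-- {p} {q} {x} {y} x≾p q≼y = ≾-+ {p} {ℚ.- q} {x} { -ᴿ y} x≾p (≾-neg {q} {y} q≼y)

≾∧≼⇒≤ᴿ : ∀ {p q x y} → x ≾ p → p ℚ.≤ q → q ≼ y → x ≤ᴿ y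
≾∧≼⇒≤ᴿ {p} {q} {x} {y} x≾p p≤q q≼y n = ≤-fromℚ (ℚ.+-mono-≤ (upper-bound x≾p n) (ℚ.≤-trans p≤q (lower-bound q≼y n)))
  (lemma p (2⁻ n) (approx x n) (approx y n))
  where
  lemma : ∀ p e x y → (p ℚ.+ e) ℚ.+ (y ℚ.+ e) ℚ.- (x ℚ.+ p) ≡ y ℚ.+ (e ℚ.+ e) ℚ.- x
  lemma = solve 4 (λ p e x y → (p :+ e) :+ (y :+ e) :- (x :+ p) := y :+ (e :+ e) :- x) refl

≤-approx : ∀ x m n → approx x m ℚ.≤ approx x n ℚ.+ (2⁻ m ℚ.+ 2⁻ n)
≤-approx x m n = ≤-fromℚ (ℚ.≤-trans (p≤∣p∣ _) (regular x m n)) (lemma (approx x m) (approx x n) (2⁻ m ℚ.+ 2⁻ n))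
  where
  p≤∣p∣ : ∀ p → p ℚ.≤ ℚ.∣ p ∣
  p≤∣p∣ p with ℚ.≤-total 0ℚ p
  ... | inj₁ 0≤p = ℚ.≤-reflexive (sym (ℚ.0≤p⇒∣p∣≡p 0≤p))
  ... | inj₂ p≤0 = ℚ.≤-trans p≤0 (ℚ.0≤∣p∣ p)
  lemma : ∀ a b e → e ℚ.- (a ℚ.- b) ≡ b ℚ.+ e ℚ.- a
  lemma = solve 3 (λ a b e → e :- (a :- b) := b :+ e :- a) refl

approx-≼ : ∀ x n → approx x n ℚ.- 2⁻ n ≼ x
approx-≼ x n = below λ m → ≤-fromℚ (≤-approx x n m) (lemma (approx x m) (approx x n) (2⁻ n) (2⁻ m))
  where
  lemma : ∀ a b d e → a ℚ.+ (d ℚ.+ e) ℚ.- b ≡ a ℚ.+ e ℚ.- (b ℚ.- d)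
  lemma = solve 4 (λ a b d e → a :+ (d :+ e) :- b := a :+ e :- (b :- d)) refl

approx-≾ : ∀ x n → x ≾ approx x n ℚ.+ 2⁻ n
approx-≾ x n = above λ m → ≤-fromℚ (≤-approx x m n) (lemma (approx x n) (approx x m) (2⁻ n) (2⁻ m))
  where
  lemma : ∀ a b d e → a ℚ.+ (e ℚ.+ d) ℚ.- b ≡ a ℚ.+ d ℚ.+ e ℚ.- b
  lemma = solve 4 (λ a b d e → a :+ (e :+ d) :- b := a :+ d :+ e :- b) refl

-- The comparison is made at an auxiliary index k. Its error is 4 · 2⁻ᵏ: one from the bound on x,
-- two from x ≤ y, one from returning to index n by regularity. Letting k grow removes it.
≼∧≤ᴿ⇒≼ : ∀ {p x y} → p ≼ x → x ≤ᴿ y → p ≼ y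
≼∧≤ᴿ⇒≼ {p} {x} {y} p≼x x≤y = below λ n → archimedean 4 λ k →
  ≤-fromℚ (ℚ.+-mono-≤ (lower-bound p≼x k) (ℚ.+-mono-≤ (x≤y k) (≤-approx y k n)))
    (lemma p (approx x k) (approx y k) (approx y n) (2⁻ k) (2⁻ n))
  where
  lemma : ∀ p x y z e f → (x ℚ.+ e) ℚ.+ ((y ℚ.+ (e ℚ.+ e)) ℚ.+ (z ℚ.+ (e ℚ.+ f))) ℚ.- (p ℚ.+ (x ℚ.+ y)) ≡
          (z ℚ.+ f) ℚ.+ + 4 / 1 ℚ.* e ℚ.- p
  lemma = solve 6 (λ p x y z e f → (x :+ e) :+ ((y :+ (e :+ e)) :+ (z :+ (e :+ f))) :- (p :+ (x :+ y)) :=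
          (z :+ f) :+ con (+ 4 / 1) :* e :- p) refl

≤ᴿ∧≾⇒≾ : ∀ {p x y} → x ≤ᴿ y → y ≾ p → x ≾ p
≤ᴿ∧≾⇒≾ {p} {x} {y} x≤y y≾p = above λ n → archimedean 4 λ k →
  ≤-fromℚ (ℚ.+-mono-≤ (upper-bound y≾p k) (ℚ.+-mono-≤ (x≤y k) (≤-approx x n k)))
    (lemma p (approx x k) (approx y k) (approx x n) (2⁻ k) (2⁻ n))
  where
  lemma : ∀ p x y z e f → (p ℚ.+ e) ℚ.+ ((y ℚ.+ (e ℚ.+ e)) ℚ.+ (x ℚ.+ (f ℚ.+ e))) ℚ.- (y ℚ.+ (x ℚ.+ z)) ≡
          (p ℚ.+ f) ℚ.+ + 4 / 1 ℚ.* e ℚ.- z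
  lemma = solve 6 (λ p x y z e f → (p :+ e) :+ ((y :+ (e :+ e)) :+ (x :+ (f :+ e))) :- (y :+ (x :+ z)) :=
          (p :+ f) :+ con (+ 4 / 1) :* e :- z) refl

≼∧≾⇒≤ : ∀ {p q x} → p ≼ x → x ≾ q → p ℚ.≤ q
≼∧≾⇒≤ {p} {q} {x} p≼x x≾q = archimedean 2 λ k →
  ≤-fromℚ (ℚ.+-mono-≤ (lower-bound p≼x k) (upper-bound x≾q k)) (lemma p q (approx x k) (2⁻ k))
  where
  lemma : ∀ p q x e → (x ℚ.+ e) ℚ.+ (q ℚ.+ e) ℚ.- (p ℚ.+ x) ≡ q ℚ.+ + 2 / 1 ℚ.* e ℚ.- p
  lemma = solve 4 (λ p q x e → (x :+ e) :+ (q :+ e) :- (p :+ x) := q :+ con (+ 2 / 1) :* e :- p) refl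

≼-limit : ∀ C {p x} → (∀ k → p ℚ.- + C / 1 ℚ.* 2⁻ k ≼ x) → p ≼ x
≼-limit C {p} {x} h = below λ n → archimedean C λ k → ≤-fromℚ (lower-bound (h k) n) (lemma p (+ C / 1 ℚ.* 2⁻ k) (approx x n ℚ.+ 2⁻ n))
  where
  lemma : ∀ p e y → y ℚ.- (p ℚ.- e) ≡ y ℚ.+ e ℚ.- p
  lemma = solve 3 (λ p e y → y :- (p :- e) := y :+ e :- p) refl

module _ (N : ℕ) .{{_ : NonZero N}} where

  ≼-/+ : ∀ {X Y x y} → X / N ≼ x → Y / N ≼ y → (X ℤ.+ Y) / N ≼ x +ᴿ y
  ≼-/+ {X} {Y} {x} {y} p q = subst (_≼ x +ᴿ y) (/-+ N X Y) (≼-+ {X / N} {Y / N} {x} {y} p q)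

  ≾-/+ : ∀ {X Y x y} → x ≾ X / N → y ≾ Y / N → x +ᴿ y ≾ (X ℤ.+ Y) / N
  ≾-/+ {X} {Y} {x} {y} p q = subst (x +ᴿ y ≾_) (/-+ N X Y) (≾-+ {X / N} {Y / N} {x} {y} p q)

  ≼-/- : ∀ {X Y x y} → X / N ≼ x → y ≾ Y / N → (X ℤ.- Y) / N ≼ x -ᴿ y
  ≼-/- {X} {Y} {x} {y} p q = subst (_≼ x -ᴿ y) (/-- N X Y) (≼-- {X / N} {Y / N} {x} {y} p q)

  ≾-/- : ∀ {X Y x y} → x ≾ X / N → Y / N ≼ y → x -ᴿ y ≾ (X ℤ.- Y) / N
  ≾-/- {X} {Y} {x} {y} p q = subst (x -ᴿ y ≾_) (/-- N X Y) (≾-- {X / N} {Y / N} {x} {y} p q)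

  /-fromℤ : ∀ z → z / 1 ≡ (z ℤ.* + N) / N
  /-fromℤ z = /-cross 1 N z (z ℤ.* + N) (sym (ℤ.*-identityʳ _))

  fromℤ-≼ : ∀ z → (z ℤ.* + N) / N ≼ fromℤ z
  fromℤ-≼ z = subst (_≼ fromℤ z) (/-fromℤ z) ≼-fromℚ

  ≾-fromℤ : ∀ z → fromℤ z ≾ (z ℤ.* + N) / N
  ≾-fromℤ z = subst (fromℤ z ≾_) (/-fromℤ z) fromℚ-≾

  ≼-sum : ∀ {s} (X : Vec ℤ s) (x : Vec ℝ s) → (∀ i → lookup X i / N ≼ lookup x i) → sumℤ X / N ≼ sumᴿ x
  ≼-sum []      []      p = subst (λ z → z / N ≼ 0ᴿ) (ℤ.*-zeroˡ (+ N)) (fromℤ-≼ (+ 0))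
  ≼-sum (X ∷ Xs) (x ∷ xs) p = ≼-/+ {X} {sumℤ Xs} {x} {sumᴿ xs} (p zero) (≼-sum Xs xs (p ∘ suc))

  ≾-sum : ∀ {s} (X : Vec ℤ s) (x : Vec ℝ s) → (∀ i → lookup x i ≾ lookup X i / N) → sumᴿ x ≾ sumℤ X / N
  ≾-sum []      []      p = subst (λ z → 0ᴿ ≾ z / N) (ℤ.*-zeroˡ (+ N)) (≾-fromℤ (+ 0))
  ≾-sum (X ∷ Xs) (x ∷ xs) p = ≾-/+ {X} {sumℤ Xs} {x} {sumᴿ xs} (p zero) (≾-sum Xs xs (p ∘ suc))

  ≤ᴿ⇒≤ : ∀ X Y x y → X / N ≼ x → x ≤ᴿ y → y ≾ Y / N → X ℤ.≤ Y
  ≤ᴿ⇒≤ X Y x y p x≤y q = /-cancelˡ N X Y (≼∧≾⇒≤ {X / N} {Y / N} {y} (≼∧≤ᴿ⇒≼ {X / N} {x} {y} p x≤y) q)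

  ≤⇒≤ᴿ : ∀ X Y x y → x ≾ X / N → X ℤ.≤ Y → Y / N ≼ y → x ≤ᴿ y
  ≤⇒≤ᴿ X Y x y p X≤Y q = ≾∧≼⇒≤ᴿ {X / N} {Y / N} {x} {y} p (/-monoˡ N X≤Y) q

  record Box {s} (lo hi : Vec ℤ s) (x : Vec ℝ s) : Set where
    constructor box
    field
      lo≼ : ∀ i → lookup lo i / N ≼ lookup x i
      ≾hi : ∀ i → lookup x i ≾ lookup hi i / N

  open Box public

  module _ {d} (a : Vec ℕ (suc d)) (l : ℕ) {lo hi : Vec ℤ (suc d)} {x : Vec ℝ (suc d)} (b : Box lo hi x) where

    CL⇒bounds : CL a l x → ∀ i →
        (+ 0 ℤ.≤ lookup hi i)
      × (lookup lo i ℤ.≤ + lookup a i ℤ.* + N)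
      × (lookup lo i ℤ.- lookup hi (next i) ℤ.≤ (+ lookup a i ℤ.- + l) ℤ.* + N)
    CL⇒bounds cl i =
        subst (ℤ._≤ lookup hi i) (ℤ.*-zeroˡ (+ N))
          (≤ᴿ⇒≤ _ _ 0ᴿ (lookup x i) (fromℤ-≼ (+ 0)) (proj₁ (cl i)) (≾hi b i))
      , ≤ᴿ⇒≤ _ _ (lookup x i) (fromℤ (+ lookup a i)) (lo≼ b i) (proj₁ (proj₂ (cl i))) (≾-fromℤ (+ lookup a i))
      , ≤ᴿ⇒≤ _ _ (lookup x i -ᴿ lookup x (next i)) (fromℤ (+ lookup a i ℤ.- + l))
          (≼-/- {lookup lo i} {lookup hi (next i)} {lookup x i} {lookup x (next i)} (lo≼ b i) (≾hi b (next i)))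
          (proj₂ (proj₂ (cl i))) (≾-fromℤ (+ lookup a i ℤ.- + l))

    bounds⇒CL : (∀ i →
        (+ 0 ℤ.≤ lookup lo i)
      × (lookup hi i ℤ.≤ + lookup a i ℤ.* + N)
      × (lookup hi i ℤ.- lookup lo (next i) ℤ.≤ (+ lookup a i ℤ.- + l) ℤ.* + N)) → CL a l x
    bounds⇒CL bd i =
        ≤⇒≤ᴿ _ _ 0ᴿ (lookup x i) (≾-fromℤ (+ 0))
          (subst (ℤ._≤ lookup lo i) (sym (ℤ.*-zeroˡ (+ N))) (proj₁ (bd i))) (lo≼ b i)
      , ≤⇒≤ᴿ _ _ (lookup x i) (fromℤ (+ lookup a i)) (≾hi b i) (proj₁ (proj₂ (bd i))) (fromℤ-≼ (+ lookup a i))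
      , ≤⇒≤ᴿ _ _ (lookup x i -ᴿ lookup x (next i)) (fromℤ (+ lookup a i ℤ.- + l))
          (≾-/- {lookup hi i} {lookup lo (next i)} {lookup x i} {lookup x (next i)} (≾hi b i) (lo≼ b (next i)))
          (proj₂ (proj₂ (bd i))) (fromℤ-≼ (+ lookup a i ℤ.- + l))

record Near (N : ℕ) .{{_ : NonZero N}} (e : ℕ) (X : ℤ) (x : ℝ) : Set where
  constructor near
  field
    near-≼ : (X ℤ.- + e) / N ≼ x
    near-≾ : x ≾ (X ℤ.+ + e) / N

open Near public

floor : ∀ N .{{_ : NonZero N}} q → ∃[ T ] (T / N ℚ.≤ q) × (q ℚ.≤ (T ℤ.+ + 1) / N)
floor N q = T
  , subst (T / N ℚ.≤_) (ℚ.↥p/↧p≡p q) (/-mono-≤ N D T (ℚ.↥ q) (ℤ.[n/ℕd]*d≤n (ℚ.↥ q ℤ.* + N) D))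
  , subst (ℚ._≤ (T ℤ.+ + 1) / N) (ℚ.↥p/↧p≡p q) (/-mono-≤ D N (ℚ.↥ q) (T ℤ.+ + 1)
      (subst (λ z → ℚ.↥ q ℤ.* + N ℤ.≤ z ℤ.* + D) (ℤ.+-comm (+ 1) T) (ℤ.<⇒≤ (ℤ.n<s[n/ℕd]*d (ℚ.↥ q ℤ.* + N) D))))
  where
  D = ℚ.↧ₙ q
  T = (ℚ.↥ q ℤ.* + N) ℤ./ℕ D

-- One unit of the error comes from rounding down a rational approximation, the other from the
-- distance of that approximation to x, made at most 1 / N.
nearby : ∀ N .{{_ : NonZero N}} x → ∃[ T ] Near N 2 T x
nearby N x = T , near
    (≼-trans {_} {_} {x} (ℚ.≤-trans (ℚ.≤-reflexive (sym (/-- N T (+ 2))))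
        (ℚ.+-mono-≤ T≤ (ℚ.neg-antimono-≤ (ℚ.≤-trans 2⁻≤ (/-monoˡ N (ℤ.+≤+ (s≤s z≤n)))))))
      (approx-≼ x k))
    (≾-trans {_} {_} {x} (approx-≾ x k)
      (ℚ.≤-trans (ℚ.+-mono-≤ ≤T 2⁻≤) (ℚ.≤-reflexive (trans (/-+ N (T ℤ.+ + 1) (+ 1)) (cong (_/ N) (ℤ.+-assoc T (+ 1) (+ 1)))))))
  where
  precision = small 1 {+ 1 / N} (/-mono-< 1 N (+ 0) (+ 1) (ℤ.+<+ (s≤s z≤n)))
  k = proj₁ precision
  2⁻≤ : 2⁻ k ℚ.≤ + 1 / N
  2⁻≤ = subst (ℚ._≤ + 1 / N) (ℚ.*-identityˡ (2⁻ k)) (proj₂ precision)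
  rounding = floor N (approx x k)
  T = proj₁ rounding
  T≤ = proj₁ (proj₂ rounding)
  ≤T = proj₂ (proj₂ rounding)

-- Lattice points of dilated sections

≼-by : ∀ {p} x → (∀ q → x ≾ q → p ℚ.≤ q) → p ≼ x
≼-by x h = below λ n → h _ (approx-≾ x n)

≾-by : ∀ {p} x → (∀ q → q ≼ x → q ℚ.≤ p) → x ≾ p
≾-by {p} x h = above λ n → ≤-fromℚ (h _ (approx-≼ x n)) (lemma p (approx x n) (2⁻ n))
  where
  lemma : ∀ p x e → p ℚ.- (x ℚ.- e) ≡ p ℚ.+ e ℚ.- x
  lemma = solve 3 (λ p x e → p :- (x :- e) := p :+ e :- x) refl

-- Expresses t + t′ = n by rational bounds in both directions. The notion is symmetric, so each
-- inclusion is proved once and used for both, without ever forming n - (n - t).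
record Complementary (n : ℕ) (t t′ : ℝ) : Set where
  field
    ≼⇒≾′ : ∀ N .{{_ : NonZero N}} X → X / N ≼ t → t′ ≾ (+ n ℤ.* + N ℤ.- X) / N
    ≾⇒≼′ : ∀ N .{{_ : NonZero N}} X → t ≾ X / N → (+ n ℤ.* + N ℤ.- X) / N ≼ t′
    ≼′⇒≾ : ∀ N .{{_ : NonZero N}} X → X / N ≼ t′ → t ≾ (+ n ℤ.* + N ℤ.- X) / N
    ≾′⇒≼ : ∀ N .{{_ : NonZero N}} X → t′ ≾ X / N → (+ n ℤ.* + N ℤ.- X) / N ≼ t

open Complementary

complementary-sym : ∀ {n t t′} → Complementary n t t′ → Complementary n t′ t
complementary-sym c = record { ≼⇒≾′ = ≼′⇒≾ c ; ≾⇒≼′ = ≾′⇒≼ c ; ≼′⇒≾ = ≼⇒≾′ c ; ≾′⇒≼ = ≾⇒≼′ c }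

complementary : ∀ n t → Complementary n t (fromℤ (+ n) -ᴿ t)
complementary n t = record
  { ≼⇒≾′ = λ N X p → ≾-/- N {+ n ℤ.* + N} {X} {fromℤ (+ n)} {t} (≾-fromℤ N (+ n)) p
  ; ≾⇒≼′ = λ N X p → ≼-/- N {+ n ℤ.* + N} {X} {fromℤ (+ n)} {t} (fromℤ-≼ N (+ n)) p
  ; ≼′⇒≾ = λ N X p → subst (t ≾_) (scaled N X) (≾-by t λ q q≼t →
      swap (X / N) q (≼∧≾⇒≤ {_} {_} {t′} p (≾-- {+ n / 1} {q} {fromℤ (+ n)} {t} fromℚ-≾ q≼t)))
  ; ≾′⇒≼ = λ N X p → subst (_≼ t) (scaled N X) (≼-by t λ q t≾q →
      swap′ (X / N) q (≼∧≾⇒≤ {_} {_} {t′} (≼-- {+ n / 1} {q} {fromℤ (+ n)} {t} ≼-fromℚ t≾q) p))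
  }
  where
  t′ = fromℤ (+ n) -ᴿ t
  scaled : ∀ N .{{_ : NonZero N}} X → + n / 1 ℚ.- X / N ≡ (+ n ℤ.* + N ℤ.- X) / N
  scaled N X = trans (cong (ℚ._- X / N) (/-fromℤ N (+ n))) (/-- N (+ n ℤ.* + N) X)
  swap : ∀ a b → a ℚ.≤ + n / 1 ℚ.- b → b ℚ.≤ + n / 1 ℚ.- a
  swap a b p = ≤-fromℚ p (lemma (+ n / 1) a b)
    where
    lemma : ∀ n a b → n ℚ.- b ℚ.- a ≡ n ℚ.- a ℚ.- b
    lemma = solve 3 (λ n a b → n :- b :- a := n :- a :- b) refl
  swap′ : ∀ a b → + n / 1 ℚ.- b ℚ.≤ a → + n / 1 ℚ.- a ℚ.≤ b
  swap′ a b p = ≤-fromℚ p (lemma (+ n / 1) a b)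
    where
    lemma : ∀ n a b → a ℚ.- (n ℚ.- b) ≡ b ℚ.- (n ℚ.- a)
    lemma = solve 3 (λ n a b → a :- (n :- b) := b :- (n :- a)) refl

-- All facets of the k-th dilate are moved inwards by m (outwards if m is negative).
DilatedCL : ∀ {d} → ℕ → ℤ → Vec ℕ (suc d) → ℕ → Vec ℤ (suc d) → Set
DilatedCL k m a l X = ∀ i →
    (m ℤ.≤ lookup X i)
  × (lookup X i ℤ.≤ + lookup a i ℤ.* + k ℤ.- m)
  × (lookup X i ℤ.- lookup X (next i) ℤ.≤ (+ lookup a i ℤ.- + l) ℤ.* + k ℤ.- m)

module _ {d n} (ā : Composition n (suc d)) (l : ℕ) (2l≤a : ∀ i → 2 * l ≤ lookup (parts ā) i)
         (k : ℕ) (m : ℤ) (m≤lk : m ℤ.≤ + l ℤ.* + k) where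
  private
    a = parts ā
    A = Vec.map (_* k) a

    lookup-A : ∀ i → lookup A i ≡ lookup a i * k
    lookup-A i = Vec.lookup-map i (_* k) a

    +lookup-A : ∀ i → + lookup A i ≡ + lookup a i ℤ.* + k
    +lookup-A i = trans (cong +_ (lookup-A i)) (ℤ.pos-* (lookup a i) k)

    step-bound : ∀ i → + lookup A i ℤ.- + (l * k) ℤ.- m ≡ (+ lookup a i ℤ.- + l) ℤ.* + k ℤ.- m
    step-bound i = cong (ℤ._- m) (trans (cong₂ ℤ._-_ (+lookup-A i) (ℤ.pos-* l k)) (lemma (+ lookup a i) (+ l) (+ k)))
      where
      lemma : ∀ a l k → a ℤ.* k ℤ.- l ℤ.* k ≡ (a ℤ.- l) ℤ.* k
      lemma = solve-ℤ

    DilatedCL⇒LatCL : ∀ X → DilatedCL k m a l X → LatCL m A (l * k) X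
    DilatedCL⇒LatCL X p i =
        proj₁ (p i)
      , subst (λ z → lookup X i ℤ.≤ z ℤ.- m) (sym (+lookup-A i)) (proj₁ (proj₂ (p i)))
      , subst (lookup X i ℤ.- lookup X (next i) ℤ.≤_) (sym (step-bound i)) (proj₂ (proj₂ (p i)))

    LatCL⇒DilatedCL : ∀ X → LatCL m A (l * k) X → DilatedCL k m a l X
    LatCL⇒DilatedCL X p i =
        proj₁ (p i)
      , subst (λ z → lookup X i ℤ.≤ z ℤ.- m) (+lookup-A i) (proj₁ (proj₂ (p i)))
      , subst (lookup X i ℤ.- lookup X (next i) ℤ.≤_) (step-bound i) (proj₂ (proj₂ (p i)))

    sum-map-* : ∀ {s} (v : Vec ℕ s) → Vec.sum (Vec.map (_* k) v) ≡ Vec.sum v * k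
    sum-map-* []      = refl
    sum-map-* (x ∷ v) = trans (cong (λ z → x * k + z) (sum-map-* v)) (sym (*-distribʳ-+ k x (Vec.sum v)))

  dilated-reflection : Reflection (DilatedCL k m a l) (+ n ℤ.* + k)
  dilated-reflection = record
    { to      = R.to
    ; from    = R.from
    ; to-∈    = λ {X} p → LatCL⇒DilatedCL (R.to X) (R.to-∈ (DilatedCL⇒LatCL X p))
    ; from-∈  = λ {X} p → LatCL⇒DilatedCL (R.from X) (R.from-∈ (DilatedCL⇒LatCL X p))
    ; from∘to = λ {X} p → R.from∘to (DilatedCL⇒LatCL X p)
    ; to∘from = λ {X} p → R.to∘from (DilatedCL⇒LatCL X p)
    ; sum-to  = λ {X} p → trans (R.sum-to (DilatedCL⇒LatCL X p)) (cong (ℤ._- sumℤ X) total-A)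
    }
    where
    module R = Reflection (reflection A (l * k)
      (λ i → ≤-trans (≤-reflexive (sym (*-assoc 2 l k)))
        (≤-trans (*-monoˡ-≤ k (2l≤a i)) (≤-reflexive (sym (lookup-A i)))))
      m (subst (m ℤ.≤_) (sym (ℤ.pos-* l k)) m≤lk))
    total-A : + Vec.sum A ≡ + n ℤ.* + k
    total-A = trans (cong +_ (trans (sum-map-* a) (cong (_* k) (total ā)))) (ℤ.pos-* n k)

/-suc : ∀ k p → + suc k / 1 ℚ.* p ≡ p ℚ.+ + k / 1 ℚ.* p
/-suc k p = trans (cong (ℚ._* p) (sym (/-+ 1 (+ 1) (+ k))))
  (trans (ℚ.*-distribʳ-+ p 1ℚ (+ k / 1)) (cong (ℚ._+ + k / 1 ℚ.* p) (ℚ.*-identityˡ p)))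

·-≼ : ∀ k {p} x → p ≼ x → + k / 1 ℚ.* p ≼ k · x
·-≼ zero    {p} x p≼x = subst (_≼ 0ᴿ) (sym (ℚ.*-zeroˡ p)) ≼-fromℚ
·-≼ (suc k) {p} x p≼x = subst (_≼ suc k · x) (sym (/-suc k p)) (≼-+ {p} {+ k / 1 ℚ.* p} {x} {k · x} p≼x (·-≼ k x p≼x))

·-≾ : ∀ k {p} x → x ≾ p → k · x ≾ + k / 1 ℚ.* p
·-≾ zero    {p} x x≾p = subst (0ᴿ ≾_) (sym (ℚ.*-zeroˡ p)) fromℚ-≾
·-≾ (suc k) {p} x x≾p = subst (suc k · x ≾_) (sym (/-suc k p)) (≾-+ {p} {+ k / 1 ℚ.* p} {x} {k · x} x≾p (·-≾ k x x≾p))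

≃-sum : ∀ N .{{_ : NonZero N}} X {t u} → X / N ≼ t → t ≾ X / N → X / N ≼ u → u ≾ X / N → t ≃ u
≃-sum N X {t} {u} p q r s = ≤⇒≤ᴿ N X X t u q ℤ.≤-refl r , ≤⇒≤ᴿ N X X u t s ℤ.≤-refl p

module _ (k : ℕ) .{{_ : NonZero k}} where

  *-/ : ∀ X → + k / 1 ℚ.* (X / k) ≡ X / 1
  *-/ X = trans (/-* 1 k (+ k) X) (/-cross (1 * k) 1 {{m*n≢0 1 k}} (+ k ℤ.* X) X
    (trans (ℤ.*-identityʳ _) (trans (ℤ.*-comm (+ k) X) (cong (λ z → X ℤ.* + z) (sym (*-identityˡ k))))))

  1/-* : ∀ p → (+ 1 / k) ℚ.* (+ k / 1 ℚ.* p) ≡ p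
  1/-* p = trans (sym (ℚ.*-assoc (+ 1 / k) (+ k / 1) p))
    (trans (cong (ℚ._* p) (trans (ℚ.*-comm (+ 1 / k) (+ k / 1)) (*-/ (+ 1)))) (ℚ.*-identityˡ p))

  instance
    1/-nonNeg : ℚ.NonNegative (+ 1 / k)
    1/-nonNeg = ℚ.nonNegative (/-mono-≤ 1 k (+ 0) (+ 1) (ℤ.+≤+ z≤n))

  -- Only rational bounds are divided: a bound q of x gives the bound k · q of k · x, which is
  -- compared with X and then multiplied by 1 / k.
  quotient : ∀ {X x} → fromℤ X ≃ k · x → (X / k ≼ x) × (x ≾ X / k)
  quotient {X} {x} (X≤kx , kx≤X) =
      ≼-by x (λ q x≾q → subst₂ ℚ._≤_ X/k (1/-* q) (ℚ.*-monoˡ-≤-nonNeg (+ 1 / k)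
        (≼∧≾⇒≤ {_} {_} {k · x} (≼∧≤ᴿ⇒≼ {_} {fromℤ X} {k · x} ≼-fromℚ X≤kx) (·-≾ k x x≾q))))
    , ≾-by x (λ q q≼x → subst₂ ℚ._≤_ (1/-* q) X/k (ℚ.*-monoˡ-≤-nonNeg (+ 1 / k)
        (≼∧≾⇒≤ {_} {_} {k · x} (·-≼ k x q≼x) (≤ᴿ∧≾⇒≾ {_} {k · x} {fromℤ X} kx≤X fromℚ-≾))))
    where
    X/k : (+ 1 / k) ℚ.* (X / 1) ≡ X / k
    X/k = trans (cong ((+ 1 / k) ℚ.*_) (sym (*-/ X))) (1/-* (X / k))

  ≃-quotient : ∀ X → fromℤ X ≃ k · fromℚ (X / k)
  ≃-quotient X = ≃-sum 1 X {fromℤ X} {k · fromℚ (X / k)} ≼-fromℚ fromℚ-≾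
    (subst (_≼ k · fromℚ (X / k)) (*-/ X) (·-≼ k (fromℚ (X / k)) ≼-fromℚ))
    (subst (k · fromℚ (X / k) ≾_) (*-/ X) (·-≾ k (fromℚ (X / k)) fromℚ-≾))

  module _ {d} (a : Vec ℕ (suc d)) (l : ℕ) (t : ℝ) where

    dilate⇒DilatedCL : ∀ X → dilate k (CLSection a l t) (Vec.map fromℤ X) →
                       DilatedCL k (+ 0) a l X × (sumℤ X / k ≼ t) × (t ≾ sumℤ X / k)
    dilate⇒DilatedCL X (x , (cl , Σ≤t , t≤Σ) , X≃kx) =
        (λ i → let p , q , r = CL⇒bounds k a l {X} {X} {x} B cl i
               in p , subst (lookup X i ℤ.≤_) (sym (ℤ.+-identityʳ _)) q
                    , subst (lookup X i ℤ.- lookup X (next i) ℤ.≤_) (sym (ℤ.+-identityʳ _)) r)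
      , ≼∧≤ᴿ⇒≼ {_} {sumᴿ x} {t} (≼-sum k X x (lo≼ B)) Σ≤t
      , ≤ᴿ∧≾⇒≾ {_} {t} {sumᴿ x} t≤Σ (≾-sum k X x (≾hi B))
      where
      X/k : ∀ i → (lookup X i / k ≼ lookup x i) × (lookup x i ≾ lookup X i / k)
      X/k i = quotient {lookup X i} {lookup x i} (subst (_≃ k · lookup x i) (Vec.lookup-map i fromℤ X) (X≃kx i))
      B : Box k X X x
      B = box (proj₁ ∘ X/k) (proj₂ ∘ X/k)

    DilatedCL⇒dilate : ∀ X → DilatedCL k (+ 0) a l X → sumℤ X / k ≼ t → t ≾ sumℤ X / k →
                       dilate k (CLSection a l t) (Vec.map fromℤ X)
    DilatedCL⇒dilate X p ≼t t≾ = x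
      , (bounds⇒CL k a l {X} {X} {x} B (λ i → let p , q , r = p i
          in p , subst (lookup X i ℤ.≤_) (ℤ.+-identityʳ _) q
               , subst (lookup X i ℤ.- lookup X (next i) ℤ.≤_) (ℤ.+-identityʳ _) r)
        , ≃-sum k (sumℤ X) {sumᴿ x} {t} (≼-sum k X x (lo≼ B)) (≾-sum k X x (≾hi B)) ≼t t≾)
      , λ i → subst₂ (λ u v → u ≃ k · v) (sym (Vec.lookup-map i fromℤ X))
                (sym (Vec.lookup-map i (λ X → fromℚ (X / k)) X)) (≃-quotient (lookup X i))
      where
      x = Vec.map (λ X → fromℚ (X / k)) X
      B : Box k X X x
      B = box (λ i → subst (lookup X i / k ≼_) (sym (Vec.lookup-map i _ X)) ≼-fromℚ)
              (λ i → subst (_≾ lookup X i / k) (sym (Vec.lookup-map i _ X)) fromℚ-≾)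

module _ {d n} (ā : Composition n (suc d)) (l : ℕ) (2l≤a : ∀ i → 2 * l ≤ lookup (parts ā) i)
         {t t′ : ℝ} (tt′ : Complementary n t t′) where

  -- The reflection with m = 0. An integer vector X lies in the k-th dilate of the section exactly
  -- when it lies in the k-th dilate of the polytope and its sum divided by k equals t, and
  -- `Complementary` carries the latter equation across.
  lattice-points : ∀ k → 1 ≤ k → LatticePoints (dilate k (CLSection (parts ā) l t)) ≅
                                   LatticePoints (dilate k (CLSection (parts ā) l t′))
  lattice-points k@(suc _) _ = record
    { to        = λ (X , p) → R.to X , fwd X p
    ; from      = λ (X , p) → R.from X , bwd X p
    ; to-cong   = cong R.to
    ; from-cong = cong R.from
    ; inverse   = (λ { {X , p} refl → R.to∘from (proj₁ (dilate⇒DilatedCL k a l t′ X p)) })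
                , (λ { {X , p} refl → R.from∘to (proj₁ (dilate⇒DilatedCL k a l t X p)) })
    }
    where
    a = parts ā
    module R = Reflection (dilated-reflection ā l 2l≤a k (+ 0)
      (subst (+ 0 ℤ.≤_) (ℤ.pos-* l k) (ℤ.+≤+ z≤n)))
    fwd : ∀ X → dilate k (CLSection a l t) (Vec.map fromℤ X) → dilate k (CLSection a l t′) (Vec.map fromℤ (R.to X))
    fwd X p =
      let q , ≼t , t≾ = dilate⇒DilatedCL k a l t X p
      in DilatedCL⇒dilate k a l t′ (R.to X) (R.to-∈ q)
           (subst (λ z → z / k ≼ t′) (sym (R.sum-to q)) (≾⇒≼′ tt′ k (sumℤ X) t≾))
           (subst (λ z → t′ ≾ z / k) (sym (R.sum-to q)) (≼⇒≾′ tt′ k (sumℤ X) ≼t))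
    bwd : ∀ X → dilate k (CLSection a l t′) (Vec.map fromℤ X) → dilate k (CLSection a l t) (Vec.map fromℤ (R.from X))
    bwd X p =
      let q , ≼t′ , t′≾ = dilate⇒DilatedCL k a l t′ X p
      in DilatedCL⇒dilate k a l t (R.from X) (R.from-∈ q)
           (subst (λ z → z / k ≼ t) (sym (R.sum-from q)) (≾′⇒≼ tt′ k (sumℤ X) t′≾))
           (subst (λ z → t ≾ z / k) (sym (R.sum-from q)) (≼′⇒≾ tt′ k (sumℤ X) ≼t′))

-- Counting grid points

-- Bernoulli's inequality (1 - k / M) ^ d ≥ 1 - k d / M, cleared of denominators.
bernoulli : ∀ M k d → k ≤ M → M ^ d * (M ∸ k * d) ≤ M * (M ∸ k) ^ d
bernoulli M k zero    k≤M = ≤-reflexive (trans (*-identityˡ _)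
  (trans (cong (M ∸_) (*-zeroʳ k)) (sym (*-identityʳ M))))
bernoulli M k (suc d) k≤M = begin
  M * M ^ d * (M ∸ k * suc d)          ≡⟨ cong (M * M ^ d *_) (trans (cong (M ∸_) (*-suc k d))
                                            (trans (cong (M ∸_) (+-comm k (k * d))) (sym (∸-+-assoc M (k * d) k)))) ⟩
  M * M ^ d * (y ∸ k)                  ≡⟨ regroup M (M ^ d) (y ∸ k) ⟩
  M ^ d * (M * (y ∸ k))                ≤⟨ *-monoʳ-≤ (M ^ d) exchange ⟩
  M ^ d * ((M ∸ k) * y)                ≡⟨ regroup′ (M ^ d) (M ∸ k) y ⟩
  (M ∸ k) * (M ^ d * y)                ≤⟨ *-monoʳ-≤ (M ∸ k) (bernoulli M k d k≤M) ⟩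
  (M ∸ k) * (M * (M ∸ k) ^ d)          ≡⟨ regroup″ (M ∸ k) M ((M ∸ k) ^ d) ⟩
  M * ((M ∸ k) * (M ∸ k) ^ d)          ∎
  where
  open ≤-Reasoning
  y = M ∸ k * d
  regroup : ∀ a b c → a * b * c ≡ b * (a * c)
  regroup = solve-∀
  regroup′ : ∀ a b c → a * (b * c) ≡ b * (a * c)
  regroup′ = solve-∀
  regroup″ : ∀ a b c → a * (b * c) ≡ b * (a * c)
  regroup″ = solve-∀
  exchange : M * (y ∸ k) ≤ (M ∸ k) * y
  exchange = ≤-trans (≤-reflexive (*-distribˡ-∸ M y k))
    (≤-trans (∸-monoʳ-≤ (M * y) (≤-trans (≤-reflexive (*-comm k y)) (*-monoˡ-≤ k (m∸n≤m M (k * d)))))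
      (≤-reflexive (sym (*-distribʳ-∸ y M k))))

-- Of the B · M ^ d cells of B cubes, reducing the side from M to M - k removes fewer than M ^ d,
-- one cube's worth, once M exceeds B · k · d.
power-gap : ∀ B M k d → k ≤ M → B * (k * d) < M → B * M ^ d < B * (M ∸ k) ^ d + M ^ d
power-gap B M k d k≤M Bkd<M = *-cancelʳ-< M _ _ (begin-strict
  B * M ^ d * M                                      ≤⟨ *-monoʳ-≤ (B * M ^ d) (m≤n+m∸n M (k * d)) ⟩
  B * M ^ d * (k * d + (M ∸ k * d))                  ≡⟨ regroup B (M ^ d) (k * d) (M ∸ k * d) ⟩
  B * (M ^ d * (M ∸ k * d)) + B * (k * d) * M ^ d    ≤⟨ +-monoˡ-≤ _ (*-monoʳ-≤ B (bernoulli M k d k≤M)) ⟩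
  B * (M * (M ∸ k) ^ d) + B * (k * d) * M ^ d        <⟨ +-monoʳ-< (B * (M * (M ∸ k) ^ d))
                                                          (*-monoˡ-< (M ^ d) Bkd<M) ⟩
  B * (M * (M ∸ k) ^ d) + M * M ^ d                  ≡⟨ regroup′ B M ((M ∸ k) ^ d) (M ^ d) ⟩
  (B * (M ∸ k) ^ d + M ^ d) * M                      ∎)
  where
  open ≤-Reasoning
  instance
    _ = >-nonZero {M} (≤-<-trans z≤n Bkd<M)
    _ = m^n≢0 M d
  regroup : ∀ a b c e → a * b * (c + e) ≡ a * (b * e) + a * c * b
  regroup = solve-∀
  regroup′ : ∀ a b c e → a * (b * c) + b * e ≡ (a * c + e) * b
  regroup′ = solve-∀

length-cartesianProductWith : ∀ {A B C : Set} (f : A → B → C) xs ys →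
  length (cartesianProductWith f xs ys) ≡ length xs * length ys
length-cartesianProductWith f []       ys = refl
length-cartesianProductWith f (x ∷ xs) ys = trans (List.length-++ (List.map (f x) ys))
  (cong₂ _+_ (List.length-map (f x) ys) (length-cartesianProductWith f xs ys))

-- Cutting the mesh into M parts assigns to the cube z the window of `len` integers from z · M + b
-- onwards in each direction. A positive b trims the cubes for the lower cut; a negative b thickens
-- them for the upper one.
module Grid (M : ℕ) (b : ℤ) (len : ℕ) where

  interval : ℤ → List ℤ
  interval z = List.map (λ r → z ℤ.* + M ℤ.+ b ℤ.+ + r) (upTo len)

  grid : ∀ {d} → Vec ℤ d → List (Vec ℤ d)
  grid []       = [] ∷ []
  grid (z ∷ zs) = cartesianProductWith _∷_ (interval z) (grid zs)

  grids : ∀ {d} → List (Vec ℤ d) → List (Vec ℤ d)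
  grids = concatMap grid

  Cell : ℤ → ℤ → Set
  Cell z w = (z ℤ.* + M ℤ.+ b ℤ.≤ w) × (w ℤ.< z ℤ.* + M ℤ.+ b ℤ.+ + len)

  length-grid : ∀ {d} (z : Vec ℤ d) → length (grid z) ≡ len ^ d
  length-grid []       = refl
  length-grid (z ∷ zs) = trans (length-cartesianProductWith _∷_ (interval z) (grid zs))
    (cong₂ _*_ (trans (List.length-map _ (upTo len)) (List.length-upTo len)) (length-grid zs))

  length-grids : ∀ {d} (zs : List (Vec ℤ d)) → length (grids zs) ≡ length zs * len ^ d
  length-grids []       = refl
  length-grids (z ∷ zs) = trans (List.length-++ (grid z)) (cong₂ _+_ (length-grid z) (length-grids zs))

  ∈-interval⁺ : ∀ z w → Cell z w → w ∈ interval z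
  ∈-interval⁺ z w (lo , hi) = subst (_∈ interval z) (trans (cong (λ r → c ℤ.+ r) +r) (lemma c w))
    (∈-map⁺ _ (∈-upTo⁺ r<))
    where
    c = z ℤ.* + M ℤ.+ b
    r = ℤ.∣ w ℤ.- c ∣
    +r : + r ≡ w ℤ.- c
    +r = ℤ.0≤i⇒+∣i∣≡i (ℤ.i≤j⇒0≤j-i lo)
    lemma : ∀ c w → c ℤ.+ (w ℤ.- c) ≡ w
    lemma = solve-ℤ
    r< : r < len
    r< = ℤ.drop‿+<+ (subst₂ ℤ._<_ (sym +r) (cancel c (+ len)) (ℤ.+-monoˡ-< (ℤ.- c) hi))
      where
      cancel : ∀ c k → c ℤ.+ k ℤ.- c ≡ k
      cancel = solve-ℤ

  ∈-interval⁻ : ∀ z w → w ∈ interval z → Cell z w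
  ∈-interval⁻ z w w∈ with ∈-map⁻ _ w∈
  ... | r , r∈ , refl = ℤ.i≤i+j _ (+ r) , ℤ.+-monoʳ-< (z ℤ.* + M ℤ.+ b) (ℤ.+<+ (∈-upTo⁻ r∈))

  ∈-grid⁺ : ∀ {d} (z w : Vec ℤ d) → (∀ j → Cell (lookup z j) (lookup w j)) → w ∈ grid z
  ∈-grid⁺ []       []       _ = here refl
  ∈-grid⁺ (z ∷ zs) (w ∷ ws) p = ∈-cartesianProductWith⁺ _∷_ (∈-interval⁺ z w (p zero)) (∈-grid⁺ zs ws (p ∘ suc))

  ∈-grid⁻ : ∀ {d} (z w : Vec ℤ d) → w ∈ grid z → ∀ j → Cell (lookup z j) (lookup w j)
  ∈-grid⁻ (z ∷ zs) (w ∷ ws) w∈ j with ∈-cartesianProductWith⁻ _∷_ (interval z) (grid zs) w∈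
  ... | _ , _ , p , q , refl = cells j
    where
    cells : ∀ j → Cell (lookup (z ∷ zs) j) (lookup (w ∷ ws) j)
    cells zero    = ∈-interval⁻ z w p
    cells (suc j) = ∈-grid⁻ zs ws q j

  grid-unique : ∀ {d} (z : Vec ℤ d) → Unique (grid z)
  grid-unique []       = [] ∷ []
  grid-unique (z ∷ zs) = Unique.cartesianProductWith⁺ _∷_ Vec.∷-injective
    (Unique.map⁺ (λ eq → ℤ.+-injective (Group.∙-cancelˡ (AbelianGroup.group ℤ.+-0-abelianGroup) (z ℤ.* + M ℤ.+ b) _ _ eq)) (Unique.upTo⁺ len)) (grid-unique zs)

  module _ .{{_ : NonZero M}} (0≤b : + 0 ℤ.≤ b) (b+len≤M : b ℤ.+ + len ℤ.≤ + M) where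

    Cell-≤ : ∀ {z z′ w} → Cell z w → Cell z′ w → z ℤ.≤ z′
    Cell-≤ {z} {z′} {w} (lo , _) (_ , hi) = ℤ.≮⇒≥ λ z′<z → ℤ.<-irrefl refl (begin-strict
      z ℤ.* + M                            ≡⟨ ℤ.+-identityʳ _ ⟨
      z ℤ.* + M ℤ.+ + 0                    ≤⟨ ℤ.+-monoʳ-≤ (z ℤ.* + M) 0≤b ⟩
      z ℤ.* + M ℤ.+ b                      ≤⟨ lo ⟩
      w                                    <⟨ hi ⟩
      z′ ℤ.* + M ℤ.+ b ℤ.+ + len           ≡⟨ ℤ.+-assoc (z′ ℤ.* + M) b (+ len) ⟩
      z′ ℤ.* + M ℤ.+ (b ℤ.+ + len)         ≤⟨ ℤ.+-monoʳ-≤ (z′ ℤ.* + M) b+len≤M ⟩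
      z′ ℤ.* + M ℤ.+ + M                   ≡⟨ lemma z′ (+ M) ⟩
      ℤ.suc z′ ℤ.* + M                     ≤⟨ ℤ.*-monoʳ-≤-nonNeg (+ M) (ℤ.i<j⇒suc[i]≤j z′<z) ⟩
      z ℤ.* + M                            ∎)
      where
      open ℤ.≤-Reasoning
      lemma : ∀ z m → z ℤ.* m ℤ.+ m ≡ (+ 1 ℤ.+ z) ℤ.* m
      lemma = solve-ℤ

    grid-disjoint : ∀ {d} {z z′ : Vec ℤ d} → z ≢ z′ → Disjoint (grid z) (grid z′)
    grid-disjoint {z = z} {z′} z≢z′ {w} (p , q) = z≢z′ (vec-≡ z z′ w (∈-grid⁻ z w p) (∈-grid⁻ z′ w q))
      where
      vec-≡ : ∀ {d} (z z′ w : Vec ℤ d) → (∀ j → Cell (lookup z j) (lookup w j)) →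
              (∀ j → Cell (lookup z′ j) (lookup w j)) → z ≡ z′
      vec-≡ []       []         []      _ _ = refl
      vec-≡ (z ∷ zs) (z′ ∷ zs′) (w ∷ ws) p q = cong₂ _∷_
        (ℤ.≤-antisym (Cell-≤ {z} {z′} {w} (p zero) (q zero)) (Cell-≤ {z′} {z} {w} (q zero) (p zero)))
        (vec-≡ zs zs′ ws (p ∘ suc) (q ∘ suc))

    grids-unique : ∀ {d} {zs : List (Vec ℤ d)} → Unique zs → Unique (grids zs)
    grids-unique {zs = zs} u = Unique.concat⁺ (All.map⁺ (All.universal grid-unique zs))
      (AllPairs.map⁺ (AllPairs.map grid-disjoint u))

map-unique : ∀ {A B : Set} {P : A → Set} (f : A → B) → (∀ {x y} → P x → P y → f x ≡ f y → x ≡ y) →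
             ∀ {xs} → All P xs → Unique xs → Unique (List.map f xs)
map-unique f inj []         []       = []
map-unique f inj (px ∷ pxs) (u ∷ us) =
  All.map⁺ (All.zipWith (λ (py , x≢y) → x≢y ∘ inj px py) (pxs , u)) ∷ map-unique f inj pxs us

^-distribʳ-* : ∀ d N M → (N * M) ^ d ≡ N ^ d * M ^ d
^-distribʳ-* zero    N M = refl
^-distribʳ-* (suc d) N M = trans (cong (N * M *_) (^-distribʳ-* d N M)) ([m*n]*[o*p]≡[m*o]*[n*p] N M (N ^ d) (M ^ d))

module _ (d : ℕ) (q : ℚ) where

  module _ (N c : ℕ) .{{_ : NonZero N}} where
    private instance
      _ = m^n≢0 N d

    <volume⇒ : q ℚ.< cubesVolume d N c → ℚ.↥ q ℤ.* + (N ^ d) ℤ.< + (d ! * c * ℚ.↧ₙ q)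
    <volume⇒ q<v = subst (ℚ.↥ q ℤ.* + (N ^ d) ℤ.<_) (sym (ℤ.pos-* (d ! * c) (ℚ.↧ₙ q)))
      (/-cancel-< (ℚ.↧ₙ q) (N ^ d) (ℚ.↥ q) (+ (d ! * c)) (subst (ℚ._< cubesVolume d N c) (sym (ℚ.↥p/↧p≡p q)) q<v))

    ⇒<volume : ℚ.↥ q ℤ.* + (N ^ d) ℤ.< + (d ! * c * ℚ.↧ₙ q) → q ℚ.< cubesVolume d N c
    ⇒<volume p = subst (ℚ._< cubesVolume d N c) (ℚ.↥p/↧p≡p q)
      (/-mono-< (ℚ.↧ₙ q) (N ^ d) (ℚ.↥ q) (+ (d ! * c))
        (subst (ℚ.↥ q ℤ.* + (N ^ d) ℤ.<_) (ℤ.pos-* (d ! * c) (ℚ.↧ₙ q)) p))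

    volume<⇒ : cubesVolume d N c ℚ.< q → + (d ! * c * ℚ.↧ₙ q) ℤ.< ℚ.↥ q ℤ.* + (N ^ d)
    volume<⇒ v<q = subst (ℤ._< ℚ.↥ q ℤ.* + (N ^ d)) (sym (ℤ.pos-* (d ! * c) (ℚ.↧ₙ q)))
      (/-cancel-< (N ^ d) (ℚ.↧ₙ q) (+ (d ! * c)) (ℚ.↥ q) (subst (cubesVolume d N c ℚ.<_) (sym (ℚ.↥p/↧p≡p q)) v<q))

    ⇒volume< : + (d ! * c * ℚ.↧ₙ q) ℤ.< ℚ.↥ q ℤ.* + (N ^ d) → cubesVolume d N c ℚ.< q
    ⇒volume< p = subst (cubesVolume d N c ℚ.<_) (ℚ.↥p/↧p≡p q)
      (/-mono-< (N ^ d) (ℚ.↧ₙ q) (+ (d ! * c)) (ℚ.↥ q)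
        (subst (ℤ._< ℚ.↥ q ℤ.* + (N ^ d)) (ℤ.pos-* (d ! * c) (ℚ.↧ₙ q)) p))

  module _ (N c k : ℕ) .{{N≢0 : NonZero N}} where
    private
      D = ℚ.↧ₙ q

      refine : ∀ M → ℚ.↥ q ℤ.* + ((N * M) ^ d) ≡ ℚ.↥ q ℤ.* + (N ^ d) ℤ.* + (M ^ d)
      refine M = trans (cong (λ z → ℚ.↥ q ℤ.* z) (trans (cong +_ (^-distribʳ-* d N M)) (ℤ.pos-* (N ^ d) (M ^ d))))
        (sym (ℤ.*-assoc (ℚ.↥ q) (+ (N ^ d)) (+ (M ^ d))))

      regroup : ∀ f c p D → f * (c * p) * D ≡ f * c * D * p
      regroup = solve-∀

    -- With x the numerator of q times N ^ d, the hypothesis says x < `B` for integers, hence x ≤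
    -- `B` - 1. After refinement the spare unit is worth M ^ d cells, and `len` is large enough for
    -- `power-gap` to show that the trimmed margins cost fewer.
    shrink : q ℚ.< cubesVolume d N c →
             ∃[ len ] Σ[ nz ∈ NonZero (len + k) ]
               q ℚ.< cubesVolume d (N * (len + k)) {{m*n≢0 N (len + k) {{N≢0}} {{nz}}}} (c * len ^ d)
    shrink q<v = len , nz , ⇒<volume (N * M) (c * len ^ d) {{m*n≢0 N M {{N≢0}} {{nz}}}}
        (subst₂ ℤ._<_ (sym (refine M)) (cong +_ (sym (regroup (d !) c (len ^ d) D))) bound)
      where
      B = d ! * c * D
      len = suc (B * (k * d))
      M = len + k
      nz : NonZero M
      nz = _
      instance _ = m^n≢0 M d
      x = ℚ.↥ q ℤ.* + (N ^ d)
      gap : B * M ^ d < B * len ^ d + M ^ d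
      gap = subst (λ z → B * M ^ d < B * z ^ d + M ^ d) (m+n∸n≡m len k)
        (power-gap B M k d (m≤n+m k len) (m≤m+n len k))
      bound : x ℤ.* + (M ^ d) ℤ.< + (B * len ^ d)
      bound = ℤ.≤-<-trans
        (ℤ.*-monoʳ-≤-nonNeg (+ (M ^ d)) (ℤ.i<j⇒i≤pred[j] (<volume⇒ N c q<v)))
        (≤-<-lemma (+ (M ^ d)) (ℤ.+<+ gap))
        where
        ≤-<-lemma : ∀ y → + (B * M ^ d) ℤ.< + (B * len ^ d) ℤ.+ + (M ^ d) →
                    ℤ.pred (+ B) ℤ.* + (M ^ d) ℤ.< + (B * len ^ d)
        ≤-<-lemma _ p = subst₂ ℤ._<_
          (trans (cong (λ z → z ℤ.- + (M ^ d)) (ℤ.pos-* B (M ^ d))) (expand (+ B) (+ (M ^ d))))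
          (cancel (+ (B * len ^ d)) (+ (M ^ d)))
          (ℤ.+-monoˡ-< (ℤ.- + (M ^ d)) p)
          where
          expand : ∀ b m → b ℤ.* m ℤ.- m ≡ (ℤ.- + 1 ℤ.+ b) ℤ.* m
          expand = solve-ℤ
          cancel : ∀ a m → a ℤ.+ m ℤ.- m ≡ a
          cancel = solve-ℤ

    -- Here x ≥ `B` + 1. `power-gap` is applied to suc `B` cubes of the thickened side M + k, and
    -- one of them is cancelled.
    thicken : cubesVolume d N c ℚ.< q →
              ∃[ M ] Σ[ nz ∈ NonZero M ]
                cubesVolume d (N * M) {{m*n≢0 N M {{N≢0}} {{nz}}}} (c * (M + k) ^ d) ℚ.< q
    thicken v<q = M , nz , ⇒volume< (N * M) (c * (M + k) ^ d) {{m*n≢0 N M {{N≢0}} {{nz}}}}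
        (subst₂ ℤ._<_ (cong +_ (sym (regroup (d !) c ((M + k) ^ d) D))) (sym (refine M)) bound)
      where
      B = d ! * c * D
      M = suc (suc B * (k * d))
      nz : NonZero M
      nz = _
      x = ℚ.↥ q ℤ.* + (N ^ d)
      gap : B * (M + k) ^ d < suc B * M ^ d
      gap = +-cancelˡ-< ((M + k) ^ d) _ _ (subst (suc B * (M + k) ^ d <_) (+-comm (suc B * M ^ d) ((M + k) ^ d))
        (subst (λ z → suc B * (M + k) ^ d < suc B * z ^ d + (M + k) ^ d) (m+n∸n≡m M k)
          (power-gap (suc B) (M + k) k d (m≤n+m k M) (m≤m+n M k))))
      bound : + (B * (M + k) ^ d) ℤ.< x ℤ.* + (M ^ d)
      bound = ℤ.<-≤-trans (ℤ.+<+ gap) (ℤ.≤-trans (ℤ.≤-reflexive (ℤ.pos-* (suc B) (M ^ d)))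
        (ℤ.*-monoʳ-≤-nonNeg (+ (M ^ d)) (ℤ.i<j⇒suc[i]≤j (volume<⇒ N c v<q))))

-- The lower cut

chartℤ : ∀ {d} → ℤ → Vec ℤ d → Vec ℤ (suc d)
chartℤ T w = (T ℤ.- sumℤ w) ∷ w

sum-chartℤ : ∀ {d} T (w : Vec ℤ d) → sumℤ (chartℤ T w) ≡ T
sum-chartℤ T w = lemma T (sumℤ w)
  where
  lemma : ∀ a b → a ℤ.- b ℤ.+ b ≡ a
  lemma = solve-ℤ

chartℤ-tail : ∀ {d} (X : Vec ℤ (suc d)) → chartℤ (sumℤ X) (Vec.tail X) ≡ X
chartℤ-tail (x ∷ xs) = cong (_∷ xs) (lemma x (sumℤ xs))
  where
  lemma : ∀ a b → a ℤ.+ b ℤ.- b ≡ a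
  lemma = solve-ℤ

sum-map-+ : ∀ {d} c (w : Vec ℤ d) → sumℤ (Vec.map (ℤ._+ c) w) ≡ sumℤ w ℤ.+ + d ℤ.* c
sum-map-+ c []      = sym (ℤ.*-zeroˡ c)
sum-map-+ {suc d} c (x ∷ w) = trans (cong (λ z → x ℤ.+ c ℤ.+ z) (sum-map-+ c w)) (lemma x (sumℤ w) c (+ d))
  where
  lemma : ∀ x s c d → x ℤ.+ c ℤ.+ (s ℤ.+ d ℤ.* c) ≡ x ℤ.+ s ℤ.+ (+ 1 ℤ.+ d) ℤ.* c
  lemma = solve-ℤ

module _ (N : ℕ) .{{_ : NonZero N}} where

  near-weaken : ∀ {e e′ X x} → e ≤ e′ → Near N e X x → Near N e′ X x
  near-weaken {e} {e′} {X} {x} e≤e′ p = near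
    (≼-trans {_} {_} {x} (/-monoˡ N (ℤ.+-monoʳ-≤ X (ℤ.neg-mono-≤ (ℤ.+≤+ e≤e′)))) (near-≼ p))
    (≾-trans {_} {_} {x} (near-≾ p) (/-monoˡ N (ℤ.+-monoʳ-≤ X (ℤ.+≤+ e≤e′))))

  -- The head of a chart is the level minus all other coordinates, so it collects the error of the
  -- level and d errors E. The same bound covers the remaining coordinates, which exist only for d ≥
  -- 1.
  near-chart : ∀ {e E d T t} (w : Vec ℤ d) (u : Vec ℝ d) → Near N e T t →
               (∀ j → Near N E (lookup w j) (lookup u j)) →
               ∀ i → Near N (e + d * E) (lookup (chartℤ T w) i) (lookup (chart t u) i)
  near-chart {e} {E} {d} {T} {t} w u T≈t w≈u zero = near
      (subst (λ z → z / N ≼ t -ᴿ sumᴿ u) lo (≼-/- N {T ℤ.- + e} {sumℤ (Vec.map (ℤ._+ + E) w)} {t} {sumᴿ u}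
        (near-≼ T≈t) (≾-sum N (Vec.map (ℤ._+ + E) w) u λ j →
          subst (λ z → lookup u j ≾ z / N) (sym (Vec.lookup-map j (ℤ._+ + E) w)) (near-≾ (w≈u j)))))
      (subst (λ z → t -ᴿ sumᴿ u ≾ z / N) hi (≾-/- N {T ℤ.+ + e} {sumℤ (Vec.map (ℤ._+ (ℤ.- + E)) w)} {t} {sumᴿ u}
        (near-≾ T≈t) (≼-sum N (Vec.map (ℤ._+ (ℤ.- + E)) w) u λ j →
          subst (λ z → z / N ≼ lookup u j) (sym (Vec.lookup-map j (ℤ._+ (ℤ.- + E)) w)) (near-≼ (w≈u j)))))
    where
    +e+dE : + (e + d * E) ≡ + e ℤ.+ + d ℤ.* + E
    +e+dE = cong (λ z → + e ℤ.+ z) (ℤ.pos-* d E)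
    lo : T ℤ.- + e ℤ.- sumℤ (Vec.map (ℤ._+ + E) w) ≡ T ℤ.- sumℤ w ℤ.- + (e + d * E)
    lo = trans (cong (λ z → T ℤ.- + e ℤ.- z) (sum-map-+ (+ E) w))
      (trans (lemma T (+ e) (sumℤ w) (+ d) (+ E)) (cong (λ z → T ℤ.- sumℤ w ℤ.- z) (sym +e+dE)))
      where
      lemma : ∀ T e s d E → T ℤ.- e ℤ.- (s ℤ.+ d ℤ.* E) ≡ T ℤ.- s ℤ.- (e ℤ.+ d ℤ.* E)
      lemma = solve-ℤ
    hi : T ℤ.+ + e ℤ.- sumℤ (Vec.map (ℤ._+ (ℤ.- + E)) w) ≡ T ℤ.- sumℤ w ℤ.+ + (e + d * E)
    hi = trans (cong (λ z → T ℤ.+ + e ℤ.- z) (sum-map-+ (ℤ.- + E) w))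
      (trans (lemma T (+ e) (sumℤ w) (+ d) (+ E)) (cong (λ z → T ℤ.- sumℤ w ℤ.+ z) (sym +e+dE)))
      where
      lemma : ∀ T e s d E → T ℤ.+ e ℤ.- (s ℤ.+ d ℤ.* (ℤ.- E)) ≡ T ℤ.- s ℤ.+ (e ℤ.+ d ℤ.* E)
      lemma = solve-ℤ
  near-chart {e} {E} {suc d} w u T≈t w≈u (suc j) = near-weaken {E} {e + suc d * E} {lookup w j} {lookup u j}
    (≤-trans (m≤m+n E (d * E)) (m≤n+m _ e)) (w≈u j)

  module _ {d} (a : Vec ℕ (suc d)) (l e : ℕ) (X : Vec ℤ (suc d)) (x : Vec ℝ (suc d))
           (X≈x : ∀ i → Near N e (lookup X i) (lookup x i)) where
    private
      lo hi : Vec ℤ (suc d)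
      lo = Vec.map (ℤ._- + e) X
      hi = Vec.map (ℤ._+ + e) X
      lo-i : ∀ i → lookup lo i ≡ lookup X i ℤ.- + e
      lo-i i = Vec.lookup-map i _ X
      hi-i : ∀ i → lookup hi i ≡ lookup X i ℤ.+ + e
      hi-i i = Vec.lookup-map i _ X
      B : Box N lo hi x
      B = box (λ i → subst (λ z → z / N ≼ lookup x i) (sym (lo-i i)) (near-≼ (X≈x i)))
              (λ i → subst (λ z → lookup x i ≾ z / N) (sym (hi-i i)) (near-≾ (X≈x i)))
      e≤2e : + e ℤ.≤ + (e + e)
      e≤2e = ℤ.+≤+ (m≤m+n e e)

    -- The facets move by 2e because the cyclic inequalities compare two coordinates, each with
    -- error e.
    CL⇒DilatedCL : CL a l x → DilatedCL N (ℤ.- + (e + e)) a l X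
    CL⇒DilatedCL cl i =
      let p , q , r = CL⇒bounds N a l {lo} {hi} {x} B cl i
      in ℤ.≤-trans (ℤ.neg-mono-≤ e≤2e)
           (≤-from (subst (+ 0 ℤ.≤_) (hi-i i) p) (lemma₁ (lookup X i) (+ e)))
       , ℤ.≤-trans (≤-from (subst (ℤ._≤ + lookup a i ℤ.* + N) (lo-i i) q)
                           (lemma₂ (lookup X i) (+ e) (+ lookup a i ℤ.* + N)))
           (ℤ.+-monoʳ-≤ (+ lookup a i ℤ.* + N) (subst (+ e ℤ.≤_) (sym (ℤ.neg-involutive _)) e≤2e))
       , ≤-from (subst₂ (λ u v → u ℤ.- v ℤ.≤ (+ lookup a i ℤ.- + l) ℤ.* + N) (lo-i i) (hi-i (next i)) r)
                (lemma₃ (lookup X i) (lookup X (next i)) (+ e) ((+ lookup a i ℤ.- + l) ℤ.* + N))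
      where
      lemma₁ : ∀ x e → x ℤ.+ e ℤ.- + 0 ≡ x ℤ.- (ℤ.- e)
      lemma₁ = solve-ℤ
      lemma₂ : ∀ x e a → a ℤ.- (x ℤ.- e) ≡ a ℤ.+ e ℤ.- x
      lemma₂ = solve-ℤ
      lemma₃ : ∀ x y e a → a ℤ.- (x ℤ.- e ℤ.- (y ℤ.+ e)) ≡ a ℤ.- (ℤ.- (e ℤ.+ e)) ℤ.- (x ℤ.- y)
      lemma₃ = solve-ℤ

    DilatedCL⇒CL : DilatedCL N (+ (e + e)) a l X → CL a l x
    DilatedCL⇒CL p = bounds⇒CL N a l {lo} {hi} {x} B λ i →
      let p₁ , p₂ , p₃ = p i
      in subst (+ 0 ℤ.≤_) (sym (lo-i i)) (ℤ.i≤j⇒0≤j-i (ℤ.≤-trans e≤2e p₁))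
       , subst (ℤ._≤ + lookup a i ℤ.* + N) (sym (hi-i i))
           (≤-from (ℤ.≤-trans p₂ (ℤ.+-monoʳ-≤ (+ lookup a i ℤ.* + N) (ℤ.neg-mono-≤ e≤2e)))
                   (lemma₂ (lookup X i) (+ e) (+ lookup a i ℤ.* + N)))
       , subst₂ (λ u v → u ℤ.- v ℤ.≤ (+ lookup a i ℤ.- + l) ℤ.* + N) (sym (hi-i i)) (sym (lo-i (next i)))
           (≤-from p₃ (lemma₃ (lookup X i) (lookup X (next i)) (+ e) ((+ lookup a i ℤ.- + l) ℤ.* + N)))
      where
      lemma₂ : ∀ x e a → a ℤ.- e ℤ.- x ≡ a ℤ.- (x ℤ.+ e)
      lemma₂ = solve-ℤ
      lemma₃ : ∀ x y e a → a ℤ.- (e ℤ.+ e) ℤ.- (x ℤ.- y) ≡ a ℤ.- (x ℤ.+ e ℤ.- (y ℤ.- e))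
      lemma₃ = solve-ℤ

  cube-near : ∀ {d} (w : Vec ℤ d) u → Cube N w u → ∀ j → Near N 1 (lookup w j) (lookup u j)
  cube-near w u p j = near
    (≼-trans {_} {_} {lookup u j} (/-monoˡ N {lookup w j ℤ.- + 1} {lookup w j} (ℤ.i≤j⇒i-k≤j (+ 1) ℤ.≤-refl))
      (≼∧≤ᴿ⇒≼ {lookup w j / N} {fromℚ (lookup w j / N)} {lookup u j} ≼-fromℚ (proj₁ (p j))))
    (subst (λ z → lookup u j ≾ z / N) (ℤ.+-comm (+ 1) (lookup w j))
      (≤ᴿ∧≾⇒≾ {ℤ.suc (lookup w j) / N} {lookup u j} {fromℚ (ℤ.suc (lookup w j) / N)} (proj₂ (p j)) fromℚ-≾))

sum-updateAt : ∀ {s} (X : Vec ℤ s) i c → sumℤ (Vec.updateAt X i (ℤ._+ c)) ≡ sumℤ X ℤ.+ c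
sum-updateAt (x ∷ X) zero    c = lemma x c (sumℤ X)
  where
  lemma : ∀ x c s → x ℤ.+ c ℤ.+ s ≡ x ℤ.+ s ℤ.+ c
  lemma = solve-ℤ
sum-updateAt (x ∷ X) (suc i) c = trans (cong (λ z → x ℤ.+ z) (sum-updateAt X i c)) (sym (ℤ.+-assoc x (sumℤ X) c))

next≢ : ∀ {d} (i : Fin (suc (suc d))) → next i ≢ i
next≢ i with view i
... | ‵fromℕ     = λ eq → contradiction (trans (sym (next-last _)) eq) λ ()
... | ‵inject₁ j = λ eq → suc≢inject₁ j (trans (sym (next-inject₁ j)) eq)
  where
  suc≢inject₁ : ∀ {d} (j : Fin d) → suc j ≢ inject₁ j
  suc≢inject₁ (suc j) eq = suc≢inject₁ j (Fin.suc-injective eq)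

module _ {s} (X : Vec ℤ s) {i j : Fin s} (i≢j : i ≢ j) (c : ℤ) where

  private
    X⁺ : Vec ℤ s
    X⁺ = Vec.updateAt X i (ℤ._+ c)

  move : Vec ℤ s
  move = Vec.updateAt X⁺ j (ℤ._+ (ℤ.- c))

  sum-move : sumℤ move ≡ sumℤ X
  sum-move = trans (sum-updateAt X⁺ j (ℤ.- c)) (trans (cong (ℤ._- c) (sum-updateAt X i c)) (lemma (sumℤ X) c))
    where
    lemma : ∀ a c → a ℤ.+ c ℤ.- c ≡ a
    lemma = solve-ℤ

  move-source : lookup move i ≡ lookup X i ℤ.+ c
  move-source = trans (Vec.lookup∘updateAt′ i j i≢j X⁺) (Vec.lookup∘updateAt i X)

  move-target : lookup move j ≡ lookup X j ℤ.- c
  move-target = trans (Vec.lookup∘updateAt j X⁺) (cong (ℤ._- c) (Vec.lookup∘updateAt′ j i (i≢j ∘ sym) X))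

  move-within : ∀ {σ} → ℤ.- + σ ℤ.≤ c → c ℤ.≤ + σ → ∀ k →
                (lookup X k ℤ.- + σ ℤ.≤ lookup move k) × (lookup move k ℤ.≤ lookup X k ℤ.+ + σ)
  move-within {σ} -σ≤c c≤σ k with k ≟ i | k ≟ j
  ... | yes refl | _        = subst (lookup X k ℤ.- + σ ℤ.≤_) (sym move-source) (ℤ.+-monoʳ-≤ (lookup X k) -σ≤c)
                            , subst (ℤ._≤ lookup X k ℤ.+ + σ) (sym move-source) (ℤ.+-monoʳ-≤ (lookup X k) c≤σ)
  ... | no _     | yes refl = subst (lookup X k ℤ.- + σ ℤ.≤_) (sym move-target) (ℤ.+-monoʳ-≤ (lookup X k) (ℤ.neg-mono-≤ c≤σ))
                            , subst (ℤ._≤ lookup X k ℤ.+ + σ) (sym move-target) (ℤ.+-monoʳ-≤ (lookup X k)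
                                (subst (ℤ.- c ℤ.≤_) (ℤ.neg-involutive (+ σ)) (ℤ.neg-mono-≤ -σ≤c)))
  ... | no k≢i   | no k≢j   = subst (lookup X k ℤ.- + σ ℤ.≤_) (sym move-other) (ℤ.i≤j⇒i-k≤j (+ σ) ℤ.≤-refl)
                            , subst (ℤ._≤ lookup X k ℤ.+ + σ) (sym move-other) (ℤ.i≤i+j (lookup X k) (+ σ))
    where
    move-other : lookup move k ≡ lookup X k
    move-other = trans (Vec.lookup∘updateAt′ k j k≢j X⁺) (Vec.lookup∘updateAt′ k i k≢i X)

≤ᴿ-by : ∀ x y → (∀ q → q ≼ x → q ≼ y) → x ≤ᴿ y
≤ᴿ-by x y h n = ≤-fromℚ (lower-bound (h _ (approx-≼ x n)) n) (lemma (approx x n) (approx y n) (2⁻ n))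
  where
  lemma : ∀ x y e → y ℚ.+ e ℚ.- (x ℚ.- e) ≡ y ℚ.+ (e ℚ.+ e) ℚ.- x
  lemma = solve 3 (λ x y e → y :+ e :- (x :- e) := y :+ (e :+ e) :- x) refl

sum-chart : ∀ {d} t (u : Vec ℝ d) → sumᴿ (chart t u) ≃ t
sum-chart t u = ≤ᴿ-by x t to , ≤ᴿ-by t x from
  where
  s = sumᴿ u
  x = (t -ᴿ s) +ᴿ s
  to : ∀ q → q ≼ x → q ≼ t
  to q q≼x = ≼-limit 4 {q} {t} λ k → ≼-trans {_} {_} {t}
    (≤-fromℚ (≼∧≾⇒≤ {_} {_} {x} q≼x (≾-+ {_} {_} {t -ᴿ s} {s} (≾-- {_} {_} {t} {s} (approx-≾ t k) (approx-≼ s k)) (approx-≾ s k)))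
      (lemma q (approx t k) (approx s k) (2⁻ k)))
    (approx-≼ t k)
    where
    lemma : ∀ q t s e → (t ℚ.+ e ℚ.- (s ℚ.- e)) ℚ.+ (s ℚ.+ e) ℚ.- q ≡ t ℚ.- e ℚ.- (q ℚ.- + 4 / 1 ℚ.* e)
    lemma = solve 4 (λ q t s e → (t :+ e :- (s :- e)) :+ (s :+ e) :- q := t :- e :- (q :- con (+ 4 / 1) :* e)) refl
  from : ∀ q → q ≼ t → q ≼ x
  from q q≼t = ≼-limit 4 {q} {x} λ k → ≼-trans {_} {_} {x}
    (≤-fromℚ (≼∧≾⇒≤ {_} {_} {t} q≼t (approx-≾ t k)) (lemma q (approx t k) (approx s k) (2⁻ k)))
    (≼-+ {_} {_} {t -ᴿ s} {s} (≼-- {_} {_} {t} {s} (approx-≼ t k) (approx-≾ s k)) (approx-≼ s k))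
    where
    lemma : ∀ q t s e → t ℚ.+ e ℚ.- q ≡ (t ℚ.- e ℚ.- (s ℚ.+ e)) ℚ.+ (s ℚ.- e) ℚ.- (q ℚ.- + 4 / 1 ℚ.* e)
    lemma = solve 4 (λ q t s e → t :+ e :- q := (t :- e :- (s :+ e)) :+ (s :- e) :- (q :- con (+ 4 / 1) :* e)) refl

near-complementary : ∀ {n t t′} N .{{_ : NonZero N}} {e T} → Complementary n t t′ →
                     Near N e T t → Near N e (+ n ℤ.* + N ℤ.- T) t′
near-complementary {n} {t} {t′} N {e} {T} c T≈t = near
    (subst (λ z → z / N ≼ t′) (lemma (+ n ℤ.* + N) T (+ e)) (Complementary.≾⇒≼′ c N (T ℤ.+ + e) (near-≾ T≈t)))
    (subst (λ z → t′ ≾ z / N) (lemma′ (+ n ℤ.* + N) T (+ e)) (Complementary.≼⇒≾′ c N (T ℤ.- + e) (near-≼ T≈t)))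
  where
  lemma : ∀ a b e → a ℤ.- (b ℤ.+ e) ≡ a ℤ.- b ℤ.- e
  lemma = solve-ℤ
  lemma′ : ∀ a b e → a ℤ.- (b ℤ.- e) ≡ a ℤ.- b ℤ.+ e
  lemma′ = solve-ℤ

module _ (N : ℕ) .{{_ : NonZero N}} where

  rational : ∀ {d} → Vec ℤ d → Vec ℝ d
  rational = Vec.map (λ x → fromℚ (x / N))

  rational-near : ∀ {d} (w : Vec ℤ d) j → Near N 0 (lookup w j) (lookup (rational w) j)
  rational-near w j = subst (Near N 0 (lookup w j)) (sym (Vec.lookup-map j _ w)) (near
    (subst (λ z → z / N ≼ fromℚ (lookup w j / N)) (sym (ℤ.+-identityʳ (lookup w j))) ≼-fromℚ)
    (subst (λ z → fromℚ (lookup w j / N) ≾ z / N) (sym (ℤ.+-identityʳ (lookup w j))) fromℚ-≾))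

lookup-tail : ∀ {A : Set} {d} (X : Vec A (suc d)) j → lookup (Vec.tail X) j ≡ lookup X (suc j)
lookup-tail (x ∷ X) j = refl

module _ (N M : ℕ) .{{N≢0 : NonZero N}} .{{M≢0 : NonZero M}} where
  private
    instance
      NM≢0 : NonZero (N * M)
      NM≢0 = m*n≢0 N M

  refine-cube : ∀ {d} (z w : Vec ℤ d) →
    (∀ j → (lookup z j ℤ.* + M ℤ.≤ lookup w j) × (lookup w j ℤ.≤ lookup z j ℤ.* + M ℤ.+ + M)) →
    Cube N z (rational (N * M) w)
  refine-cube z w p j = subst (λ x → (fromℚ (lookup z j / N) ≤ᴿ x) × (x ≤ᴿ fromℚ (ℤ.suc (lookup z j) / N)))
    (sym (Vec.lookup-map j _ w))
    ( ≾∧≼⇒≤ᴿ {lookup z j / N} {lookup w j / (N * M)} {fromℚ (lookup z j / N)} {fromℚ (lookup w j / (N * M))} fromℚ-≾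
        (/-mono-≤ N (N * M) (lookup z j) (lookup w j)
          (subst (ℤ._≤ lookup w j ℤ.* + N) (scale (lookup z j)) (ℤ.*-monoʳ-≤-nonNeg (+ N) (proj₁ (p j))))) ≼-fromℚ
    , ≾∧≼⇒≤ᴿ {lookup w j / (N * M)} {ℤ.suc (lookup z j) / N} {fromℚ (lookup w j / (N * M))} {fromℚ (ℤ.suc (lookup z j) / N)} fromℚ-≾
        (/-mono-≤ (N * M) N (lookup w j) (ℤ.suc (lookup z j))
          (subst (lookup w j ℤ.* + N ℤ.≤_) (trans (cong (ℤ._* + N) (suc-* (lookup z j) (+ M))) (scale (ℤ.suc (lookup z j))))
            (ℤ.*-monoʳ-≤-nonNeg (+ N) (proj₂ (p j))))) ≼-fromℚ )
    where
    suc-* : ∀ z m → z ℤ.* m ℤ.+ m ≡ (+ 1 ℤ.+ z) ℤ.* m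
    suc-* = solve-ℤ
    scale : ∀ z → z ℤ.* + M ℤ.* + N ≡ z ℤ.* + (N * M)
    scale z = trans (lemma z (+ M) (+ N)) (cong (λ y → z ℤ.* y) (sym (ℤ.pos-* N M)))
      where
      lemma : ∀ z m n → z ℤ.* m ℤ.* n ≡ z ℤ.* (n ℤ.* m)
      lemma = solve-ℤ

  -- Moving the point by ±σ(eᵢ − e_{i+1}) stays in the cube and in the hyperplane, and brings the
  -- point closer by at least σ to each of the facets belonging to i.
  slack : ∀ {d} (a : Vec ℕ (suc (suc d))) l k {t T} (z w : Vec ℤ (suc d)) →
          (∀ u → Cube N z u → CL a l (chart t u)) → Near (N * M) 2 T t →
          (∀ j → (lookup z j ℤ.* + M ℤ.+ + (k + 4) ℤ.≤ lookup w j) ×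
                 (lookup w j ℤ.≤ lookup z j ℤ.* + M ℤ.+ + M ℤ.- + (k + 4))) →
          DilatedCL (N * M) (+ k) a l (chartℤ T w)
  slack {d} a l k {t} {T} z w inside T≈t w∈z i =
      ≤-from (proj₁ (moved (ℤ.- + σ) ℤ.≤-refl (ℤ.neg-≤-pos {σ} {σ})))
        (trans (cong (ℤ._- -4ℤ) (move-source X (next≢ i ∘ sym) (ℤ.- + σ))) (lemma₁ (lookup X i) (+ k)))
    , ≤-from (proj₁ (proj₂ up))
        (trans (cong (λ z → A ℤ.- -4ℤ ℤ.- z) source) (lemma₂ A (lookup X i) (+ k)))
    -- Both coordinates move, so this facet is approached by 2σ; one σ suffices and the other is
    -- discarded.
    , ℤ.≤-trans (≤-from (proj₂ (proj₂ up))
        (trans (cong₂ (λ y z → B ℤ.- -4ℤ ℤ.- (y ℤ.- z)) source target)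
               (lemma₃ B (lookup X i) (lookup X (next i)) (+ k))))
        (ℤ.i≤j⇒i-k≤j (+ σ) ℤ.≤-refl)
    where
    -- The desired margin `k` plus the 4 lost by `CL⇒DilatedCL`, twice the rounding error 2 of the
    -- level.
    σ = k + 4
    X = chartℤ T w
    A = + lookup a i ℤ.* + (N * M)
    B = (+ lookup a i ℤ.- + l) ℤ.* + (N * M)
    -4ℤ = ℤ.- + 4
    at : ∀ w′ → (∀ j → (lookup z j ℤ.* + M ℤ.≤ lookup w′ j) × (lookup w′ j ℤ.≤ lookup z j ℤ.* + M ℤ.+ + M)) →
         DilatedCL (N * M) -4ℤ a l (chartℤ T w′)
    at w′ p = go (rational (N * M) w′) (rational-near (N * M) w′) (refine-cube z w′ p)
      where
      go : ∀ u → (∀ j → Near (N * M) 0 (lookup w′ j) (lookup u j)) → Cube N z u →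
           DilatedCL (N * M) -4ℤ a l (chartℤ T w′)
      go u w′≈u c = CL⇒DilatedCL (N * M) a l 2 (chartℤ T w′) (chart t u)
        (λ i → near-weaken (N * M) {2 + suc d * 0} {2} {lookup (chartℤ T w′) i} {lookup (chart t u) i}
          (≤-reflexive (cong (λ z → 2 + z) (*-zeroʳ (suc d))))
          (near-chart (N * M) {2} {0} {suc d} {T} {t} w′ u T≈t w′≈u i))
        (inside u c)
    moved : ∀ c → ℤ.- + σ ℤ.≤ c → c ℤ.≤ + σ → _
    moved c -σ≤c c≤σ = subst (DilatedCL (N * M) -4ℤ a l)
      (trans (cong (λ T → chartℤ T (Vec.tail X′)) (sym (trans (sum-move X (next≢ i ∘ sym) c) (sum-chartℤ T w))))
             (chartℤ-tail X′))
      (at (Vec.tail X′) λ j →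
        let lo , hi = move-within X (next≢ i ∘ sym) c -σ≤c c≤σ (suc j)
        in subst (lookup z j ℤ.* + M ℤ.≤_) (sym (lookup-tail X′ j))
             (ℤ.≤-trans (≤-from (proj₁ (w∈z j)) (lemma (lookup w j) (lookup z j ℤ.* + M) (+ σ))) lo)
         , subst (ℤ._≤ lookup z j ℤ.* + M ℤ.+ + M) (sym (lookup-tail X′ j))
             (ℤ.≤-trans hi (≤-from (proj₂ (w∈z j)) (lemma′ (lookup w j) (lookup z j ℤ.* + M ℤ.+ + M) (+ σ)))))
      i
      where
      X′ = move X (next≢ i ∘ sym) c
      lemma : ∀ w z s → w ℤ.- (z ℤ.+ s) ≡ w ℤ.- s ℤ.- z
      lemma = solve-ℤ
      lemma′ : ∀ w z s → z ℤ.- s ℤ.- w ≡ z ℤ.- (w ℤ.+ s)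
      lemma′ = solve-ℤ
    up = moved (+ σ) (ℤ.neg-≤-pos {σ} {σ}) ℤ.≤-refl
    source = move-source X (next≢ i ∘ sym) (+ σ)
    target = move-target X (next≢ i ∘ sym) (+ σ)
    lemma₁ : ∀ x k → x ℤ.- (k ℤ.+ + 4) ℤ.- (ℤ.- + 4) ≡ x ℤ.- k
    lemma₁ = solve-ℤ
    lemma₂ : ∀ a x k → a ℤ.- (ℤ.- + 4) ℤ.- (x ℤ.+ (k ℤ.+ + 4)) ≡ a ℤ.- k ℤ.- x
    lemma₂ = solve-ℤ
    lemma₃ : ∀ b x y k → b ℤ.- (ℤ.- + 4) ℤ.- (x ℤ.+ (k ℤ.+ + 4) ℤ.- (y ℤ.- (k ℤ.+ + 4))) ≡
                         b ℤ.- k ℤ.- (k ℤ.+ + 4) ℤ.- (x ℤ.- y)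
    lemma₃ = solve-ℤ

module _ {d n} (ā : Composition n (suc d)) (l : ℕ) (1≤l : 1 ≤ l)
         (2l≤a : ∀ i → 2 * l ≤ lookup (parts ā) i) where
  private
    a = parts ā

    k≤lN : ∀ k N → k ≤ N → + k ℤ.≤ + l ℤ.* + N
    k≤lN k N k≤N = subst (+ k ℤ.≤_) (ℤ.pos-* l N) (ℤ.+≤+ (≤-trans k≤N
      (≤-trans (≤-reflexive (sym (*-identityˡ N))) (*-monoˡ-≤ N 1≤l))))

  module Inner {t t′ : ℝ} (tt′ : Complementary n t t′) (N M : ℕ) (N≢0 : NonZero N) (M≢0 : NonZero M) (len : ℕ)
               (I : List (Vec ℤ d)) (T : ℤ) (T≈t : Near (N * M) {{m*n≢0 N M {{N≢0}} {{M≢0}}}} 2 T t) where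
    private
      -- Error of a chart whose level is rounded within 2 and whose other coordinates vary over a
      -- cube of side 1. The margin `k` = 2e lets whole cubes around the images stay inside, and
      -- `slack` demands `k` + 4 at the source.
      e = 2 + d * 1
      k = e + e
      σ = k + 4
      N′ = N * M
      N′≢0 : NonZero N′
      N′≢0 = m*n≢0 N M {{N≢0}} {{M≢0}}
      instance
        _ = N≢0
        _ = M≢0
        _ = N′≢0
    open Grid M (+ σ) len
    private
      ws : List (Vec ℤ d)
      ws = grids I
      T′ : ℤ
      T′ = + n ℤ.* + N′ ℤ.- T

    module _ (M≡ : M ≡ len + (σ + σ)) where
      private
        module R = Reflection (dilated-reflection ā l 2l≤a N′ (+ k) (k≤lN k N′
          (≤-trans (≤-trans (m≤m+n k 4) (≤-trans (m≤m+n σ σ)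
              (≤-trans (m≤n+m (σ + σ) len) (≤-reflexive (sym M≡)))))
            (≤-trans (≤-reflexive (sym (*-identityˡ M))) (*-monoˡ-≤ M (>-nonZero⁻¹ N))))))

      Good : Vec ℤ d → Set
      Good w = DilatedCL N′ (+ k) a l (chartℤ T w)

      f : Vec ℤ d → Vec ℤ d
      f w = Vec.tail (R.to (chartℤ T w))

      -- The level of the image is known, so dropping the head in `f` loses no information. This is
      -- what makes `f` injective.
      f-chart : ∀ {w} → Good w → chartℤ T′ (f w) ≡ R.to (chartℤ T w)
      f-chart {w} g = trans
        (cong (λ S → chartℤ S (f w)) (sym (trans (R.sum-to g) (cong (λ S → + n ℤ.* + N′ ℤ.- S) (sum-chartℤ T w)))))
        (chartℤ-tail (R.to (chartℤ T w)))

      f-injective : ∀ {w w′} → Good w → Good w′ → f w ≡ f w′ → w ≡ w′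
      f-injective {w} {w′} g g′ eq = cong Vec.tail (trans (sym (R.from∘to g)) (trans
        (cong R.from (trans (sym (f-chart g)) (trans (cong (chartℤ T′) eq) (f-chart g′)))) (R.from∘to g′)))

      width : + σ ℤ.+ + len ℤ.≤ + M
      width = ℤ.+≤+ (≤-trans (≤-reflexive (+-comm σ len)) (≤-trans (+-monoʳ-≤ len (m≤m+n σ σ)) (≤-reflexive (sym M≡))))

      inside : ∀ {w} → Good w → ∀ u → Cube N′ (f w) u → CLSection a l t′ (chart t′ u)
      inside {w} g u c =
          DilatedCL⇒CL N′ a l e (R.to (chartℤ T w)) (chart t′ u)
            (subst (λ X → ∀ i → Near N′ e (lookup X i) (lookup (chart t′ u) i)) (f-chart g)
              (near-chart N′ {2} {1} {d} {T′} {t′} (f w) u (near-complementary N′ {2} {T} tt′ T≈t) (cube-near N′ (f w) u c)))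
            (R.to-∈ g)
        , sum-chart t′ u

      inner-points : All Good ws → Unique I →
                     ∃[ J ] Unique J × All (λ z → ∀ u → Cube N′ z u → CLSection a l t′ (chart t′ u)) J
                          × length J ≡ length I * len ^ d
      inner-points good I! = List.map f ws
        , map-unique {P = Good} f f-injective good (grids-unique (ℤ.+≤+ z≤n) width I!)
        , All.map⁺ (All.map inside good)
        , trans (List.length-map f ws) (length-grids I)

      good-points : ∀ {d′} → d ≡ suc d′ →
                    All (λ z → ∀ u → Cube N z u → CLSection a l t (chart t u)) I → All Good ws
      good-points refl I⊆ = All.tabulate λ {w} w∈ →
        let z , z∈I , w∈z = find (∈-concatMap⁻ grid {xs = I} w∈)
        in slack N M a l k {t} {T} z w (λ u c → proj₁ (All.lookup I⊆ z∈I u c)) T≈t λ j →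
             let lo , hi = ∈-grid⁻ z w w∈z j
             in lo , ℤ.≤-trans (ℤ.<⇒≤ hi) (ℤ.≤-reflexive
                  (trans (cong (λ c → lookup z j ℤ.* + M ℤ.+ + σ ℤ.+ c) +len)
                         (lemma (lookup z j ℤ.* + M) (+ σ) (+ M))))
        where
        +len : + len ≡ + M ℤ.- (+ σ ℤ.+ + σ)
        +len = trans (lemma′ (+ len) (+ σ)) (cong (λ z → + z ℤ.- (+ σ ℤ.+ + σ)) (sym M≡))
          where
          lemma′ : ∀ a s → a ≡ a ℤ.+ (s ℤ.+ s) ℤ.- (s ℤ.+ s)
          lemma′ = solve-ℤ
        lemma : ∀ z s m → z ℤ.+ s ℤ.+ (m ℤ.- (s ℤ.+ s)) ≡ z ℤ.+ m ℤ.- s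
        lemma = solve-ℤ

  inner : ∀ {d′ t t′ q} → d ≡ suc d′ → Complementary n t t′ →
          lower (relVolume t (CLSection (parts ā) l t)) q → lower (relVolume t′ (CLSection (parts ā) l t′)) q
  inner {t = t} {t′} {q} d≡ tt′ (N , N≢0 , I , I! , I⊆ , q<v) =
    let len , M≢0 , q<v′ = shrink d q N (length I) (σ + σ) {{N≢0}} q<v
        M = len + (σ + σ)
        T , T≈t = nearby (N * M) {{m*n≢0 N M {{N≢0}} {{M≢0}}}} t
        open Inner {t} {t′} tt′ N M N≢0 M≢0 len I T T≈t
        J , J! , J⊆ , |J| = inner-points refl (good-points refl d≡ I⊆) I!
    in N * M , m*n≢0 N M {{N≢0}} {{M≢0}} , J , J! , J⊆
     , subst (λ c → q ℚ.< cubesVolume d (N * M) {{m*n≢0 N M {{N≢0}} {{M≢0}}}} c) (sym |J|) q<v′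
    where
    σ = (2 + d * 1) + (2 + d * 1) + 4

-- The upper cut

-- The discrepancy C is fixed while the mesh 1 / Q becomes arbitrarily fine.
≤ᴿ-limit : ∀ C x y → (∀ K → ∃[ Q ] Σ[ nz ∈ NonZero Q ] ∃[ X ] ∃[ Y ]
             K ≤ Q × (x ≾ (X / Q) {{nz}}) × ((Y / Q) {{nz}} ≼ y) × X ℤ.≤ Y ℤ.+ + C) → x ≤ᴿ y
≤ᴿ-limit C x y h = ≤ᴿ-by x y λ q q≼x → ≼-limit C {q} {y} λ k → step q q≼x k (h (2 ^ k))
  where
  step : ∀ q → q ≼ x → ∀ k → _ → q ℚ.- + C / 1 ℚ.* 2⁻ k ≼ y
  step q q≼x k (Q , nz , X , Y , K≤Q , x≾ , ≼y , X≤) = ≼-trans {_} {_} {y} bound ≼y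
    where
    instance
      _ = nz
      _ = m^n≢0 2 k
    error : + C / Q ℚ.≤ + C / 1 ℚ.* 2⁻ k
    error = subst (+ C / Q ℚ.≤_)
      (sym (trans (cong (+ C / 1 ℚ.*_) (2⁻-/ k)) (/-* 1 (2 ^ k) (+ C) (+ 1))))
      (/-mono-≤ Q (1 * 2 ^ k) {{nz}} {{m*n≢0 1 (2 ^ k)}} (+ C) (+ C ℤ.* + 1)
        (subst (λ z → + C ℤ.* + (1 * 2 ^ k) ℤ.≤ z ℤ.* + Q) (sym (ℤ.*-identityʳ (+ C)))
          (ℤ.*-monoˡ-≤-nonNeg (+ C) (ℤ.+≤+ (≤-trans (≤-reflexive (*-identityˡ (2 ^ k))) K≤Q)))))
    bound : q ℚ.- + C / 1 ℚ.* 2⁻ k ℚ.≤ Y / Q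
    bound = ≤-fromℚ
      (ℚ.≤-trans (≼∧≾⇒≤ {_} {_} {x} q≼x x≾) (ℚ.≤-trans (/-monoˡ Q {X} {Y ℤ.+ + C} X≤)
        (ℚ.≤-trans (ℚ.≤-reflexive (sym (/-+ Q Y (+ C)))) (ℚ.+-monoʳ-≤ (Y / Q) error))))
      (lemma q (Y / Q) (+ C / 1 ℚ.* 2⁻ k))
      where
      lemma : ∀ q y e → y ℚ.+ e ℚ.- q ≡ y ℚ.- (q ℚ.- e)
      lemma = solve 3 (λ q y e → y :+ e :- q := y :- (q :- e)) refl

-- Closedness of the polytope: x may be approximated by grid points of slightly enlarged dilates,
-- provided that both the enlargement and the distance stay bounded in grid steps.
CL-limit : ∀ {d} (a : Vec ℕ (suc d)) l m E (x : Vec ℝ (suc d)) →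
           (∀ K → ∃[ Q ] Σ[ nz ∈ NonZero Q ] ∃[ P ]
             K ≤ Q × DilatedCL Q (ℤ.- + m) a l P × (∀ i → Near Q {{nz}} E (lookup P i) (lookup x i))) →
           CL a l x
CL-limit a l m E x h i =
    ≤ᴿ-limit (m + E + E) 0ᴿ (lookup x i) (λ K → let Q , nz , P , K≤Q , P∈ , P≈x = h K in
      Q , nz , + 0 ℤ.* + Q , lookup P i ℤ.- + E , K≤Q , ≾-fromℤ Q {{nz}} (+ 0) , near-≼ {{nz}} (P≈x i)
        , ≤-from (ℤ.+-mono-≤ (proj₁ (P∈ i)) (ℤ.+≤+ (z≤n {E})))
            (trans (lemma₁ (lookup P i) (+ m) (+ E)) (cong (λ z → lookup P i ℤ.- + E ℤ.+ (+ m ℤ.+ + E ℤ.+ + E) ℤ.- z) (sym (ℤ.*-zeroˡ (+ Q))))))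
  , ≤ᴿ-limit (m + E + E) (lookup x i) (fromℤ (+ lookup a i)) (λ K → let Q , nz , P , K≤Q , P∈ , P≈x = h K in
      Q , nz , lookup P i ℤ.+ + E , + lookup a i ℤ.* + Q , K≤Q , near-≾ {{nz}} (P≈x i) , fromℤ-≼ Q {{nz}} (+ lookup a i)
        , ≤-from (ℤ.+-mono-≤ (proj₁ (proj₂ (P∈ i))) (ℤ.+≤+ (z≤n {E})))
            (lemma₂ (+ lookup a i ℤ.* + Q) (lookup P i) (+ m) (+ E)))
  , ≤ᴿ-limit (m + E + E) (lookup x i -ᴿ lookup x (next i)) (fromℤ (+ lookup a i ℤ.- + l)) (λ K → let Q , nz , P , K≤Q , P∈ , P≈x = h K in
      Q , nz , lookup P i ℤ.+ + E ℤ.- (lookup P (next i) ℤ.- + E) , (+ lookup a i ℤ.- + l) ℤ.* + Q , K≤Q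
        , ≾-/- Q {{nz}} {lookup P i ℤ.+ + E} {lookup P (next i) ℤ.- + E} {lookup x i} {lookup x (next i)}
            (near-≾ {{nz}} (P≈x i)) (near-≼ {{nz}} (P≈x (next i)))
        , fromℤ-≼ Q {{nz}} (+ lookup a i ℤ.- + l)
        , ≤-from (proj₂ (proj₂ (P∈ i))) (lemma₃ ((+ lookup a i ℤ.- + l) ℤ.* + Q) (lookup P i) (lookup P (next i)) (+ m) (+ E)))
  where
  lemma₁ : ∀ p m e → p ℤ.+ e ℤ.- (ℤ.- m ℤ.+ + 0) ≡ p ℤ.- e ℤ.+ (m ℤ.+ e ℤ.+ e) ℤ.- + 0
  lemma₁ = solve-ℤ
  lemma₂ : ∀ a p m e → a ℤ.- (ℤ.- m) ℤ.+ e ℤ.- (p ℤ.+ + 0) ≡ a ℤ.+ (m ℤ.+ e ℤ.+ e) ℤ.- (p ℤ.+ e)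
  lemma₂ = solve-ℤ
  lemma₃ : ∀ a p q m e → a ℤ.- (ℤ.- m) ℤ.- (p ℤ.- q) ≡ a ℤ.+ (m ℤ.+ e ℤ.+ e) ℤ.- (p ℤ.+ e ℤ.- (q ℤ.- e))
  lemma₃ = solve-ℤ

-- A factor in [0, 1] keeps the sequence regular with unchanged indices.
scale : (w : ℚ) → 0ℚ ℚ.≤ w → w ℚ.≤ 1ℚ → ℝ → ℝ
scale w 0≤w w≤1 x .approx  n   = w ℚ.* approx x n
scale w 0≤w w≤1 x .regular m n = begin
  ℚ.∣ w ℚ.* approx x m ℚ.- w ℚ.* approx x n ∣  ≡⟨ cong ℚ.∣_∣ (factor w (approx x m) (approx x n)) ⟩
  ℚ.∣ w ℚ.* (approx x m ℚ.- approx x n) ∣      ≡⟨ ℚ.∣p*q∣≡∣p∣*∣q∣ w _ ⟩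
  ℚ.∣ w ∣ ℚ.* ℚ.∣ approx x m ℚ.- approx x n ∣  ≤⟨ ℚ.*-monoʳ-≤-nonNeg _ {{ℚ.∣-∣-nonNeg (approx x m ℚ.- approx x n)}} ∣w∣≤1 ⟩
  1ℚ ℚ.* ℚ.∣ approx x m ℚ.- approx x n ∣       ≡⟨ ℚ.*-identityˡ _ ⟩
  ℚ.∣ approx x m ℚ.- approx x n ∣              ≤⟨ regular x m n ⟩
  2⁻ m ℚ.+ 2⁻ n                                ∎
  where
  open ℚ.≤-Reasoning
  factor : ∀ w a b → w ℚ.* a ℚ.- w ℚ.* b ≡ w ℚ.* (a ℚ.- b)
  factor = solve 3 (λ w a b → w :* a :- w :* b := w :* (a :- b)) refl
  ∣w∣≤1 : ℚ.∣ w ∣ ℚ.≤ 1ℚ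
  ∣w∣≤1 = subst (ℚ._≤ 1ℚ) (sym (ℚ.0≤p⇒∣p∣≡p 0≤w)) w≤1

module _ {w : ℚ} (0≤w : 0ℚ ℚ.≤ w) (w≤1 : w ℚ.≤ 1ℚ) where
  private
    w2⁻≤ : ∀ n → w ℚ.* 2⁻ n ℚ.≤ 2⁻ n
    w2⁻≤ n = subst (w ℚ.* 2⁻ n ℚ.≤_) (ℚ.*-identityˡ (2⁻ n)) (ℚ.*-monoʳ-≤-nonNeg (2⁻ n) {{2⁻-nonNeg n}} w≤1)

  ≼-scale : ∀ {p} x → p ≼ x → w ℚ.* p ≼ scale w 0≤w w≤1 x
  ≼-scale {p} x p≼x = below λ n → ℚ.≤-trans (ℚ.*-monoˡ-≤-nonNeg w {{ℚ.nonNegative 0≤w}} (lower-bound p≼x n))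
    (ℚ.≤-trans (ℚ.≤-reflexive (ℚ.*-distribˡ-+ w (approx x n) (2⁻ n))) (ℚ.+-monoʳ-≤ (w ℚ.* approx x n) (w2⁻≤ n)))

  ≾-scale : ∀ {p} x → x ≾ p → scale w 0≤w w≤1 x ≾ w ℚ.* p
  ≾-scale {p} x x≾p = above λ n → ℚ.≤-trans (ℚ.*-monoˡ-≤-nonNeg w {{ℚ.nonNegative 0≤w}} (upper-bound x≾p n))
    (ℚ.≤-trans (ℚ.≤-reflexive (ℚ.*-distribˡ-+ w p (2⁻ n))) (ℚ.+-monoʳ-≤ (w ℚ.* p) (w2⁻≤ n)))

sum-mono : ∀ {s} (f g : Vec ℤ s) → (∀ j → lookup f j ℤ.≤ lookup g j) → sumℤ f ℤ.≤ sumℤ g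
sum-mono []      []      p = ℤ.≤-refl
sum-mono (x ∷ f) (y ∷ g) p = ℤ.+-mono-≤ (p zero) (sum-mono f g (p ∘ suc))

sum-gap : ∀ {s} c (f g : Vec ℤ s) i → (∀ j → lookup f j ℤ.≤ lookup g j) →
          lookup f i ℤ.+ c ℤ.≤ lookup g i → sumℤ f ℤ.+ c ℤ.≤ sumℤ g
sum-gap c (x ∷ f) (y ∷ g) zero    p gap = subst (ℤ._≤ y ℤ.+ sumℤ g) (lemma x c (sumℤ f))
  (ℤ.+-mono-≤ gap (sum-mono f g (p ∘ suc)))
  where
  lemma : ∀ x c s → x ℤ.+ c ℤ.+ s ≡ x ℤ.+ s ℤ.+ c
  lemma = solve-ℤ
sum-gap c (x ∷ f) (y ∷ g) (suc i) p gap = subst (ℤ._≤ y ℤ.+ sumℤ g) (sym (ℤ.+-assoc x (sumℤ f) c))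
  (ℤ.+-mono-≤ (p zero) (sum-gap c f g i (p ∘ suc) gap))

lookup≤sum : ∀ {s} (v : Vec ℕ s) i → lookup v i ≤ Vec.sum v
lookup≤sum (x ∷ v) zero    = m≤m+n x _
lookup≤sum (x ∷ v) (suc i) = ≤-trans (lookup≤sum v i) (m≤n+m _ x)

sum-nats : ∀ {s} (v : Vec ℕ s) k → sumℤ (Vec.map (λ b → + b ℤ.* k) v) ≡ + Vec.sum v ℤ.* k
sum-nats []      k = sym (ℤ.*-zeroˡ k)
sum-nats (x ∷ v) k = trans (cong (λ z → + x ℤ.* k ℤ.+ z) (sum-nats v k)) (sym (ℤ.*-distribʳ-+ k (+ x) (+ Vec.sum v)))

sum-replicate : ∀ s → sumℤ (Vec.replicate s (+ 0)) ≡ + 0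
sum-replicate zero    = refl
sum-replicate (suc s) = trans (ℤ.+-identityˡ _) (sum-replicate s)

-- A lattice point X almost in the N-th dilate, pushed down and up by τ, gives two points of the
-- (N + m)-th dilate whose levels enclose t.
module Enclosure {d n} (ā : Composition n (suc d)) (l : ℕ) (1≤l : 1 ≤ l)
                 (2l≤a : ∀ i → 2 * l ≤ lookup (parts ā) i)
                 (N m : ℕ) (1≤m : 1 ≤ m) where
  a : Vec ℕ (suc d)
  a = parts ā

  N″ s τ : ℕ
  -- Upper facets moved outwards by m fit into this dilate because aᵢ and aᵢ - l are at least 1. The
  -- facets xᵢ ≥ 0 gain nothing from dilation and are restored by truncation at 0.
  N″ = N + m
  s  = suc d
  -- Chosen so that (T + 2) · (N + m) ≤ (T + τ) · N for every T ≤ n · N + s · m: raising the level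
  -- by τ beats the rounding error 2 even after the denominator grows to `N″`.
  τ  = 2 + (n * m + (s * m + 2) * m)

  down : ℤ → ℤ
  down x = + 0 ℤ.⊔ (x ℤ.- + τ)

  up : ℕ → ℤ → ℤ
  up b x = (+ b ℤ.* + N″) ℤ.⊓ (x ℤ.+ + τ)

  private
    l≤a : ∀ i → l ≤ lookup a i
    l≤a i = ≤-trans (m≤m+n l _) (2l≤a i)

    1≤a : ∀ i → 1 ≤ lookup a i
    1≤a i = ≤-trans 1≤l (l≤a i)

    1≤a-l : ∀ i → + 1 ℤ.≤ + lookup a i ℤ.- + l
    1≤a-l i = ≤-from (ℤ.+≤+ (+-mono-≤ 1≤l (2l≤a i)))
      (trans (cong (λ z → + l ℤ.+ + lookup a i ℤ.- (+ 1 ℤ.+ (+ l ℤ.+ z))) (cong +_ (+-identityʳ l)))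
             (lemma (+ l) (+ lookup a i)))
      where
      lemma : ∀ l a → l ℤ.+ a ℤ.- (+ 1 ℤ.+ (l ℤ.+ l)) ≡ a ℤ.- l ℤ.- + 1
      lemma = solve-ℤ

    grow : ∀ c → + 1 ℤ.≤ c → c ℤ.* + N ℤ.- (ℤ.- + m) ℤ.≤ c ℤ.* + N″
    grow c 1≤c = ≤-from (ℤ.*-monoʳ-≤-nonNeg (+ m) 1≤c) (lemma c (+ N) (+ m))
      where
      lemma : ∀ c n m → c ℤ.* m ℤ.- + 1 ℤ.* m ≡ c ℤ.* (n ℤ.+ m) ℤ.- (c ℤ.* n ℤ.- (ℤ.- m))
      lemma = solve-ℤ

    0≤*N″ : ∀ c → + 1 ℤ.≤ c → + 0 ℤ.≤ c ℤ.* + N″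
    0≤*N″ c 1≤c = subst (ℤ._≤ c ℤ.* + N″) (ℤ.*-zeroˡ (+ N″))
      (ℤ.*-monoʳ-≤-nonNeg (+ N″) (ℤ.≤-trans (ℤ.+≤+ z≤n) 1≤c))

    m+1≤τ : m + 1 ≤ τ
    m+1≤τ = ≤-trans (≤-reflexive (+-comm m 1)) (s≤s (m≤n⇒m≤1+n
      (≤-trans (≤-trans (≤-reflexive (sym (*-identityˡ m))) (*-monoˡ-≤ m (≤-trans (s≤s z≤n) (m≤n+m 2 (s * m)))))
        (m≤n+m _ (n * m)))))

  module Point (X : Vec ℤ (suc d)) (X∈ : DilatedCL N (ℤ.- + m) a l X) where
    Y⁻ Y⁺ : Vec ℤ (suc d)
    Y⁻ = Vec.map down X
    Y⁺ = Vec.zipWith up a X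

    Y⁻≡ : ∀ i → lookup Y⁻ i ≡ down (lookup X i)
    Y⁻≡ i = Vec.lookup-map i down X

    Y⁺≡ : ∀ i → lookup Y⁺ i ≡ up (lookup a i) (lookup X i)
    Y⁺≡ i = Vec.lookup-zipWith up i a X

    private
      X≤ : ∀ i → lookup X i ℤ.≤ + lookup a i ℤ.* + N″
      X≤ i = ℤ.≤-trans (proj₁ (proj₂ (X∈ i))) (grow (+ lookup a i) (ℤ.+≤+ (1≤a i)))

      X-X≤ : ∀ i → lookup X i ℤ.- lookup X (next i) ℤ.≤ (+ lookup a i ℤ.- + l) ℤ.* + N″
      X-X≤ i = ℤ.≤-trans (proj₂ (proj₂ (X∈ i))) (grow (+ lookup a i ℤ.- + l) (1≤a-l i))

      0≤X+τ : ∀ i → + 1 ℤ.≤ lookup X i ℤ.+ + τ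
      0≤X+τ i = ≤-from (ℤ.+-mono-≤ (proj₁ (X∈ i)) (ℤ.+≤+ m+1≤τ)) (lemma (lookup X i) (+ τ) (+ m))
        where
        lemma : ∀ x t m → x ℤ.+ t ℤ.- (ℤ.- m ℤ.+ (m ℤ.+ + 1)) ≡ x ℤ.+ t ℤ.- + 1
        lemma = solve-ℤ

    X-τ≤Y⁻ : ∀ i → lookup X i ℤ.- + τ ℤ.≤ lookup Y⁻ i
    X-τ≤Y⁻ i = subst (lookup X i ℤ.- + τ ℤ.≤_) (sym (Y⁻≡ i)) (ℤ.i≤j⊔i (+ 0) _)

    Y⁺≤X+τ : ∀ i → lookup Y⁺ i ℤ.≤ lookup X i ℤ.+ + τ
    Y⁺≤X+τ i = subst (ℤ._≤ lookup X i ℤ.+ + τ) (sym (Y⁺≡ i)) (ℤ.i⊓j≤j (+ lookup a i ℤ.* + N″) _)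

    Y⁺≤aN″ : ∀ i → lookup Y⁺ i ℤ.≤ + lookup a i ℤ.* + N″
    Y⁺≤aN″ i = subst (ℤ._≤ + lookup a i ℤ.* + N″) (sym (Y⁺≡ i)) (ℤ.i⊓j≤i _ (lookup X i ℤ.+ + τ))

    0≤Y⁻ : ∀ i → + 0 ℤ.≤ lookup Y⁻ i
    0≤Y⁻ i = subst (+ 0 ℤ.≤_) (sym (Y⁻≡ i)) (ℤ.i≤i⊔j (+ 0) _)

    -- Strictness makes the difference of the two levels positive, so that it can serve as a
    -- denominator in the interpolation.
    Y⁻<Y⁺ : ∀ i → lookup Y⁻ i ℤ.+ + 1 ℤ.≤ lookup Y⁺ i
    Y⁻<Y⁺ i = subst₂ (λ u v → u ℤ.+ + 1 ℤ.≤ v) (sym (Y⁻≡ i)) (sym (Y⁺≡ i))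
      (subst (ℤ._≤ up (lookup a i) x) (sym (ℤ.+-comm (down x) (+ 1)))
        (subst (ℤ._≤ up (lookup a i) x) (sym (ℤ.mono-≤-distrib-⊔ {ℤ.suc} (λ p → ℤ.+-monoʳ-≤ (+ 1) p) (+ 0) (x ℤ.- + τ)))
          (ℤ.⊔-lub
            (ℤ.⊓-glb aN″≥1 (0≤X+τ i))
            (ℤ.⊓-glb (ℤ.≤-trans shrinkτ (X≤ i)) (ℤ.≤-trans shrinkτ (ℤ.i≤i+j x (+ τ)))))))
      where
      x = lookup X i
      aN″≥1 : + 1 ℤ.≤ + lookup a i ℤ.* + N″
      aN″≥1 = subst (+ 1 ℤ.≤_) (ℤ.pos-* (lookup a i) N″)
        (ℤ.+≤+ (*-mono-≤ (1≤a i) (≤-trans 1≤m (m≤n+m m N))))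
      shrinkτ : + 1 ℤ.+ (x ℤ.- + τ) ℤ.≤ x
      shrinkτ = ≤-from (ℤ.+≤+ (s≤s (z≤n {pred τ}))) (lemma x (+ τ))
        where
        lemma : ∀ x t → t ℤ.- + 1 ≡ x ℤ.- (+ 1 ℤ.+ (x ℤ.- t))
        lemma = solve-ℤ

    Y⁻≤Y⁺ : ∀ i → lookup Y⁻ i ℤ.≤ lookup Y⁺ i
    Y⁻≤Y⁺ i = ℤ.≤-trans (ℤ.i≤i+j _ (+ 1)) (Y⁻<Y⁺ i)

    Y⁻-step : ∀ i → lookup Y⁻ i ℤ.- lookup Y⁻ (next i) ℤ.≤ (+ lookup a i ℤ.- + l) ℤ.* + N″
    Y⁻-step i = subst₂ (λ u v → u ℤ.- v ℤ.≤ B) (sym (Y⁻≡ i)) (sym (Y⁻≡ (next i)))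
      (≤-from (ℤ.⊔-lub {x = B ℤ.+ down x′}
          (ℤ.+-mono-≤ (0≤*N″ _ (1≤a-l i)) (ℤ.i≤i⊔j (+ 0) (x′ ℤ.- + τ)))
          (ℤ.≤-trans (≤-from (X-X≤ i) (lemma B x x′ (+ τ))) (ℤ.+-monoʳ-≤ B (ℤ.i≤j⊔i (+ 0) (x′ ℤ.- + τ)))))
        (lemma′ B (down x) (down x′)))
      where
      B = (+ lookup a i ℤ.- + l) ℤ.* + N″
      x = lookup X i
      x′ = lookup X (next i)
      lemma : ∀ b x y t → b ℤ.- (x ℤ.- y) ≡ b ℤ.+ (y ℤ.- t) ℤ.- (x ℤ.- t)
      lemma = solve-ℤ
      lemma′ : ∀ b x y → b ℤ.+ y ℤ.- x ≡ b ℤ.- (x ℤ.- y)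
      lemma′ = solve-ℤ

    Y⁺-step : ∀ i → lookup Y⁺ i ℤ.- lookup Y⁺ (next i) ℤ.≤ (+ lookup a i ℤ.- + l) ℤ.* + N″
    Y⁺-step i = subst₂ (λ u v → u ℤ.- v ℤ.≤ B) (sym (Y⁺≡ i)) (sym (Y⁺≡ (next i)))
      (≤-from (ℤ.⊓-glb {x = y ℤ.- B}
          (ℤ.≤-trans (≤-from (ℤ.i⊓j≤i (+ lookup a i ℤ.* + N″) (x ℤ.+ + τ)) (lemma₁ (+ lookup a i) (+ l) (+ N″) y))
            (ℤ.*-monoʳ-≤-nonNeg (+ N″) (ℤ.+≤+ (l≤a (next i)))))
          (≤-from (ℤ.+-mono-≤ (ℤ.i⊓j≤j (+ lookup a i ℤ.* + N″) (x ℤ.+ + τ)) (X-X≤ i)) (lemma₂ B x x′ (+ τ) y)))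
        (lemma₃ B y (up (lookup a (next i)) x′)))
      where
      B = (+ lookup a i ℤ.- + l) ℤ.* + N″
      x = lookup X i
      x′ = lookup X (next i)
      y = up (lookup a i) x
      lemma₁ : ∀ a l n y → a ℤ.* n ℤ.- y ≡ l ℤ.* n ℤ.- (y ℤ.- (a ℤ.- l) ℤ.* n)
      lemma₁ = solve-ℤ
      lemma₂ : ∀ b x x′ t y → x ℤ.+ t ℤ.+ b ℤ.- (y ℤ.+ (x ℤ.- x′)) ≡ x′ ℤ.+ t ℤ.- (y ℤ.- b)
      lemma₂ = solve-ℤ
      lemma₃ : ∀ b y z → z ℤ.- (y ℤ.- b) ≡ b ℤ.- (y ℤ.- z)
      lemma₃ = solve-ℤ

    S⁻ S⁺ : ℤ
    S⁻ = sumℤ Y⁻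
    S⁺ = sumℤ Y⁺

    S⁻<S⁺ : S⁻ ℤ.+ + 1 ℤ.≤ S⁺
    S⁻<S⁺ = sum-gap (+ 1) Y⁻ Y⁺ zero Y⁻≤Y⁺ (Y⁻<Y⁺ zero)

    -- Truncation raises an entry by at most m. As soon as one entry is at least τ it drops by the
    -- full τ, which outweighs all the others and leaves 2 for the rounding error of the level.
    -- Otherwise everything is truncated to 0.
    S⁻-bound : (S⁻ ≡ + 0) ⊎ (S⁻ ℤ.≤ sumℤ X ℤ.- + 2)
    S⁻-bound with any? (λ i → + τ ℤ.≤? lookup X i)
    ... | no  ¬∃ = inj₁ (trans (cong sumℤ (all-zero X (λ i τ≤ → ¬∃ (i , τ≤)))) (sum-replicate s))
      where
      all-zero : ∀ {k} (X : Vec ℤ k) → (∀ i → ¬ + τ ℤ.≤ lookup X i) → Vec.map down X ≡ Vec.replicate k (+ 0)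
      all-zero []      _ = refl
      all-zero (x ∷ X) p = cong₂ _∷_
        (ℤ.i≥j⇒i⊔j≡i (ℤ.i≤j⇒i-j≤0 (ℤ.<⇒≤ (ℤ.≰⇒> (p zero))))) (all-zero X (p ∘ suc))
    ... | yes (i , τ≤) = inj₂ (≤-from (ℤ.+-mono-≤
        (subst (S⁻ ℤ.+ (+ τ ℤ.+ + m) ℤ.≤_) (sum-map-+ (+ m) X)
          (sum-gap (+ τ ℤ.+ + m) Y⁻ (Vec.map (ℤ._+ + m) X) i
            (λ j → subst₂ ℤ._≤_ (sym (Y⁻≡ j)) (sym (Vec.lookup-map j _ X))
              (ℤ.⊔-lub (≤-from (proj₁ (X∈ j)) (lemma₁ (lookup X j) (+ m)))
                       (≤-from (ℤ.+≤+ (z≤n {τ + m})) (lemma₂ (lookup X j) (+ τ) (+ m)))))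
            (subst₂ ℤ._≤_ (cong (ℤ._+ (+ τ ℤ.+ + m)) (sym (Y⁻≡ i))) (sym (Vec.lookup-map i _ X))
              (ℤ.≤-reflexive (trans (cong (ℤ._+ (+ τ ℤ.+ + m)) (ℤ.i≤j⇒i⊔j≡j (ℤ.i≤j⇒0≤j-i τ≤)))
                                    (lemma₃ (lookup X i) (+ τ) (+ m)))))))
        sm+2≤τ+m)
        (lemma₄ S⁻ (sumℤ X) (+ τ) (+ m) (+ s ℤ.* + m)))
      where
      sm+2≤τ+m : + s ℤ.* + m ℤ.+ + 2 ℤ.≤ + τ ℤ.+ + m
      sm+2≤τ+m = subst (λ z → z ℤ.+ + 2 ℤ.≤ + τ ℤ.+ + m) (ℤ.pos-* s m) (ℤ.+≤+
        (≤-trans (≤-trans (≤-trans (≤-reflexive (sym (*-identityʳ _))) (*-monoʳ-≤ (s * m + 2) 1≤m))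
          (≤-trans (m≤n+m _ (n * m)) (m≤n+m _ 2))) (m≤m+n τ m)))
      lemma₁ : ∀ x m → x ℤ.- (ℤ.- m) ≡ x ℤ.+ m ℤ.- + 0
      lemma₁ = solve-ℤ
      lemma₂ : ∀ x t m → t ℤ.+ m ℤ.- + 0 ≡ x ℤ.+ m ℤ.- (x ℤ.- t)
      lemma₂ = solve-ℤ
      lemma₃ : ∀ x t m → x ℤ.- t ℤ.+ (t ℤ.+ m) ≡ x ℤ.+ m
      lemma₃ = solve-ℤ
      lemma₄ : ∀ S T t m u → T ℤ.+ u ℤ.+ (t ℤ.+ m) ℤ.- (S ℤ.+ (t ℤ.+ m) ℤ.+ (u ℤ.+ + 2)) ≡ T ℤ.- + 2 ℤ.- S
      lemma₄ = solve-ℤ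

    -- No entry drops, and one with enough room below its cap gains the full τ. If none has room,
    -- all entries sit at their caps.
    S⁺-bound : (S⁺ ≡ + n ℤ.* + N″) ⊎ (sumℤ X ℤ.+ + τ ℤ.≤ S⁺)
    S⁺-bound with any? (λ i → lookup X i ℤ.+ + τ ℤ.≤? + lookup a i ℤ.* + N″)
    ... | no ¬∃ = inj₁ (trans (cong sumℤ (all-full a X (λ i p → ¬∃ (i , p))))
                         (trans (sum-nats a (+ N″)) (cong (λ z → + z ℤ.* + N″) (total ā))))
      where
      all-full : ∀ {k} (a : Vec ℕ k) (X : Vec ℤ k) → (∀ i → ¬ lookup X i ℤ.+ + τ ℤ.≤ + lookup a i ℤ.* + N″) →
                 Vec.zipWith up a X ≡ Vec.map (λ b → + b ℤ.* + N″) a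
      all-full []      []      _ = refl
      all-full (b ∷ a) (x ∷ X) p = cong₂ _∷_ (ℤ.i≤j⇒i⊓j≡i (ℤ.<⇒≤ (ℤ.≰⇒> (p zero)))) (all-full a X (p ∘ suc))
    ... | yes (i , p) = inj₂ (sum-gap (+ τ) X Y⁺ i
        (λ j → subst (lookup X j ℤ.≤_) (sym (Y⁺≡ j)) (ℤ.⊓-glb (X≤ j) (ℤ.i≤i+j (lookup X j) (+ τ))))
        (subst (lookup X i ℤ.+ + τ ℤ.≤_) (sym (Y⁺≡ i)) (ℤ.⊓-glb p ℤ.≤-refl)))

    sum-X≤ : sumℤ X ℤ.≤ + n ℤ.* + N ℤ.+ + s ℤ.* + m
    sum-X≤ = subst (sumℤ X ℤ.≤_)
      (trans (sum-map-+ (+ m) aN) (cong (λ z → z ℤ.+ + s ℤ.* + m) (trans (sum-nats a (+ N)) (cong (λ z → + z ℤ.* + N) (total ā)))))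
      (sum-mono X (Vec.map (ℤ._+ + m) aN) λ j →
        subst (lookup X j ℤ.≤_) (sym (trans (Vec.lookup-map j _ aN) (cong (ℤ._+ + m) (Vec.lookup-map j _ a))))
          (subst (λ z → lookup X j ℤ.≤ + lookup a j ℤ.* + N ℤ.+ z) (ℤ.neg-involutive (+ m)) (proj₁ (proj₂ (X∈ j)))))
      where
      aN = Vec.map (λ b → + b ℤ.* + N) a

near-scale : ∀ D N .{{_ : NonZero D}} .{{_ : NonZero N}} {e T x} → Near N e T x →
             Near (D * N) {{m*n≢0 D N}} (D * e) (+ D ℤ.* T) x
near-scale D N {e} {T} {x} T≈x = near {{DN≢0}}
    (subst (_≼ x) (rescale (T ℤ.- + e) _ (trans (ℤ.*-distribˡ-+ (+ D) T (ℤ.- + e))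
      (cong (λ z → + D ℤ.* T ℤ.+ z) (trans (sym (ℤ.neg-distribʳ-* (+ D) (+ e))) (cong ℤ.-_ (sym (ℤ.pos-* D e))))))) (near-≼ T≈x))
    (subst (x ≾_) (rescale (T ℤ.+ + e) _ (trans (ℤ.*-distribˡ-+ (+ D) T (+ e))
      (cong (λ z → + D ℤ.* T ℤ.+ z) (sym (ℤ.pos-* D e))))) (near-≾ T≈x))
  where
  DN≢0 = m*n≢0 D N
  rescale : ∀ X Y → + D ℤ.* X ≡ Y → X / N ≡ (Y / (D * N)) {{DN≢0}}
  rescale X Y refl = /-cross N (D * N) {{_}} {{DN≢0}} X (+ D ℤ.* X)
    (trans (cong (λ z → X ℤ.* z) (ℤ.pos-* D N)) (lemma X (+ D) (+ N)))
    where
    lemma : ∀ x d n → x ℤ.* (d ℤ.* n) ≡ d ℤ.* x ℤ.* n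
    lemma = solve-ℤ

sum-line : ∀ {k} (v w : Vec ℤ k) c e →
           sumℤ (Vec.tabulate (λ i → lookup v i ℤ.* c ℤ.+ (lookup w i ℤ.- lookup v i) ℤ.* e)) ≡
           sumℤ v ℤ.* c ℤ.+ (sumℤ w ℤ.- sumℤ v) ℤ.* e
sum-line []      []      c e = lemma c e
  where
  lemma : ∀ c e → + 0 ≡ + 0 ℤ.* c ℤ.+ (+ 0 ℤ.- + 0) ℤ.* e
  lemma = solve-ℤ
sum-line (x ∷ v) (y ∷ w) c e = trans (cong (λ z → x ℤ.* c ℤ.+ (y ℤ.- x) ℤ.* e ℤ.+ z) (sum-line v w c e))
  (lemma x y (sumℤ v) (sumℤ w) c e)
  where
  lemma : ∀ x y a b c e → x ℤ.* c ℤ.+ (y ℤ.- x) ℤ.* e ℤ.+ (a ℤ.* c ℤ.+ (b ℤ.- a) ℤ.* e) ≡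
                          (x ℤ.+ a) ℤ.* c ℤ.+ (y ℤ.+ b ℤ.- (x ℤ.+ a)) ℤ.* e
  lemma = solve-ℤ

convex-≤ : ∀ {x y b α β} → + 0 ℤ.≤ α → + 0 ℤ.≤ β → x ℤ.≤ b → y ℤ.≤ b → x ℤ.* α ℤ.+ y ℤ.* β ℤ.≤ b ℤ.* (α ℤ.+ β)
convex-≤ {x} {y} {b} {α} {β} 0≤α 0≤β x≤b y≤b = subst (x ℤ.* α ℤ.+ y ℤ.* β ℤ.≤_) (sym (ℤ.*-distribˡ-+ b α β))
  (ℤ.+-mono-≤ (ℤ.*-monoʳ-≤-nonNeg α {{ℤ.nonNegative 0≤α}} x≤b) (ℤ.*-monoʳ-≤-nonNeg β {{ℤ.nonNegative 0≤β}} y≤b))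

module Interpolation {d n} (ā : Composition n (suc d)) (l : ℕ) (1≤l : 1 ≤ l)
    (2l≤a : ∀ i → 2 * l ≤ lookup (parts ā) i)
    (N m : ℕ) (N≢0 : NonZero N) (1≤m : 1 ≤ m)
    (X : Vec ℤ (suc d)) (X∈ : DilatedCL N (ℤ.- + m) (parts ā) l X)
    (t : ℝ) (X≈t : Near N {{N≢0}} 2 (sumℤ X) t) (0≼t : (+ 0 / 1) ≼ t) (t≾n : t ≾ (+ n / 1)) where

  open Enclosure ā l 1≤l 2l≤a N m 1≤m
  open Point X X∈

  instance
    N≢0′ : NonZero N
    N≢0′ = N≢0
    N″≢0 : NonZero N″
    N″≢0 = >-nonZero (≤-trans 1≤m (m≤n+m m N))

  private
    T = sumℤ X

    0≤S⁻ : + 0 ℤ.≤ S⁻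
    0≤S⁻ = subst (ℤ._≤ S⁻) (sum-replicate s) (sum-mono (Vec.replicate s (+ 0)) Y⁻
      (λ j → subst (ℤ._≤ lookup Y⁻ j) (sym (Vec.lookup-replicate j (+ 0))) (0≤Y⁻ j)))

  -- The truncated case uses t ≥ 0. In the other, T - 2 is nonnegative, so the larger denominator
  -- only lowers the quotient.
  S⁻≼t : S⁻ / N″ ≼ t
  S⁻≼t with S⁻-bound
  ... | inj₁ S⁻≡0 = subst (_≼ t) (/-cross 1 N″ (+ 0) S⁻ (trans (ℤ.*-zeroˡ (+ N″)) (sym (trans (ℤ.*-identityʳ S⁻) S⁻≡0)))) 0≼t
  ... | inj₂ S⁻≤  = ≼-trans {S⁻ / N″} {(T ℤ.- + 2) / N} {t} (/-mono-≤ N″ N S⁻ (T ℤ.- + 2)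
      (ℤ.≤-trans (ℤ.*-monoʳ-≤-nonNeg (+ N) S⁻≤)
        (ℤ.*-monoˡ-≤-nonNeg (T ℤ.- + 2) {{ℤ.nonNegative (ℤ.≤-trans 0≤S⁻ S⁻≤)}} (ℤ.+≤+ (m≤m+n N m)))))
      (near-≼ X≈t)

  t≾S⁺ : t ≾ S⁺ / N″
  t≾S⁺ with S⁺-bound
  ... | inj₁ S⁺≡ = subst (t ≾_) (trans (/-fromℤ N″ (+ n)) (cong (λ z → (z / N″) {{N″≢0}}) (sym S⁺≡))) t≾n
  ... | inj₂ ≤S⁺ = ≾-trans {(T ℤ.+ + 2) / N} {S⁺ / N″} {t} (near-≾ X≈t) (/-mono-≤ N N″ (T ℤ.+ + 2) S⁺
      (ℤ.≤-trans (≤-from (ℤ.+-mono-≤ (ℤ.*-monoʳ-≤-nonNeg (+ m) sum-X≤) (ℤ.*-monoˡ-≤-nonNeg c 1≤N))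
          (trans (lemma T (+ N) (+ m) (+ n) (+ s)) (cong (λ z → (T ℤ.+ z) ℤ.* + N ℤ.- (T ℤ.+ + 2) ℤ.* + N″) (sym +τ))))
        (ℤ.*-monoʳ-≤-nonNeg (+ N) ≤S⁺)))
      where
      c = (+ s ℤ.* + m ℤ.+ + 2) ℤ.* + m
      c-pos : c ≡ + ((s * m + 2) * m)
      c-pos = sym (trans (ℤ.pos-* (s * m + 2) m) (cong (λ z → (z ℤ.+ + 2) ℤ.* + m) (ℤ.pos-* s m)))
      instance
        c≥0 : ℤ.NonNegative c
        c≥0 = ℤ.nonNegative (subst (+ 0 ℤ.≤_) (sym c-pos) (ℤ.+≤+ z≤n))
      1≤N : + 1 ℤ.≤ + N
      1≤N = ℤ.+≤+ (>-nonZero⁻¹ N)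
      +τ : + τ ≡ + 2 ℤ.+ (+ n ℤ.* + m ℤ.+ c)
      +τ = cong (λ z → + 2 ℤ.+ z) (trans (cong₂ ℤ._+_ (ℤ.pos-* n m) (sym c-pos)) refl)
      lemma : ∀ T N m n s → (n ℤ.* N ℤ.+ s ℤ.* m) ℤ.* m ℤ.+ (s ℤ.* m ℤ.+ + 2) ℤ.* m ℤ.* N ℤ.-
                              (T ℤ.* m ℤ.+ (s ℤ.* m ℤ.+ + 2) ℤ.* m ℤ.* + 1) ≡
              (T ℤ.+ (+ 2 ℤ.+ (n ℤ.* m ℤ.+ (s ℤ.* m ℤ.+ + 2) ℤ.* m))) ℤ.* N ℤ.- (T ℤ.+ + 2) ℤ.* (N ℤ.+ m)
      lemma = solve-ℤ

  D : ℕ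
  D = ℤ.∣ S⁺ ℤ.- S⁻ ∣

  +D : + D ≡ S⁺ ℤ.- S⁻
  +D = ℤ.0≤i⇒+∣i∣≡i (ℤ.i≤j⇒0≤j-i (ℤ.≤-trans (ℤ.i≤i+j S⁻ (+ 1)) S⁻<S⁺))

  instance
    D≢0 : NonZero D
    D≢0 = >-nonZero (ℤ.drop‿+≤+ (subst (+ 1 ℤ.≤_) (sym +D) (≤-from S⁻<S⁺ (lemma S⁻ S⁺))))
      where
      lemma : ∀ a b → b ℤ.- (a ℤ.+ + 1) ≡ b ℤ.- a ℤ.- + 1
      lemma = solve-ℤ

  Δ : Fin s → ℤ
  Δ i = lookup Y⁺ i ℤ.- lookup Y⁻ i

  0≤Δ : ∀ i → + 0 ℤ.≤ Δ i
  0≤Δ i = ℤ.i≤j⇒0≤j-i (Y⁻≤Y⁺ i)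

  Δ≤D : ∀ i → Δ i ℤ.≤ + D
  Δ≤D i = subst (Δ i ℤ.≤_) (sym +D) (≤-from
    (sum-gap (Δ i) Y⁻ Y⁺ i Y⁻≤Y⁺ (ℤ.≤-reflexive (lemma (lookup Y⁻ i) (lookup Y⁺ i))))
    (lemma′ S⁻ S⁺ (Δ i)))
    where
    lemma : ∀ a b → a ℤ.+ (b ℤ.- a) ≡ b
    lemma = solve-ℤ
    lemma′ : ∀ a b c → b ℤ.- (a ℤ.+ c) ≡ b ℤ.- a ℤ.- c
    lemma′ = solve-ℤ

  weight : Fin s → ℚ
  weight i = Δ i / D

  0≤weight : ∀ i → 0ℚ ℚ.≤ weight i
  0≤weight i = /-mono-≤ 1 D (+ 0) (Δ i) (subst₂ ℤ._≤_ (sym (ℤ.*-zeroˡ (+ D))) (sym (ℤ.*-identityʳ (Δ i))) (0≤Δ i))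

  weight≤1 : ∀ i → weight i ℚ.≤ 1ℚ
  weight≤1 i = /-mono-≤ D 1 (Δ i) (+ 1) (subst₂ ℤ._≤_ (sym (ℤ.*-identityʳ (Δ i))) (sym (ℤ.*-identityˡ (+ D))) (Δ≤D i))

  -- The coordinates at level t of the line through Y⁻ / N″ and Y⁺ / N″.
  coord : Fin s → ℝ
  coord i = fromℚ (lookup Y⁻ i / N″) +ᴿ scale (weight i) (0≤weight i) (weight≤1 i) (t -ᴿ fromℚ (S⁻ / N″))

  module Grained (K : ℕ) (K≢0 : NonZero K) where
    instance
      K≢0′ : NonZero K
      K≢0′ = K≢0
      N″K≢0 : NonZero (N″ * K)
      N″K≢0 = m*n≢0 N″ K
      Q≢0 : NonZero (D * (N″ * K))
      Q≢0 = m*n≢0 D (N″ * K)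

    Q : ℕ
    Q = D * (N″ * K)

    -- Numerator over D · N″ · K of the i-th interpolated coordinate when t is replaced by θ / (N″ ·
    -- K).
    F : ℤ → Fin s → ℤ
    F θ i = lookup Y⁻ i ℤ.* (+ D ℤ.* + K) ℤ.+ Δ i ℤ.* (θ ℤ.- S⁻ ℤ.* + K)

    private
      S⁻/ : S⁻ / N″ ≡ (S⁻ ℤ.* + K) / (N″ * K)
      S⁻/ = /-cross N″ (N″ * K) S⁻ (S⁻ ℤ.* + K)
        (trans (cong (λ z → S⁻ ℤ.* z) (ℤ.pos-* N″ K)) (lemma S⁻ (+ N″) (+ K)))
        where
        lemma : ∀ a n k → a ℤ.* (n ℤ.* k) ≡ a ℤ.* k ℤ.* n
        lemma = solve-ℤ

      Y⁻/ : ∀ i → lookup Y⁻ i / N″ ≡ (lookup Y⁻ i ℤ.* (+ D ℤ.* + K)) / (D * (N″ * K))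
      Y⁻/ i = /-cross N″ (D * (N″ * K)) (lookup Y⁻ i) (lookup Y⁻ i ℤ.* (+ D ℤ.* + K))
        (trans (cong (λ z → lookup Y⁻ i ℤ.* z) (trans (ℤ.pos-* D (N″ * K)) (cong (λ z → + D ℤ.* z) (ℤ.pos-* N″ K))))
               (lemma (lookup Y⁻ i) (+ D) (+ N″) (+ K)))
        where
        lemma : ∀ a d n k → a ℤ.* (d ℤ.* (n ℤ.* k)) ≡ a ℤ.* (d ℤ.* k) ℤ.* n
        lemma = solve-ℤ

      t₀ : ℝ
      t₀ = t -ᴿ fromℚ (S⁻ / N″)

    coord-≼ : ∀ θ i → θ / (N″ * K) ≼ t → F θ i / (D * (N″ * K)) ≼ coord i
    coord-≼ θ i θ≼t = ≼-/+ (D * (N″ * K)) {lookup Y⁻ i ℤ.* (+ D ℤ.* + K)} {Δ i ℤ.* (θ ℤ.- S⁻ ℤ.* + K)}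
        {fromℚ (lookup Y⁻ i / N″)} {scale (weight i) (0≤weight i) (weight≤1 i) t₀}
      (subst (_≼ fromℚ (lookup Y⁻ i / N″)) (Y⁻/ i) ≼-fromℚ)
      (subst (_≼ scale (weight i) (0≤weight i) (weight≤1 i) t₀) (/-* D (N″ * K) (Δ i) (θ ℤ.- S⁻ ℤ.* + K))
        (≼-scale (0≤weight i) (weight≤1 i) {(θ ℤ.- S⁻ ℤ.* + K) / (N″ * K)} t₀
          (≼-/- (N″ * K) {θ} {S⁻ ℤ.* + K} {t} {fromℚ (S⁻ / N″)} θ≼t (subst (fromℚ (S⁻ / N″) ≾_) S⁻/ fromℚ-≾))))

    coord-≾ : ∀ θ i → t ≾ θ / (N″ * K) → coord i ≾ F θ i / (D * (N″ * K))
    coord-≾ θ i t≾θ = ≾-/+ (D * (N″ * K)) {lookup Y⁻ i ℤ.* (+ D ℤ.* + K)} {Δ i ℤ.* (θ ℤ.- S⁻ ℤ.* + K)}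
        {fromℚ (lookup Y⁻ i / N″)} {scale (weight i) (0≤weight i) (weight≤1 i) t₀}
      (subst (fromℚ (lookup Y⁻ i / N″) ≾_) (Y⁻/ i) fromℚ-≾)
      (subst (scale (weight i) (0≤weight i) (weight≤1 i) t₀ ≾_) (/-* D (N″ * K) (Δ i) (θ ℤ.- S⁻ ℤ.* + K))
        (≾-scale (0≤weight i) (weight≤1 i) {(θ ℤ.- S⁻ ℤ.* + K) / (N″ * K)} t₀
          (≾-/- (N″ * K) {θ} {S⁻ ℤ.* + K} {t} {fromℚ (S⁻ / N″)} t≾θ (subst (_≼ fromℚ (S⁻ / N″)) S⁻/ ≼-fromℚ))))

    S⁻K≼t : (S⁻ ℤ.* + K) / (N″ * K) ≼ t
    S⁻K≼t = subst (_≼ t) S⁻/ S⁻≼t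

    t≾S⁺K : t ≾ (S⁺ ℤ.* + K) / (N″ * K)
    t≾S⁺K = subst (t ≾_) (/-cross N″ (N″ * K) S⁺ (S⁺ ℤ.* + K)
        (trans (cong (λ z → S⁺ ℤ.* z) (ℤ.pos-* N″ K)) (lemma S⁺ (+ N″) (+ K)))) t≾S⁺
      where
      lemma : ∀ a n k → a ℤ.* (n ℤ.* k) ≡ a ℤ.* k ℤ.* n
      lemma = solve-ℤ

    F-near : ∀ {θ e} i → Near (N″ * K) e θ t → Near (D * (N″ * K)) (D * e) (F θ i) (coord i)
    F-near {θ} {e} i θ≈t = near
      (≼-trans {(F θ i ℤ.- + (D * e)) / (D * (N″ * K))} {F (θ ℤ.- + e) i / (D * (N″ * K))} {coord i}
        (/-monoˡ (D * (N″ * K)) {F θ i ℤ.- + (D * e)} {F (θ ℤ.- + e) i}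
          (≤-from Δe≤De (lemma (lookup Y⁻ i ℤ.* (+ D ℤ.* + K)) (Δ i) θ (S⁻ ℤ.* + K) (+ e) (+ (D * e)))))
        (coord-≼ (θ ℤ.- + e) i (near-≼ θ≈t)))
      (≾-trans {F (θ ℤ.+ + e) i / (D * (N″ * K))} {(F θ i ℤ.+ + (D * e)) / (D * (N″ * K))} {coord i}
        (coord-≾ (θ ℤ.+ + e) i (near-≾ θ≈t))
        (/-monoˡ (D * (N″ * K)) {F (θ ℤ.+ + e) i} {F θ i ℤ.+ + (D * e)}
          (≤-from Δe≤De (lemma′ (lookup Y⁻ i ℤ.* (+ D ℤ.* + K)) (Δ i) θ (S⁻ ℤ.* + K) (+ e) (+ (D * e))))))
      where
      Δe≤De : Δ i ℤ.* + e ℤ.≤ + (D * e)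
      Δe≤De = subst (Δ i ℤ.* + e ℤ.≤_) (sym (ℤ.pos-* D e)) (ℤ.*-monoʳ-≤-nonNeg (+ e) (Δ≤D i))
      lemma : ∀ y D θ s e E → E ℤ.- D ℤ.* e ≡ y ℤ.+ D ℤ.* (θ ℤ.- e ℤ.- s) ℤ.- (y ℤ.+ D ℤ.* (θ ℤ.- s) ℤ.- E)
      lemma = solve-ℤ
      lemma′ : ∀ y D θ s e E → E ℤ.- D ℤ.* e ≡ y ℤ.+ D ℤ.* (θ ℤ.- s) ℤ.+ E ℤ.- (y ℤ.+ D ℤ.* (θ ℤ.+ e ℤ.- s))
      lemma′ = solve-ℤ

    module _ (θ : ℤ) (S⁻K≤θ : S⁻ ℤ.* + K ℤ.≤ θ) (θ≤S⁺K : θ ℤ.≤ S⁺ ℤ.* + K) where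
      private
        α β : ℤ
        α = S⁺ ℤ.* + K ℤ.- θ
        β = θ ℤ.- S⁻ ℤ.* + K
        0≤α : + 0 ℤ.≤ α
        0≤α = ℤ.i≤j⇒0≤j-i θ≤S⁺K
        0≤β : + 0 ℤ.≤ β
        0≤β = ℤ.i≤j⇒0≤j-i S⁻K≤θ
        DK : + D ℤ.* + K ≡ α ℤ.+ β
        DK = trans (cong (ℤ._* + K) +D) (lemma S⁺ S⁻ θ (+ K))
          where
          lemma : ∀ p q θ k → (p ℤ.- q) ℤ.* k ≡ p ℤ.* k ℤ.- θ ℤ.+ (θ ℤ.- q ℤ.* k)
          lemma = solve-ℤ
        F≡ : ∀ i → F θ i ≡ lookup Y⁻ i ℤ.* α ℤ.+ lookup Y⁺ i ℤ.* β
        F≡ i = trans (cong (λ z → lookup Y⁻ i ℤ.* z ℤ.+ Δ i ℤ.* β) DK) (lemma (lookup Y⁻ i) (lookup Y⁺ i) α β)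
          where
          lemma : ∀ x y α β → x ℤ.* (α ℤ.+ β) ℤ.+ (y ℤ.- x) ℤ.* β ≡ x ℤ.* α ℤ.+ y ℤ.* β
          lemma = solve-ℤ
        total-scale : ∀ c → c ℤ.* + N″ ℤ.* (α ℤ.+ β) ≡ c ℤ.* + (D * (N″ * K)) ℤ.- (ℤ.- + 0)
        total-scale c = trans (cong (λ z → c ℤ.* + N″ ℤ.* z) (sym DK)) (trans (lemma c (+ N″) (+ D) (+ K))
          (cong (λ z → c ℤ.* z ℤ.- (ℤ.- + 0)) (sym (trans (ℤ.pos-* D (N″ * K)) (cong (λ z → + D ℤ.* z) (ℤ.pos-* N″ K))))))
          where
          lemma : ∀ c n d k → c ℤ.* n ℤ.* (d ℤ.* k) ≡ c ℤ.* (d ℤ.* (n ℤ.* k)) ℤ.- (ℤ.- + 0)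
          lemma = solve-ℤ

      line : Vec ℤ s
      line = Vec.tabulate (F θ)

      -- The i-th entry is Y⁻ᵢ · α + Y⁺ᵢ · β with nonnegative α and β adding up to D · K, so every
      -- facet inequality is a combination of those of the two end points.
      line-∈ : DilatedCL (D * (N″ * K)) (ℤ.- + 0) a l line
      line-∈ i =
          subst (+ 0 ℤ.≤_) (sym (line≡ i)) (ℤ.+-mono-≤
            (subst (ℤ._≤ lookup Y⁻ i ℤ.* α) (ℤ.*-zeroˡ α) (ℤ.*-monoʳ-≤-nonNeg α {{ℤ.nonNegative 0≤α}} (0≤Y⁻ i)))
            (subst (ℤ._≤ lookup Y⁺ i ℤ.* β) (ℤ.*-zeroˡ β) (ℤ.*-monoʳ-≤-nonNeg β {{ℤ.nonNegative 0≤β}} (ℤ.≤-trans (0≤Y⁻ i) (Y⁻≤Y⁺ i)))))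
        , subst₂ ℤ._≤_ (sym (line≡ i)) (total-scale (+ lookup a i))
            (convex-≤ 0≤α 0≤β (ℤ.≤-trans (Y⁻≤Y⁺ i) (Y⁺≤aN″ i)) (Y⁺≤aN″ i))
        , subst₂ ℤ._≤_ (trans (lemma (lookup Y⁻ i) (lookup Y⁻ (next i)) (lookup Y⁺ i) (lookup Y⁺ (next i)) α β)
                              (sym (cong₂ ℤ._-_ (line≡ i) (line≡ (next i)))))
            (total-scale (+ lookup a i ℤ.- + l))
            (convex-≤ 0≤α 0≤β (Y⁻-step i) (Y⁺-step i))
        where
        line≡ : ∀ i → lookup line i ≡ lookup Y⁻ i ℤ.* α ℤ.+ lookup Y⁺ i ℤ.* β
        line≡ i = trans (Vec.lookup∘tabulate (F θ) i) (F≡ i)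
        lemma : ∀ x x′ y y′ α β → (x ℤ.- x′) ℤ.* α ℤ.+ (y ℤ.- y′) ℤ.* β ≡ x ℤ.* α ℤ.+ y ℤ.* β ℤ.- (x′ ℤ.* α ℤ.+ y′ ℤ.* β)
        lemma = solve-ℤ

      line-chart : chartℤ (+ D ℤ.* θ) (Vec.tabulate (F θ ∘ suc)) ≡ line
      line-chart = trans (cong (λ z → chartℤ z (Vec.tabulate (F θ ∘ suc))) (sym (trans (sum-line Y⁻ Y⁺ (+ D ℤ.* + K) β)
          (trans (cong (λ z → S⁻ ℤ.* (+ D ℤ.* + K) ℤ.+ z ℤ.* β) (sym +D)) (lemma S⁻ (+ D) (+ K) θ)))))
        (chartℤ-tail line)
        where
        lemma : ∀ s d k θ → s ℤ.* (d ℤ.* k) ℤ.+ d ℤ.* (θ ℤ.- s ℤ.* k) ≡ d ℤ.* θ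
        lemma = solve-ℤ

    -- A rounded level may leave the interval between the two end levels although t does not, and
    -- then α or β would be negative. Clamping moves it by at most 2 more, which gives the error 4.
    clamp : ℤ → ℤ
    clamp θ = (S⁻ ℤ.* + K) ℤ.⊔ (θ ℤ.⊓ (S⁺ ℤ.* + K))

    module _ {θ} (θ≈t : Near (N″ * K) 2 θ t) where
      private
        S⁻K≤ : S⁻ ℤ.* + K ℤ.≤ θ ℤ.+ + 2
        S⁻K≤ = /-cancelˡ (N″ * K) (S⁻ ℤ.* + K) (θ ℤ.+ + 2) (≼∧≾⇒≤ {_} {_} {t} S⁻K≼t (near-≾ θ≈t))
        ≤S⁺K : θ ℤ.- + 2 ℤ.≤ S⁺ ℤ.* + K
        ≤S⁺K = /-cancelˡ (N″ * K) (θ ℤ.- + 2) (S⁺ ℤ.* + K) (≼∧≾⇒≤ {_} {_} {t} (near-≼ θ≈t) t≾S⁺K)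

      S⁻K≤clamp : S⁻ ℤ.* + K ℤ.≤ clamp θ
      S⁻K≤clamp = ℤ.i≤i⊔j (S⁻ ℤ.* + K) _

      clamp≤S⁺K : clamp θ ℤ.≤ S⁺ ℤ.* + K
      clamp≤S⁺K = ℤ.⊔-lub (ℤ.*-monoʳ-≤-nonNeg (+ K) (ℤ.≤-trans (ℤ.i≤i+j S⁻ (+ 1)) S⁻<S⁺)) (ℤ.i⊓j≤j θ _)

      clamp-near : Near (N″ * K) 4 (clamp θ) t
      clamp-near = near
        (≼-trans {(clamp θ ℤ.- + 4) / (N″ * K)} {(θ ℤ.- + 2) / (N″ * K)} {t}
          (/-monoˡ (N″ * K) {clamp θ ℤ.- + 4} {θ ℤ.- + 2}
            (≤-from (ℤ.⊔-lub S⁻K≤ (ℤ.≤-trans (ℤ.i⊓j≤i θ _) (ℤ.i≤i+j θ (+ 2)))) (lemma (clamp θ) θ))) (near-≼ θ≈t))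
        (≾-trans {(θ ℤ.+ + 2) / (N″ * K)} {(clamp θ ℤ.+ + 4) / (N″ * K)} {t} (near-≾ θ≈t)
          (/-monoˡ (N″ * K) {θ ℤ.+ + 2} {clamp θ ℤ.+ + 4}
            (≤-from (ℤ.≤-trans (ℤ.⊓-glb (ℤ.i≤j⇒i-k≤j (+ 2) ℤ.≤-refl) ≤S⁺K) (ℤ.i≤j⊔i (S⁻ ℤ.* + K) _)) (lemma′ (clamp θ) θ))))
        where
        lemma : ∀ c θ → θ ℤ.+ + 2 ℤ.- c ≡ θ ℤ.- + 2 ℤ.- (c ℤ.- + 4)
        lemma = solve-ℤ
        lemma′ : ∀ c θ → c ℤ.- (θ ℤ.- + 2) ≡ c ℤ.+ + 4 ℤ.- (θ ℤ.+ + 2)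
        lemma′ = solve-ℤ

  point : Vec ℝ d
  point = Vec.tabulate (coord ∘ suc)

  -- Grid points on the segment exist only at rational levels. As K grows the mesh shrinks while the
  -- error, counted in grid steps, stays the same, so `CL-limit` applies to the real level t.
  point-CL : CL a l (chart t point)
  point-CL = CL-limit a l 0 (D * 4 + d * (D * 4)) (chart t point) λ K → grained K (nearby (N″ * suc K) {{m*n≢0 N″ (suc K)}} t)
    where
    grained : ∀ K → ∃[ θ ] Near (N″ * suc K) {{m*n≢0 N″ (suc K)}} 2 θ t → _
    grained K (θ , θ≈t) = D * (N″ * suc K) , Q≢0 , line θ′ lo hi , K≤Q , line-∈ θ′ lo hi
      , subst (λ P → ∀ i → Near (D * (N″ * suc K)) (D * 4 + d * (D * 4)) (lookup P i) (lookup (chart t point) i))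
          (line-chart θ′ lo hi)
          (near-chart (D * (N″ * suc K)) {D * 4} {D * 4} {d} {+ D ℤ.* θ′} {t}
            (Vec.tabulate (F θ′ ∘ suc)) point (near-scale D (N″ * suc K) θ′≈t) points-near)
      where
      open Grained (suc K) _
      θ′ = clamp θ
      lo = S⁻K≤clamp {θ} θ≈t
      hi = clamp≤S⁺K {θ} θ≈t
      θ′≈t = clamp-near {θ} θ≈t
      points-near : ∀ j → Near (D * (N″ * suc K)) (D * 4) (lookup (Vec.tabulate (F θ′ ∘ suc)) j) (lookup point j)
      points-near j = subst₂ (Near (D * (N″ * suc K)) (D * 4))
        (sym (Vec.lookup∘tabulate (F θ′ ∘ suc) j)) (sym (Vec.lookup∘tabulate (coord ∘ suc) j)) (F-near (suc j) θ′≈t)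
      K≤Q : K ≤ D * (N″ * suc K)
      K≤Q = ≤-trans (n≤1+n K) (≤-trans (m≤n*m (suc K) N″) (m≤n*m (N″ * suc K) D))

  Y⁻≼coord : ∀ i → lookup Y⁻ i / N″ ≼ coord i
  Y⁻≼coord i = subst (_≼ coord i) (/-cross (D * (N″ * 1)) N″ (F (S⁻ ℤ.* + 1) i) (lookup Y⁻ i)
      (trans (lemma (lookup Y⁻ i) (Δ i) (+ D) S⁻ (+ N″))
             (cong (λ z → lookup Y⁻ i ℤ.* z) (sym (trans (ℤ.pos-* D (N″ * 1)) (cong (λ z → + D ℤ.* z) (ℤ.pos-* N″ 1)))))))
    (coord-≼ (S⁻ ℤ.* + 1) i S⁻K≼t)
    where
    open Grained 1 _
    lemma : ∀ y δ d s n → (y ℤ.* (d ℤ.* + 1) ℤ.+ δ ℤ.* (s ℤ.* + 1 ℤ.- s ℤ.* + 1)) ℤ.* n ≡ y ℤ.* (d ℤ.* (n ℤ.* + 1))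
    lemma = solve-ℤ

  coord≾Y⁺ : ∀ i → coord i ≾ lookup Y⁺ i / N″
  coord≾Y⁺ i = subst (coord i ≾_) (/-cross (D * (N″ * 1)) N″ (F (S⁺ ℤ.* + 1) i) (lookup Y⁺ i)
      (trans (cong (λ z → (lookup Y⁻ i ℤ.* (z ℤ.* + 1) ℤ.+ Δ i ℤ.* (S⁺ ℤ.* + 1 ℤ.- S⁻ ℤ.* + 1)) ℤ.* + N″) +D)
        (trans (lemma (lookup Y⁻ i) (lookup Y⁺ i) S⁺ S⁻ (+ N″))
          (cong (λ z → lookup Y⁺ i ℤ.* z) (sym (trans (ℤ.pos-* D (N″ * 1)) (cong₂ ℤ._*_ +D (ℤ.pos-* N″ 1))))))))
    (coord-≾ (S⁺ ℤ.* + 1) i t≾S⁺K)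
    where
    open Grained 1 _
    lemma : ∀ y y′ p q n → (y ℤ.* ((p ℤ.- q) ℤ.* + 1) ℤ.+ (y′ ℤ.- y) ℤ.* (p ℤ.* + 1 ℤ.- q ℤ.* + 1)) ℤ.* n ≡
                           y′ ℤ.* ((p ℤ.- q) ℤ.* (n ℤ.* + 1))
    lemma = solve-ℤ

-- Real points in grid cubes, and the covering of reflected corners

¬≤ᴿ⇒≥ᴿ : ∀ x y → ¬ (x ≤ᴿ y) → y ≤ᴿ x
¬≤ᴿ⇒≥ᴿ x y x≰y n with approx y n ℚ.≤? approx x n ℚ.+ (2⁻ n ℚ.+ 2⁻ n)
... | yes p = p
... | no ¬p = contradiction
  (≾∧≼⇒≤ᴿ {approx x n ℚ.+ 2⁻ n} {approx y n ℚ.- 2⁻ n} {x} {y} (approx-≾ x n)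
    (≤-fromℚ (ℚ.<⇒≤ (ℚ.≰⇒> ¬p)) (lemma (approx x n) (approx y n) (2⁻ n))) (approx-≼ y n)) x≰y
  where
  lemma : ∀ x y e → y ℚ.- (x ℚ.+ (e ℚ.+ e)) ≡ y ℚ.- e ℚ.- (x ℚ.+ e)
  lemma = solve 3 (λ x y e → y :- (x :+ (e :+ e)) := y :- e :- (x :+ e)) refl

module _ (N : ℕ) .{{_ : NonZero N}} where

  -- A cell containing x is found by climbing from the lower bound (T − 2) / N past the upper bound.
  ¬¬-cell : ∀ x → ¬ ¬ (∃[ z ] (fromℚ (z / N) ≤ᴿ x) × (x ≤ᴿ fromℚ (ℤ.suc z / N)))
  ¬¬-cell x no-cell = climb (nearby N x)
    where
    climb : ∃[ T ] Near N 2 T x → _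
    climb (T , T≈x) = reach 5 λ p → contradiction
        (/-cancelˡ N (height 5) (T ℤ.+ + 2) (≼∧≾⇒≤ {_} {_} {x} (≼∧≤ᴿ⇒≼ {height 5 / N} {fromℚ (height 5 / N)} {x} ≼-fromℚ p) (near-≾ T≈x)))
        (ℤ.<⇒≱ (subst (T ℤ.+ + 2 ℤ.<_) (lemma T) (ℤ.suc[i]≤j⇒i<j ℤ.≤-refl)))
      where
      height : ℕ → ℤ
      height zero    = T ℤ.- + 2
      height (suc k) = ℤ.suc (height k)
      lemma : ∀ T → + 1 ℤ.+ (T ℤ.+ + 2) ≡ + 1 ℤ.+ (+ 1 ℤ.+ (+ 1 ℤ.+ (+ 1 ℤ.+ (+ 1 ℤ.+ (T ℤ.- + 2)))))
      lemma = solve-ℤ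
      reach : ∀ k → ¬ ¬ (fromℚ (height k / N) ≤ᴿ x)
      reach zero    ¬p = ¬p (≾∧≼⇒≤ᴿ {height 0 / N} {height 0 / N} {fromℚ (height 0 / N)} {x} fromℚ-≾ ℚ.≤-refl (near-≼ T≈x))
      reach (suc k) ¬p = reach k λ p → no-cell (height k , p , ¬≤ᴿ⇒≥ᴿ (fromℚ (height (suc k) / N)) x ¬p)

  ¬¬-cube : ∀ {d} (u : Vec ℝ d) → ¬ ¬ (∃[ z ] Cube N z u)
  ¬¬-cube []      k = k ([] , λ ())
  ¬¬-cube (x ∷ u) k = ¬¬-cell x λ (z , p) → ¬¬-cube u λ (zs , q) →
    k (z ∷ zs , λ { zero → p ; (suc j) → q j })

module _ {d n} (ā : Composition n (suc d)) (l : ℕ) {x : Vec ℝ (suc d)} {t : ℝ} where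
  private
    a = parts ā

  level-bounds : CL a l x → sumᴿ x ≃ t → ((+ 0 / 1) ≼ t) × (t ≾ (+ n / 1))
  level-bounds cl (Σ≤t , t≤Σ) =
      subst (λ z → (z / 1) ≼ t) (sum-replicate (suc d)) (≼∧≤ᴿ⇒≼ {_} {sumᴿ x} {t}
        (≼-sum 1 zeros′ x λ i → subst (λ z → (z / 1) ≼ lookup x i) (sym (Vec.lookup-replicate i (+ 0)))
          (≼∧≤ᴿ⇒≼ {_} {0ᴿ} {lookup x i} (fromℤ-≼ 1 (+ 0)) (proj₁ (cl i)))) Σ≤t)
    , subst (λ z → t ≾ (z / 1)) (trans (sum-nats a (+ 1)) (trans (ℤ.*-identityʳ _) (cong +_ (total ā))))
        (≤ᴿ∧≾⇒≾ {_} {t} {sumᴿ x} t≤Σ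
        (≾-sum 1 full x λ i → subst (λ z → lookup x i ≾ (z / 1)) (sym (Vec.lookup-map i _ a))
          (≤ᴿ∧≾⇒≾ {_} {lookup x i} {fromℤ (+ lookup a i)} (proj₁ (proj₂ (cl i))) (≾-fromℤ 1 (+ lookup a i)))))
    where
    zeros′ full : Vec ℤ (suc d)
    zeros′ = Vec.replicate (suc d) (+ 0)
    full = Vec.map (λ b → + b ℤ.* + 1) a

module Cover {d n} (ā : Composition n (suc d)) (l : ℕ) (1≤l : 1 ≤ l)
    (2l≤a : ∀ i → 2 * l ≤ lookup (parts ā) i) (m : ℕ) (1≤m : 1 ≤ m) where

  a : Vec ℕ (suc d)
  a = parts ā

  C len : ℕ
  -- τ is the same for every N, so 0 serves as its argument. The term (n + 1) · m pays for replacing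
  -- the denominator N · M + m by N · M, given -1 ≤ z ≤ n · N.
  C = Enclosure.τ ā l 1≤l 2l≤a 0 m 1≤m + (n + 1) * m
  -- A margin `C` on both sides, and 1 because windows are half-open whereas cubes are closed.
  len = C + C + 1

  module _ (N M : ℕ) (N≢0 : NonZero N) (M≢0 : NonZero M) (O : List (Vec ℤ d)) (t : ℝ)
           (cover : ∀ z u → Cube N {{N≢0}} z u → CLSection a l t (chart t u) → z ∈ O)
           (X : Vec ℤ (suc d)) (X∈ : DilatedCL (N * M) (ℤ.- + m) a l X)
           (X≈t : Near (N * M) {{m*n≢0 N M {{N≢0}} {{M≢0}}}} 2 (sumℤ X) t)
           (0≼t : (+ 0 / 1) ≼ t) (t≾n : t ≾ (+ n / 1)) where
    open Grid M (ℤ.- + C) (M + len)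
    private
      instance
        _ = N≢0
        _ = M≢0
      N′≢0 = m*n≢0 N M {{N≢0}} {{M≢0}}
      module I = Interpolation ā l 1≤l 2l≤a (N * M) m N′≢0 1≤m X X∈ t X≈t 0≼t t≾n
      open Enclosure ā l 1≤l 2l≤a (N * M) m 1≤m using (N″; τ)
      open Enclosure.Point ā l 1≤l 2l≤a (N * M) m 1≤m X X∈
      instance
        _ = I.N″≢0

      +N″ : + N″ ≡ + N ℤ.* + M ℤ.+ + m
      +N″ = cong (λ z → z ℤ.+ + m) (ℤ.pos-* N M)

    module _ (i : Fin (suc d)) (z : ℤ) (z≤ : fromℚ (z / N) ≤ᴿ I.coord i) (≤z : I.coord i ≤ᴿ fromℚ (ℤ.suc z / N)) where
      private
        x = lookup X i

        zN″≤ : z ℤ.* + N″ ℤ.≤ lookup Y⁺ i ℤ.* + N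
        zN″≤ = /-cancel-≤ N N″ z (lookup Y⁺ i) (≼∧≾⇒≤ {_} {_} {I.coord i}
          (≼∧≤ᴿ⇒≼ {z / N} {fromℚ (z / N)} {I.coord i} ≼-fromℚ z≤) (I.coord≾Y⁺ i))

        ≤zN″ : lookup Y⁻ i ℤ.* + N ℤ.≤ ℤ.suc z ℤ.* + N″
        ≤zN″ = /-cancel-≤ N″ N (lookup Y⁻ i) (ℤ.suc z) (≼∧≾⇒≤ {_} {_} {I.coord i} (I.Y⁻≼coord i)
          (≤ᴿ∧≾⇒≾ {ℤ.suc z / N} {I.coord i} {fromℚ (ℤ.suc z / N)} ≤z fromℚ-≾))

        0≤suc-z : + 0 ℤ.≤ ℤ.suc z
        0≤suc-z = ℤ.*-cancelʳ-≤-pos (+ 0) (ℤ.suc z) (+ N″) {{ℤ.positive (ℤ.+<+ (>-nonZero⁻¹ N″))}}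
          (subst (ℤ._≤ ℤ.suc z ℤ.* + N″) (sym (ℤ.*-zeroˡ (+ N″))) (ℤ.≤-trans
            (subst (ℤ._≤ lookup Y⁻ i ℤ.* + N) (ℤ.*-zeroˡ (+ N)) (ℤ.*-monoʳ-≤-nonNeg (+ N) (0≤Y⁻ i))) ≤zN″))

        z≤nN : z ℤ.≤ + n ℤ.* + N
        z≤nN = ℤ.≤-trans
          (ℤ.*-cancelʳ-≤-pos z (+ lookup a i ℤ.* + N) (+ N″) {{ℤ.positive (ℤ.+<+ (>-nonZero⁻¹ N″))}}
            (ℤ.≤-trans zN″≤ (ℤ.≤-trans (ℤ.*-monoʳ-≤-nonNeg (+ N) (Y⁺≤aN″ i))
              (ℤ.≤-reflexive (lemma (+ lookup a i) (+ N) (+ N″))))))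
          (ℤ.*-monoʳ-≤-nonNeg (+ N) (ℤ.+≤+ (≤-trans (lookup≤sum a i) (≤-reflexive (total ā)))))
          where
          lemma : ∀ a n k → a ℤ.* k ℤ.* n ≡ a ℤ.* n ℤ.* k
          lemma = solve-ℤ

        1≤N : + 1 ℤ.≤ + N
        1≤N = ℤ.+≤+ (>-nonZero⁻¹ N)

        +C : + C ≡ + τ ℤ.+ (+ n ℤ.+ + 1) ℤ.* + m
        +C = cong (λ z → + τ ℤ.+ z) (ℤ.pos-* (n + 1) m)

        cancel-N : ∀ {x y} → x ℤ.* + N ℤ.≤ y ℤ.* + N → x ℤ.≤ y
        cancel-N {x} {y} = ℤ.*-cancelʳ-≤-pos x y (+ N) {{ℤ.positive (ℤ.+<+ (>-nonZero⁻¹ N))}}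

      in-cell : Cell z x
      in-cell = subst (λ c → z ℤ.* + M ℤ.- c ℤ.≤ x) (sym +C) (cancel-N lower-cell)
              , ℤ.≤-<-trans (cancel-N upper-cell) above-cell
        where
        lower-cell : (z ℤ.* + M ℤ.- (+ τ ℤ.+ (+ n ℤ.+ + 1) ℤ.* + m)) ℤ.* + N ℤ.≤ x ℤ.* + N
        lower-cell = ≤-from (ℤ.+-mono-≤ (ℤ.+-mono-≤
            (subst (λ k → z ℤ.* k ℤ.≤ lookup Y⁺ i ℤ.* + N) +N″ zN″≤)
            (ℤ.*-monoʳ-≤-nonNeg (+ N) (Y⁺≤X+τ i)))
            (ℤ.+-mono-≤ (ℤ.*-monoʳ-≤-nonNeg (+ m) 0≤suc-z) (ℤ.+-mono-≤ (ℤ.*-monoˡ-≤-nonNeg (+ m) 1≤N)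
              (ℤ.*-monoʳ-≤-nonNeg (+ N) (ℤ.*-monoʳ-≤-nonNeg (+ m) (ℤ.+≤+ (z≤n {n})))))))
          (lemma z (+ N) (+ M) (+ m) (lookup Y⁺ i) x (+ τ) (+ n))
          where
          lemma : ∀ z N M m y x τ n →
            y ℤ.* N ℤ.+ (x ℤ.+ τ) ℤ.* N ℤ.+ ((+ 1 ℤ.+ z) ℤ.* m ℤ.+ (m ℤ.* N ℤ.+ n ℤ.* m ℤ.* N)) ℤ.-
            (z ℤ.* (N ℤ.* M ℤ.+ m) ℤ.+ y ℤ.* N ℤ.+ (+ 0 ℤ.* m ℤ.+ (m ℤ.* + 1 ℤ.+ + 0 ℤ.* m ℤ.* N))) ≡
            x ℤ.* N ℤ.- (z ℤ.* M ℤ.- (τ ℤ.+ (n ℤ.+ + 1) ℤ.* m)) ℤ.* N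
          lemma = solve-ℤ
        upper-cell : x ℤ.* + N ℤ.≤ (z ℤ.* + M ℤ.+ + M ℤ.+ (+ τ ℤ.+ (+ n ℤ.+ + 1) ℤ.* + m)) ℤ.* + N
        upper-cell = ≤-from (ℤ.+-mono-≤ (ℤ.+-mono-≤
            (subst (λ k → lookup Y⁻ i ℤ.* + N ℤ.≤ ℤ.suc z ℤ.* k) +N″ ≤zN″)
            (ℤ.*-monoʳ-≤-nonNeg (+ N) (X-τ≤Y⁻ i)))
            (ℤ.+-mono-≤ (ℤ.*-monoʳ-≤-nonNeg (+ m) z≤nN) (ℤ.*-monoˡ-≤-nonNeg (+ m) 1≤N)))
          (lemma z (+ N) (+ M) (+ m) (lookup Y⁻ i) x (+ τ) (+ n))
          where
          lemma : ∀ z N M m y x τ n →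
            (+ 1 ℤ.+ z) ℤ.* (N ℤ.* M ℤ.+ m) ℤ.+ y ℤ.* N ℤ.+ (n ℤ.* N ℤ.* m ℤ.+ m ℤ.* N) ℤ.-
            (y ℤ.* N ℤ.+ (x ℤ.- τ) ℤ.* N ℤ.+ (z ℤ.* m ℤ.+ m ℤ.* + 1)) ≡
            (z ℤ.* M ℤ.+ M ℤ.+ (τ ℤ.+ (n ℤ.+ + 1) ℤ.* m)) ℤ.* N ℤ.- x ℤ.* N
          lemma = solve-ℤ
        above-cell : z ℤ.* + M ℤ.+ + M ℤ.+ (+ τ ℤ.+ (+ n ℤ.+ + 1) ℤ.* + m) ℤ.< z ℤ.* + M ℤ.- + C ℤ.+ + (M + len)
        above-cell = subst (λ c → z ℤ.* + M ℤ.+ + M ℤ.+ c ℤ.< z ℤ.* + M ℤ.- + C ℤ.+ + (M + len)) +C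
          (subst (z ℤ.* + M ℤ.+ + M ℤ.+ + C ℤ.<_) (lemma (z ℤ.* + M) (+ M) (+ C)) (ℤ.suc[i]≤j⇒i<j ℤ.≤-refl))
          where
          lemma : ∀ z m c → + 1 ℤ.+ (z ℤ.+ m ℤ.+ c) ≡ z ℤ.- c ℤ.+ (m ℤ.+ (c ℤ.+ c ℤ.+ + 1))
          lemma = solve-ℤ

    -- The cube containing a real point cannot be computed, but membership in a finite list of
    -- integer vectors is decidable and hence stable, so a cube obtained up to double negation is
    -- enough.
    tail-∈ : Vec.tail X ∈ grids O
    tail-∈ = decidable-stable (∈? (Vec.≡-dec ℤ._≟_) (Vec.tail X) (grids O)) λ ∉ →
      ¬¬-cube N I.point λ (z , c) → ∉ (∈-concatMap⁺ grid (lose (cover z I.point c (I.point-CL , sum-chart t I.point))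
        (∈-grid⁺ z (Vec.tail X) λ j → subst (Cell (lookup z j)) (sym (lookup-tail X j))
          (in-cell (suc j) (lookup z j)
            (subst (fromℚ (lookup z j / N) ≤ᴿ_) (Vec.lookup∘tabulate (I.coord ∘ suc) j) (proj₁ (c j)))
            (subst (_≤ᴿ fromℚ (ℤ.suc (lookup z j) / N)) (Vec.lookup∘tabulate (I.coord ∘ suc) j) (proj₂ (c j)))))))

module Outer {d n} (ā : Composition n (suc d)) (l : ℕ) (1≤l : 1 ≤ l)
    (2l≤a : ∀ i → 2 * l ≤ lookup (parts ā) i) {t t′ : ℝ} (tt′ : Complementary n t t′) where
  private
    a = parts ā
    e m : ℕ
    e = 2 + d * 1
    m = e + e
    open module C = Cover ā l 1≤l 2l≤a m (s≤s z≤n) using (C; len)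

  module _ (N M : ℕ) (N≢0 : NonZero N) (M≢0 : NonZero M) (O : List (Vec ℤ d))
           (cover : ∀ z u → Cube N {{N≢0}} z u → CLSection a l t (chart t u) → z ∈ O)
           (T : ℤ) (T≈t : Near (N * M) {{m*n≢0 N M {{N≢0}} {{M≢0}}}} 2 T t) where
    private
      instance
        N′≢0 : NonZero (N * M)
        N′≢0 = m*n≢0 N M {{N≢0}} {{M≢0}}
      open Grid M (ℤ.- + C) (M + len)
      T′ : ℤ
      T′ = + n ℤ.* + (N * M) ℤ.- T
      module R = Reflection (dilated-reflection ā l 2l≤a (N * M) (ℤ.- + m)
        (ℤ.≤-trans (ℤ.neg-≤-pos {m} {l * (N * M)}) (ℤ.≤-reflexive (ℤ.pos-* l (N * M)))))
      g : Vec ℤ d → Vec ℤ d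
      g w = Vec.tail (R.from (chartℤ T w))

    outer-points : ∃[ J ] (∀ z u → Cube (N * M) z u → CLSection a l t′ (chart t′ u) → z ∈ J)
                        × length J ≡ length O * (M + len) ^ d
    outer-points = List.map g (grids O) , covered , trans (List.length-map g (grids O)) (length-grids O)
      where
      covered : ∀ z u → Cube (N * M) z u → CLSection a l t′ (chart t′ u) → z ∈ List.map g (grids O)
      covered z u c (cl , level) = subst (_∈ List.map g (grids O)) g-tail (∈-map⁺ g tail∈)
        where
        Z : Vec ℤ (suc d)
        Z = chartℤ T′ z
        Z∈ : DilatedCL (N * M) (ℤ.- + m) a l Z
        Z∈ = CL⇒DilatedCL (N * M) a l e Z (chart t′ u)
          (near-chart (N * M) {2} {1} {d} {T′} {t′} z u (near-complementary (N * M) {2} {T} tt′ T≈t) (cube-near (N * M) z u c)) cl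
        X : Vec ℤ (suc d)
        X = R.to Z
        sum-X : sumℤ X ≡ T
        sum-X = trans (R.sum-to Z∈) (trans (cong (λ z → + n ℤ.* + (N * M) ℤ.- z) (sum-chartℤ T′ z))
          (lemma (+ n ℤ.* + (N * M)) T))
          where
          lemma : ∀ a b → a ℤ.- (a ℤ.- b) ≡ b
          lemma = solve-ℤ
        -- A point of the complementary section forces 0 ≤ t′ ≤ n, hence 0 ≤ t ≤ n. The
        -- interpolation needs this when all entries are truncated at 0 or at their caps.
        bounds : ((+ 0 / 1) ≼ t′) × (t′ ≾ (+ n / 1))
        bounds = level-bounds ā l {chart t′ u} {t′} cl level
        0≼t : (+ 0 / 1) ≼ t
        0≼t = subst (λ z → (z / 1) ≼ t) (lemma (+ n)) (Complementary.≾′⇒≼ tt′ 1 (+ n) (proj₂ bounds))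
          where
          lemma : ∀ a → a ℤ.* + 1 ℤ.- a ≡ + 0
          lemma = solve-ℤ
        t≾n : t ≾ (+ n / 1)
        t≾n = subst (λ z → t ≾ (z / 1)) (lemma (+ n)) (Complementary.≼′⇒≾ tt′ 1 (+ 0) (proj₁ bounds))
          where
          lemma : ∀ a → a ℤ.* + 1 ℤ.- + 0 ≡ a
          lemma = solve-ℤ
        tail∈ : Vec.tail X ∈ grids O
        tail∈ = C.tail-∈ N M N≢0 M≢0 O t cover X (R.to-∈ Z∈) (subst (λ S → Near (N * M) 2 S t) (sym sum-X) T≈t) 0≼t t≾n
        g-tail : g (Vec.tail X) ≡ z
        g-tail = cong Vec.tail (trans (cong R.from (trans (cong (λ S → chartℤ S (Vec.tail X)) (sym sum-X)) (chartℤ-tail X)))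
                                      (R.from∘to Z∈))

  outer : ∀ {q} → upper (relVolume t (CLSection (parts ā) l t)) q → upper (relVolume t′ (CLSection (parts ā) l t′)) q
  outer {q} (N , N≢0 , O , cover , v<q) =
    let M , M≢0 , v<q′ = thicken d q N (length O) len {{N≢0}} v<q
        T , T≈t = nearby (N * M) {{m*n≢0 N M {{N≢0}} {{M≢0}}}} t
        J , covered , |J| = outer-points N M N≢0 M≢0 O cover T T≈t
    in N * M , m*n≢0 N M {{N≢0}} {{M≢0}} , J , covered
     , subst (λ c → cubesVolume d (N * M) {{m*n≢0 N M {{N≢0}} {{M≢0}}}} c ℚ.< q) (sym |J|) v<q′

-- For d = 0 the section is a point, which cannot be moved as in slack.
module Pointlike {d n} (ā : Composition n (suc d)) (l : ℕ) (2l≤a : ∀ i → 2 * l ≤ lookup (parts ā) i)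
                 {t t′ : ℝ} (tt′ : Complementary n t t′) (empty : ¬ Fin d) where
  private
    a = parts ā
    e : ℕ
    e = 2 + d * 0

    module Approximation (u : Vec ℝ d) (cl : CL a l (chart t u)) (N : ℕ) (N≢0 : NonZero N)
                         (T : ℤ) (T≈t : Near N {{N≢0}} 2 T t) where
      instance
        N≢0′ : NonZero N
        N≢0′ = N≢0

      near-any : ∀ {T x} (w : Vec ℤ d) → Near N 2 T x → ∀ i → Near N e (lookup (chartℤ T w) i) (lookup (chart x u) i)
      near-any {T} {x} w T≈x = near-chart N {2} {0} {d} {T} {x} w u T≈x λ j → contradiction j empty

      X : Vec ℤ (suc d)
      X = chartℤ T (Vec.replicate d (+ 0))

      X∈ : DilatedCL N (ℤ.- + (e + e)) a l X
      X∈ = CL⇒DilatedCL N a l e X (chart t u) (near-any {T} {t} (Vec.replicate d (+ 0)) T≈t) cl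

      module R = Reflection (dilated-reflection ā l 2l≤a N (ℤ.- + (e + e))
        (ℤ.≤-trans (ℤ.neg-≤-pos {e + e} {l * N}) (ℤ.≤-reflexive (ℤ.pos-* l N))))

      to-X : chartℤ (+ n ℤ.* + N ℤ.- T) (Vec.tail (R.to X)) ≡ R.to X
      to-X = trans (cong (λ S → chartℤ S (Vec.tail (R.to X)))
          (sym (trans (R.sum-to X∈) (cong (λ z → + n ℤ.* + N ℤ.- z) (sum-chartℤ T (Vec.replicate d (+ 0)))))))
        (chartℤ-tail (R.to X))

      to-X-near : ∀ i → Near N e (lookup (R.to X) i) (lookup (chart t′ u) i)
      to-X-near = subst (λ Y → ∀ i → Near N e (lookup Y i) (lookup (chart t′ u) i)) to-X
        (near-any {+ n ℤ.* + N ℤ.- T} {t′} (Vec.tail (R.to X)) (near-complementary N {2} {T} tt′ T≈t))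

    -- A section without free coordinates is determined by its level. The reflected grid points
    -- therefore converge to the only candidate at level t′, and the polytope is closed.
    reflect-point : ∀ u → CL a l (chart t u) → CL a l (chart t′ u)
    reflect-point u cl = CL-limit a l (e + e) e (chart t′ u) λ K →
      let T , T≈t = nearby (suc K) t
          open Approximation u cl (suc K) _ T T≈t
      in suc K , _ , R.to X , n≤1+n K , R.to-∈ X∈ , to-X-near

  lower-⊆₀ : ∀ {q} → lower (relVolume t (CLSection (parts ā) l t)) q → lower (relVolume t′ (CLSection (parts ā) l t′)) q
  lower-⊆₀ (N , N≢0 , I , I! , I⊆ , q<v) = N , N≢0 , I , I!
    , All.map (λ p u c → reflect-point u (proj₁ (p u c)) , sum-chart t′ u) I⊆ , q<v

¬Fin⊎suc : ∀ d → (¬ Fin d) ⊎ (∃[ d′ ] d ≡ suc d′)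
¬Fin⊎suc zero    = inj₁ λ ()
¬Fin⊎suc (suc d) = inj₂ (d , refl)

module _ {d n} (ā : Composition n (suc d)) (l : ℕ) (1≤l : 1 ≤ l)
         (2l≤a : ∀ i → 2 * l ≤ lookup (parts ā) i) {t t′} (tt′ : Complementary n t t′) where

  lower-⊆ : ∀ {q} → lower (relVolume t (CLSection (parts ā) l t)) q → lower (relVolume t′ (CLSection (parts ā) l t′)) q
  lower-⊆ {q} v = [ (λ empty → Pointlike.lower-⊆₀ ā l 2l≤a {t} {t′} tt′ empty {q} v)
                  , (λ (_ , d≡) → inner ā l 1≤l 2l≤a {t = t} {t′} {q} d≡ tt′ v) ]′ (¬Fin⊎suc d)

theorem4p8 :
  ∀ {d n : ℕ} (ā : Composition n (suc d)) (l : ℕ) →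
  1 ≤ l →
  (∀ (i : Fin (suc d)) → 2 * l ≤ lookup (parts ā) i) →
  ∀ (t : ℝ) → 0ᴿ <ᴿ t →
  let CLᵗ   = CLSection (parts ā) l t
      CLⁿ⁻ᵗ = CLSection (parts ā) l (fromℤ (+ n) -ᴿ t)
  in
  (relVolume t CLᵗ ≈ᶜ relVolume (fromℤ (+ n) -ᴿ t) CLⁿ⁻ᵗ)
  ×
  (∀ (k : ℕ) → 1 ≤ k →
     LatticePoints (dilate k CLᵗ) ≅ LatticePoints (dilate k CLⁿ⁻ᵗ))
theorem4p8 {n = n} ā l 1≤l 2l≤a t _ =
    ( ((λ {q} → lower-⊆ ā l 1≤l 2l≤a {t} {t′} c {q}) , (λ {q} → lower-⊆ ā l 1≤l 2l≤a {t′} {t} c′ {q}))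
    , ((λ {q} → Outer.outer ā l 1≤l 2l≤a {t} {t′} c {q}) , (λ {q} → Outer.outer ā l 1≤l 2l≤a {t′} {t} c′ {q})) )
  , lattice-points ā l 2l≤a {t} {t′} c
  where
  t′ : ℝ
  t′ = fromℤ (+ n) -ᴿ t
  c : Complementary n t t′
  c = complementary n t
  c′ : Complementary n t′ t
  c′ = complementary-sym c
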